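{- For every $\vec{s}\in S$ and every $\varepsilon>0$, there is a 4-regular graph gadget with signature $\vec{s}'$ such that $\|\vec{s}-\vec{s}'\|_1\le\varepsilon$.
   Context: The set $S\subseteq\mathbb{R}^3$ consists of all vectors $P(\alpha,\beta,\gamma)^{\mathrm T}$, where $P$ is a $3\times3$ permutation matrix, $\alpha\ge\beta\ge\gamma\ge0$, $\alpha+\beta+\gamma=1$, and $\gamma\ge f(\beta)$, where $f(x)=\frac12(1-x)\bigl(1-\exp(2x/(x-1))\bigr)$. A 4-regular graph gadget is a finite undirected graph (parallel edges and loops allowed) together with exactly four half-edges, labelled $0,1,2,3$, each incident with exactly one vertex, such that every vertex has degree 4 (counting half-edges, and loops twice). A route is a trail (no repeated edges, repeated vertices allowed) starting with one half-edge and ending with another. A valid set of routes is a set of two routes such that every edge and every half-edge is travelled exactly once (routes are considered up to reversal); equivalently, it is a choice at every vertex of a perfect matching of the four edge-ends/half-edges at it such that following the matchings yields two trails joining the four half-edges in pairs and no closed trails. $\mathrm{VR}(\{a,b\},\{c,d\})$ denotes the set of valid sets of routes in which one route connects half-edges $a,b$ and the other connects $c,d$. The signature of a gadget is the triple $(\alpha,\beta,\gamma)$ with $\alpha=|\mathrm{VR}(\{0,1\},\{2,3\})|/N$, $\beta=|\mathrm{VR}(\{0,2\},\{1,3\})|/N$, $\gamma=|\mathrm{VR}(\{0,3\},\{1,2\})|/N$, where $N$ is the sum of the three cardinalities (defined when $N>0$). -}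

module Defs where

open import Data.Bool.Base using (Bool; not)
open import Data.Fin.Base using (Fin)
open import Data.Fin.Patterns using (0F; 1F; 2F; 3F)
open import Data.Fin.Permutation using (Permutation′; _⟨$⟩ʳ_)
open import Data.Integer.Base as ℤ using (+_)
import Data.Integer.Properties as ℤₚ
open import Data.Nat.Base as ℕ using (ℕ; zero; suc) hiding (module ℕ)
import Data.Nat.Properties as ℕₚ
open import Data.Product.Base using (Σ; ∃; _×_; _,_; proj₁; proj₂)
open import Data.Rational.Base as ℚ using (ℚ; 0ℚ; 1ℚ; ½) hiding (module ℚ)
import Data.Rational.Properties as ℚₚ
import Data.Rational.Unnormalised.Base as ℚᵘ
import Data.Rational.Unnormalised.Properties as ℚᵘₚ
open import Data.Rational.Solver using (module +-*-Solver)
open import Data.Sum.Base using (_⊎_; inj₁; inj₂; [_,_]′)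
open import Data.Vec.Functional using (Vector; []; _∷_; foldr; map; zipWith)
open import Function.Base using (_∘_; _on_; case_of_)
open import Function.Bundles using (_↔_; Inverse)
open import Level using (0ℓ)
open import Relation.Binary.Bundles using (Setoid)
open import Relation.Binary.Construct.Closure.ReflexiveTransitive using (Star)
open import Relation.Binary.Construct.Closure.Transitive using (TransClosure)
open import Relation.Binary.PropositionalEquality
  using (_≡_; _≢_; _≗_; refl; sym; trans; cong; cong₂; subst; subst₂; setoid)
open import Relation.Nullary.Decidable.Core using (yes; no)
open import Relation.Nullary.Negation.Core using (¬_; contradiction)

module RationalLemmas where

  open ℚ using (_+_; _*_; _-_; -_; ∣_∣; _≤_; _<_; _≥_; 1/_; _/_)
  open ℚₚ
  open +-*-Solver using (solve; _:+_; _:*_; _:-_; :-_; _:=_; con)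

  fromℕ : ℕ → ℚ
  fromℕ n = + n / 1

  -- The junk value 0⁻¹ = 0 makes inversion total.
  inv : ℚ → ℚ
  inv p with p ≟ 0ℚ
  ... | yes _   = 0ℚ
  ... | no  p≢0 = (1/ p) {{ℚ.≢-nonZero p≢0}}

  inv-inverseʳ : ∀ p → p ≢ 0ℚ → p * inv p ≡ 1ℚ
  inv-inverseʳ p p≢0 with p ≟ 0ℚ
  ... | yes p≡0 = contradiction p≡0 p≢0
  ... | no  q   = *-inverseʳ p {{ℚ.≢-nonZero q}}

  *-monoʳ : ∀ {r p q} → 0ℚ ≤ r → p ≤ q → r * p ≤ r * q
  *-monoʳ {r} 0≤r p≤q = *-monoˡ-≤-nonNeg r {{ℚ.nonNegative 0≤r}} p≤q

  *-monoˡ : ∀ {r p q} → 0ℚ ≤ r → p ≤ q → p * r ≤ q * r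
  *-monoˡ {r} 0≤r p≤q = *-monoʳ-≤-nonNeg r {{ℚ.nonNegative 0≤r}} p≤q

  *-mono : ∀ {p q r s} → 0ℚ ≤ p → 0ℚ ≤ s → p ≤ q → r ≤ s → p * r ≤ q * s
  *-mono 0≤p 0≤s p≤q r≤s = ≤-trans (*-monoʳ 0≤p r≤s) (*-monoˡ 0≤s p≤q)

  0≤* : ∀ {p q} → 0ℚ ≤ p → 0ℚ ≤ q → 0ℚ ≤ p * q
  0≤* {p} {q} 0≤p 0≤q = subst (_≤ p * q) (*-zeroʳ p) (*-monoʳ 0≤p 0≤q)

  0<* : ∀ {p q} → 0ℚ < p → 0ℚ < q → 0ℚ < p * q
  0<* {p} {q} 0<p 0<q =
    subst (_< p * q) (*-zeroʳ p) (*-monoʳ-<-pos p {{ℚ.positive 0<p}} 0<q)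

  0≤+ : ∀ {p q} → 0ℚ ≤ p → 0ℚ ≤ q → 0ℚ ≤ p + q
  0≤+ 0≤p 0≤q = +-mono-≤ 0≤p 0≤q

  p≤p+q : ∀ {p q} → 0ℚ ≤ q → p ≤ p + q
  p≤p+q {p} {q} 0≤q = subst (_≤ p + q) (+-identityʳ p) (+-monoʳ-≤ p 0≤q)

  0<1 : 0ℚ < 1ℚ
  0<1 = positive⁻¹ 1ℚ

  0≤1 : 0ℚ ≤ 1ℚ
  0≤1 = <⇒≤ 0<1

  0<inv : ∀ {p} → 0ℚ < p → 0ℚ < inv p
  0<inv {p} 0<p with p ≟ 0ℚ
  ... | yes p≡0 = contradiction (sym p≡0) (<⇒≢ 0<p)
  ... | no  p≢0 = positive⁻¹ ((1/ p) {{ℚ.≢-nonZero p≢0}})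
          {{1/pos⇒pos p {{ℚ.positive 0<p}}}}

  quotient : ∀ C ε → 0ℚ < C → 0ℚ < ε → ∃ λ δ → 0ℚ < δ × C * δ ≡ ε
  quotient C ε 0<C 0<ε = inv C * ε , 0<* (0<inv 0<C) 0<ε ,
    trans (sym (*-assoc C (inv C) ε))
      (trans (cong (_* ε) (inv-inverseʳ C (λ C≡0 → <⇒≢ 0<C (sym C≡0))))
             (*-identityˡ ε))

  ∣-∣-comm : ∀ p q → ∣ p - q ∣ ≡ ∣ q - p ∣
  ∣-∣-comm p q = trans
    (cong ∣_∣ (solve 2 (λ p q → p :- q := :- (q :- p)) refl p q))
    (∣-p∣≡∣p∣ (q - p))

  p≤∣p∣ : ∀ p → p ≤ ∣ p ∣
  p≤∣p∣ p with ≤-total 0ℚ p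
  ... | inj₁ 0≤p = ≤-reflexive (sym (0≤p⇒∣p∣≡p 0≤p))
  ... | inj₂ p≤0 = ≤-trans p≤0 (0≤∣p∣ p)

  ∣∣-lub : ∀ {p q} → p ≤ q → - p ≤ q → ∣ p ∣ ≤ q
  ∣∣-lub {p} {q} p≤q -p≤q with ∣p∣≡p∨∣p∣≡-p p
  ... | inj₁ e = subst (_≤ q) (sym e) p≤q
  ... | inj₂ e = subst (_≤ q) (sym e) -p≤q

  ∣p∣≤∣q∣+∣p-q∣ : ∀ p q → ∣ p ∣ ≤ ∣ q ∣ + ∣ p - q ∣
  ∣p∣≤∣q∣+∣p-q∣ p q = subst (λ t → ∣ t ∣ ≤ ∣ q ∣ + ∣ p - q ∣)
    (solve 2 (λ p q → q :+ (p :- q) := p) refl p q)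
    (∣p+q∣≤∣p∣+∣q∣ q (p - q))

  p≤q+r⇒p-q≤r : ∀ {p q r} → p ≤ q + r → p - q ≤ r
  p≤q+r⇒p-q≤r {p} {q} {r} h = subst (p - q ≤_)
    (solve 2 (λ q r → q :+ r :- q := r) refl q r) (+-monoˡ-≤ (- q) h)

  ∣∣p∣-∣q∣∣≤∣p-q∣ : ∀ p q → ∣ ∣ p ∣ - ∣ q ∣ ∣ ≤ ∣ p - q ∣
  ∣∣p∣-∣q∣∣≤∣p-q∣ p q = ∣∣-lub
    (p≤q+r⇒p-q≤r (∣p∣≤∣q∣+∣p-q∣ p q))
    (subst₂ _≤_
      (solve 2 (λ a b → b :- a := :- (a :- b)) refl ∣ p ∣ ∣ q ∣)
      (∣-∣-comm q p)
      (p≤q+r⇒p-q≤r (∣p∣≤∣q∣+∣p-q∣ q p)))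

  +-diff : ∀ a b c d → ∣ (a + b) - (c + d) ∣ ≤ ∣ a - c ∣ + ∣ b - d ∣
  +-diff a b c d = subst (λ t → ∣ t ∣ ≤ ∣ a - c ∣ + ∣ b - d ∣)
    (solve 4 (λ a b c d → (a :- c) :+ (b :- d) := (a :+ b) :- (c :+ d))
      refl a b c d)
    (∣p+q∣≤∣p∣+∣q∣ (a - c) (b - d))

  *-diff : ∀ a b c d →
           ∣ a * b - c * d ∣ ≤ ∣ a ∣ * ∣ b - d ∣ + ∣ a - c ∣ * ∣ d ∣
  *-diff a b c d = subst₂ _≤_
    (cong ∣_∣ (solve 4 (λ a b c d →
      a :* (b :- d) :+ (a :- c) :* d := a :* b :- c :* d) refl a b c d))
    (cong₂ _+_ (∣p*q∣≡∣p∣*∣q∣ a (b - d)) (∣p*q∣≡∣p∣*∣q∣ (a - c) d))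
    (∣p+q∣≤∣p∣+∣q∣ (a * (b - d)) ((a - c) * d))

  ∣inv∣ : ∀ p → ∣ inv p ∣ ≡ inv ∣ p ∣
  ∣inv∣ p with p ≟ 0ℚ
  ... | yes refl = refl
  ... | no p≢0 = begin-equality
      ∣ p⁻¹ ∣                          ≡⟨ sym (*-identityʳ ∣ p⁻¹ ∣) ⟩
      ∣ p⁻¹ ∣ * 1ℚ                     ≡⟨ cong (∣ p⁻¹ ∣ *_) (sym (inv-inverseʳ ∣ p ∣ ∣p∣≢0)) ⟩
      ∣ p⁻¹ ∣ * (∣ p ∣ * inv ∣ p ∣)    ≡⟨ sym (*-assoc ∣ p⁻¹ ∣ ∣ p ∣ (inv ∣ p ∣)) ⟩
      (∣ p⁻¹ ∣ * ∣ p ∣) * inv ∣ p ∣    ≡⟨ cong (_* inv ∣ p ∣) (sym (∣p*q∣≡∣p∣*∣q∣ p⁻¹ p)) ⟩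
      ∣ p⁻¹ * p ∣ * inv ∣ p ∣          ≡⟨ cong (λ t → ∣ t ∣ * inv ∣ p ∣) (*-inverseˡ p {{nz}}) ⟩
      1ℚ * inv ∣ p ∣                   ≡⟨ *-identityˡ (inv ∣ p ∣) ⟩
      inv ∣ p ∣                        ∎
    where
    open ≤-Reasoning
    nz = ℚ.≢-nonZero p≢0
    p⁻¹ = (1/ p) {{nz}}
    ∣p∣≢0 : ∣ p ∣ ≢ 0ℚ
    ∣p∣≢0 e = p≢0 (∣p∣≡0⇒p≡0 p e)

  inv-anti : ∀ {p q} → 0ℚ < p → p ≤ q → inv q ≤ inv p
  inv-anti {p} {q} 0<p p≤q = begin
      inv q                  ≡⟨ sym (*-identityʳ (inv q)) ⟩
      inv q * 1ℚ             ≡⟨ cong (inv q *_) (sym (inv-inverseʳ p (λ e → <⇒≢ 0<p (sym e)))) ⟩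
      inv q * (p * inv p)    ≤⟨ *-monoʳ (<⇒≤ (0<inv 0<q)) (*-monoˡ (<⇒≤ (0<inv 0<p)) p≤q) ⟩
      inv q * (q * inv p)    ≡⟨ solve 3 (λ a b c → a :* (b :* c) := (b :* a) :* c) refl (inv q) q (inv p) ⟩
      (q * inv q) * inv p    ≡⟨ cong (_* inv p) (inv-inverseʳ q (λ e → <⇒≢ 0<q (sym e))) ⟩
      1ℚ * inv p             ≡⟨ *-identityˡ (inv p) ⟩
      inv p                  ∎
    where
    open ≤-Reasoning
    0<q = <-≤-trans 0<p p≤q

  inv-diff : ∀ {δ} p q → 0ℚ < δ → δ ≤ ∣ p ∣ → δ ≤ ∣ q ∣ →
             ∣ inv p - inv q ∣ ≤ (inv δ * inv δ) * ∣ p - q ∣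
  inv-diff {δ} p q 0<δ δ≤p δ≤q = begin
      ∣ inv p - inv q ∣
        ≡⟨ cong ∣_∣ (sym (cong₂ _-_ (*-identityʳ (inv p)) (*-identityˡ (inv q)))) ⟩
      ∣ inv p * 1ℚ - 1ℚ * inv q ∣
        ≡⟨ cong ∣_∣ (sym (cong₂ (λ s t → inv p * s - t * inv q) q1 p1)) ⟩
      ∣ inv p * (q * inv q) - (p * inv p) * inv q ∣
        ≡⟨ cong ∣_∣ (solve 4 (λ p q a b → a :* (q :* b) :- (p :* a) :* b := (a :* b) :* (q :- p)) refl p q (inv p) (inv q)) ⟩
      ∣ (inv p * inv q) * (q - p) ∣
        ≡⟨ ∣p*q∣≡∣p∣*∣q∣ (inv p * inv q) (q - p) ⟩
      ∣ inv p * inv q ∣ * ∣ q - p ∣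
        ≡⟨ cong₂ _*_ (∣p*q∣≡∣p∣*∣q∣ (inv p) (inv q)) (∣-∣-comm q p) ⟩
      (∣ inv p ∣ * ∣ inv q ∣) * ∣ p - q ∣
        ≡⟨ cong₂ (λ s t → (s * t) * ∣ p - q ∣) (∣inv∣ p) (∣inv∣ q) ⟩
      (inv ∣ p ∣ * inv ∣ q ∣) * ∣ p - q ∣
        ≤⟨ *-monoˡ (0≤∣p∣ (p - q))
             (*-mono (<⇒≤ (0<inv (<-≤-trans 0<δ δ≤p))) (<⇒≤ (0<inv 0<δ))
               (inv-anti 0<δ δ≤p) (inv-anti 0<δ δ≤q)) ⟩
      (inv δ * inv δ) * ∣ p - q ∣ ∎
    where
    open ≤-Reasoning
    apart : ∀ r → δ ≤ ∣ r ∣ → r ≢ 0ℚ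
    apart r δ≤r refl = <⇒≢ (<-≤-trans 0<δ δ≤r) refl
    q1 : q * inv q ≡ 1ℚ
    q1 = inv-inverseʳ q (apart q δ≤q)
    p1 : p * inv p ≡ 1ℚ
    p1 = inv-inverseʳ p (apart p δ≤p)

  fromℕ-mono : ∀ {m n} → m ℕ.≤ n → fromℕ m ≤ fromℕ n
  fromℕ-mono {m} {n} m≤n = toℚᵘ-cancel-≤
    (ℚᵘₚ.≤-respʳ-≃ (ℚᵘₚ.≃-sym (toℚᵘ-fromℚᵘ (ℚᵘ.mkℚᵘ (+ n) 0)))
    (ℚᵘₚ.≤-respˡ-≃ (ℚᵘₚ.≃-sym (toℚᵘ-fromℚᵘ (ℚᵘ.mkℚᵘ (+ m) 0)))
      (ℚᵘ.*≤* (ℤₚ.*-monoʳ-≤-nonNeg (+ 1) (ℤ.+≤+ m≤n)))))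

  fromℕ-suc : ∀ n → fromℕ (suc n) ≡ 1ℚ + fromℕ n
  fromℕ-suc n = toℚᵘ-injective
    (ℚᵘₚ.≃-trans (toℚᵘ-fromℚᵘ (ℚᵘ.mkℚᵘ (+ suc n) 0))
    (ℚᵘₚ.≃-trans (ℚᵘ.*≡* (cong (λ i → (+ 1 ℤ.+ i) ℤ.* + 1) (sym (ℤₚ.*-identityʳ (+ n)))))
    (ℚᵘₚ.≃-sym (ℚᵘₚ.≃-trans (toℚᵘ-homo-+ 1ℚ (fromℕ n))
      (ℚᵘₚ.+-congʳ ℚᵘ.1ℚᵘ (toℚᵘ-fromℚᵘ (ℚᵘ.mkℚᵘ (+ n) 0)))))))

  0≤fromℕ : ∀ n → 0ℚ ≤ fromℕ n
  0≤fromℕ n = fromℕ-mono {0} {n} ℕ.z≤n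

  recip : ℕ → ℚ
  recip k = + 1 / suc k

  recip-inverse : ∀ k → recip k * fromℕ (suc k) ≡ 1ℚ
  recip-inverse k = toℚᵘ-injective
    (ℚᵘₚ.≃-trans (toℚᵘ-homo-* (recip k) (fromℕ (suc k)))
    (ℚᵘₚ.≃-trans (ℚᵘₚ.*-cong (toℚᵘ-fromℚᵘ (ℚᵘ.mkℚᵘ (+ 1) k))
                             (toℚᵘ-fromℚᵘ (ℚᵘ.mkℚᵘ (+ suc k) 0)))
      (ℚᵘ.*≡* (cong +_ eq))))
    where
    eq : (1 ℕ.* suc k) ℕ.* 1 ≡ 1 ℕ.* (suc k ℕ.* 1)
    eq = ℕₚ.*-assoc 1 (suc k) 1

  0≤recip : ∀ k → 0ℚ ≤ recip k
  0≤recip k = nonNegative⁻¹ (recip k) {{normalize-nonNeg 1 (suc k)}}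

  archimedean : ∀ p → ∃ λ n → p ≤ fromℕ n
  archimedean p@(ℚ.mkℚ i d _) = ℤ.∣ i ∣ , toℚᵘ-cancel-≤
    (ℚᵘₚ.≤-respʳ-≃ (ℚᵘₚ.≃-sym (toℚᵘ-fromℚᵘ (ℚᵘ.mkℚᵘ (+ ℤ.∣ i ∣) 0)))
      (ℚᵘ.*≤* (ℤₚ.≤-trans (ℤₚ.≤-reflexive (ℤₚ.*-identityʳ i)) (bound i))))
    where
    bound : ∀ i → i ℤ.≤ + ℤ.∣ i ∣ ℤ.* + suc d
    bound (+ n)        = subst (+ n ℤ.≤_) (ℤₚ.pos-* n (suc d))
                           (ℤ.+≤+ (ℕₚ.m≤m*n n (suc d)))
    bound ℤ.-[1+ n ]   = subst (ℤ.-[1+ n ] ℤ.≤_) (ℤₚ.pos-* (suc n) (suc d)) ℤ.-≤+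

  recip-small : ∀ C ε → 0ℚ < ε → ∃ λ N → ∀ n → N ℕ.≤ n → C * recip n ≤ ε
  recip-small C ε 0<ε with quotient ε 1ℚ 0<ε 0<1
  ... | η , 0<η , εη≡1 with archimedean (C * η)
  ... | N , Cη≤N = N , λ n N≤n → begin
      C * recip n                      ≡⟨ sym (*-identityˡ (C * recip n)) ⟩
      1ℚ * (C * recip n)               ≡⟨ cong (_* (C * recip n)) (sym εη≡1) ⟩
      (ε * η) * (C * recip n)          ≡⟨ solve 4 (λ e h c r → (e :* h) :* (c :* r) := e :* ((c :* h) :* r)) refl ε η C (recip n) ⟩
      ε * ((C * η) * recip n)          ≤⟨ *-monoʳ (<⇒≤ 0<ε) (*-monoˡ (0≤recip n)
                                            (≤-trans Cη≤N (fromℕ-mono (ℕₚ.≤-trans N≤n (ℕₚ.n≤1+n n))))) ⟩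
      ε * (fromℕ (suc n) * recip n)    ≡⟨ cong (ε *_) (trans (*-comm (fromℕ (suc n)) (recip n)) (recip-inverse n)) ⟩
      ε * 1ℚ                           ≡⟨ *-identityʳ ε ⟩
      ε                                ∎
    where open ≤-Reasoning

open RationalLemmas

record Cauchy (u : ℕ → ℚ) : Set where
  constructor cauchy
  field
    modulus : ∀ ε → 0ℚ ℚ.< ε → ∃ λ N → ∀ m n → N ℕ.≤ m → N ℕ.≤ n →
              ℚ.∣ u m ℚ.- u n ∣ ℚ.≤ ε

open Cauchy public

-- Equality of reals is _≃_ below; it identifies Cauchy sequences whose
-- difference tends to 0.
record ℝ : Set where
  constructor mkℝ
  field
    seq      : ℕ → ℚ
    isCauchy : Cauchy seq

open ℝ public

Eventually : (ℕ → Set) → Set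
Eventually P = ∃ λ N → ∀ n → N ℕ.≤ n → P n

module CauchyLemmas where

  open ℚ using (_+_; _*_; _-_; -_; ∣_∣; _≤_; _<_)
  open ℚₚ
  open ≤-Reasoning
  open +-*-Solver using (solve; _:+_; _:*_; _:-_; :-_; _:=_; con)

  cauchy-by : ∀ {u} C → 0ℚ < C →
    (∀ δ → 0ℚ < δ → ∃ λ N → ∀ m n → N ℕ.≤ m → N ℕ.≤ n → ∣ u m - u n ∣ ≤ C * δ) →
    Cauchy u
  cauchy-by {u} C 0<C h .modulus ε 0<ε with quotient C ε 0<C 0<ε
  ... | δ , 0<δ , Cδ≡ε with h δ 0<δ
  ... | N , g = N , λ m n p q → subst (∣ u m - u n ∣ ≤_) Cδ≡ε (g m n p q)

  bounded : ∀ {u} → Cauchy u →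
            ∃ λ B → 0ℚ < B × Eventually (λ n → ∣ u n ∣ ≤ B)
  bounded {u} c with modulus c 1ℚ 0<1
  ... | N , h = ∣ u N ∣ + 1ℚ
              , <-≤-trans 0<1 (subst (_≤ ∣ u N ∣ + 1ℚ) (+-identityˡ 1ℚ)
                  (+-monoˡ-≤ 1ℚ (0≤∣p∣ (u N))))
              , N , λ n N≤n → ≤-trans (∣p∣≤∣q∣+∣p-q∣ (u n) (u N))
                  (+-monoʳ-≤ ∣ u N ∣ (h n N N≤n ℕₚ.≤-refl))

  const-cauchy : ∀ q → Cauchy (λ _ → q)
  const-cauchy q .modulus ε 0<ε = 0 , λ _ _ _ _ →
    subst (_≤ ε) (sym (cong ∣_∣ (+-inverseʳ q))) (<⇒≤ 0<ε)

  +-cauchy : ∀ {u v} → Cauchy u → Cauchy v → Cauchy (λ n → u n + v n)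
  +-cauchy {u} {v} cu cv = cauchy-by (1ℚ + 1ℚ) (positive⁻¹ (1ℚ + 1ℚ)) λ δ 0<δ →
    case (modulus cu δ 0<δ , modulus cv δ 0<δ) of λ where
      ((M , hu) , (N , hv)) → M ℕ.⊔ N , λ m n p q → begin
        ∣ (u m + v m) - (u n + v n) ∣ ≤⟨ +-diff (u m) (v m) (u n) (v n) ⟩
        ∣ u m - u n ∣ + ∣ v m - v n ∣ ≤⟨ +-mono-≤
          (hu m n (ℕₚ.m⊔n≤o⇒m≤o M N p) (ℕₚ.m⊔n≤o⇒m≤o M N q))
          (hv m n (ℕₚ.m⊔n≤o⇒n≤o M N p) (ℕₚ.m⊔n≤o⇒n≤o M N q)) ⟩
        δ + δ                         ≡⟨ solve 1 (λ d → d :+ d := (con 1ℚ :+ con 1ℚ) :* d) refl δ ⟩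
        (1ℚ + 1ℚ) * δ                 ∎

  neg-cauchy : ∀ {u} → Cauchy u → Cauchy (λ n → - u n)
  neg-cauchy {u} cu .modulus ε 0<ε with modulus cu ε 0<ε
  ... | N , h = N , λ m n p q → subst (_≤ ε)
    (trans (∣-∣-comm (u m) (u n)) (cong ∣_∣
      (solve 2 (λ a b → b :- a := (:- a) :- (:- b)) refl (u m) (u n))))
    (h m n p q)

  ∣∣-cauchy : ∀ {u} → Cauchy u → Cauchy (λ n → ∣ u n ∣)
  ∣∣-cauchy {u} cu .modulus ε 0<ε with modulus cu ε 0<ε
  ... | N , h = N , λ m n p q → ≤-trans (∣∣p∣-∣q∣∣≤∣p-q∣ (u m) (u n)) (h m n p q)

  *-cauchy : ∀ {u v} → Cauchy u → Cauchy v → Cauchy (λ n → u n * v n)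
  *-cauchy {u} {v} cu cv = go (bounded cu) (bounded cv)
    where
    est : ∀ {B C δ} → 0ℚ < C → 0ℚ < δ → ∀ m n →
          ∣ u m ∣ ≤ B → ∣ v n ∣ ≤ C → ∣ u m - u n ∣ ≤ δ → ∣ v m - v n ∣ ≤ δ →
          ∣ u m * v m - u n * v n ∣ ≤ (B + C) * δ
    est {B} {C} {δ} 0<C 0<δ m n um≤B vn≤C du≤δ dv≤δ = begin
      ∣ u m * v m - u n * v n ∣
        ≤⟨ *-diff (u m) (v m) (u n) (v n) ⟩
      ∣ u m ∣ * ∣ v m - v n ∣ + ∣ u m - u n ∣ * ∣ v n ∣
        ≤⟨ +-mono-≤ (*-mono (0≤∣p∣ (u m)) (<⇒≤ 0<δ) um≤B dv≤δ)
                    (*-mono (0≤∣p∣ (u m - u n)) (<⇒≤ 0<C) du≤δ vn≤C) ⟩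
      B * δ + δ * C
        ≡⟨ solve 3 (λ b c d → b :* d :+ d :* c := (b :+ c) :* d) refl B C δ ⟩
      (B + C) * δ ∎
    go : (∃ λ B → 0ℚ < B × Eventually (λ n → ∣ u n ∣ ≤ B)) →
         (∃ λ C → 0ℚ < C × Eventually (λ n → ∣ v n ∣ ≤ C)) →
         Cauchy (λ n → u n * v n)
    go (B , 0<B , K , hB) (C , 0<C , L , hC) =
      cauchy-by (B + C) (+-mono-< 0<B 0<C) λ δ 0<δ →
        case (modulus cu δ 0<δ , modulus cv δ 0<δ) of λ where
          ((M , hu) , (N , hv)) → (K ℕ.⊔ L) ℕ.⊔ (M ℕ.⊔ N) , λ m n p q →
            let pKL = ℕₚ.m⊔n≤o⇒m≤o (K ℕ.⊔ L) (M ℕ.⊔ N) p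
                qKL = ℕₚ.m⊔n≤o⇒m≤o (K ℕ.⊔ L) (M ℕ.⊔ N) q
                pMN = ℕₚ.m⊔n≤o⇒n≤o (K ℕ.⊔ L) (M ℕ.⊔ N) p
                qMN = ℕₚ.m⊔n≤o⇒n≤o (K ℕ.⊔ L) (M ℕ.⊔ N) q
            in est 0<C 0<δ m n
                 (hB m (ℕₚ.m⊔n≤o⇒m≤o K L pKL))
                 (hC n (ℕₚ.m⊔n≤o⇒n≤o K L qKL))
                 (hu m n (ℕₚ.m⊔n≤o⇒m≤o M N pMN) (ℕₚ.m⊔n≤o⇒m≤o M N qMN))
                 (hv m n (ℕₚ.m⊔n≤o⇒n≤o M N pMN) (ℕₚ.m⊔n≤o⇒n≤o M N qMN))

  inv-cauchy : ∀ {u} δ → 0ℚ < δ → Eventually (λ n → δ ≤ ∣ u n ∣) →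
               Cauchy u → Cauchy (λ n → inv (u n))
  inv-cauchy {u} δ 0<δ (K , hK) cu =
    cauchy-by (inv δ * inv δ) 0<C λ η 0<η →
      case modulus cu η 0<η of λ where
        (N , h) → K ℕ.⊔ N , λ m n p q → ≤-trans
          (inv-diff (u m) (u n) 0<δ (hK m (ℕₚ.m⊔n≤o⇒m≤o K N p)) (hK n (ℕₚ.m⊔n≤o⇒m≤o K N q)))
          (*-monoʳ (<⇒≤ 0<C) (h m n (ℕₚ.m⊔n≤o⇒n≤o K N p) (ℕₚ.m⊔n≤o⇒n≤o K N q)))
    where
    0<C = 0<* (0<inv 0<δ) (0<inv 0<δ)

-- xᵏ / k!
expTerm : ℚ → ℕ → ℚ
expTerm x zero    = 1ℚ
expTerm x (suc k) = expTerm x k ℚ.* x ℚ.* (+ 1 ℚ./ suc k)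

-- Σ_{k<n} xᵏ / k!
expSum : ℚ → ℕ → ℚ
expSum x zero    = 0ℚ
expSum x (suc n) = expSum x n ℚ.+ expTerm x n

module ExpLemmas where

  open ℚ using (_+_; _*_; _-_; -_; ∣_∣; _≤_; _<_)
  open ℚₚ
  open ≤-Reasoning
  open +-*-Solver using (solve; _:+_; _:*_; _:-_; :-_; _:=_; con)
  open CauchyLemmas

  2ℚ : ℚ
  2ℚ = 1ℚ + 1ℚ

  0≤term : ∀ {B} → 0ℚ ≤ B → ∀ k → 0ℚ ≤ expTerm B k
  0≤term 0≤B zero    = 0≤1
  0≤term 0≤B (suc k) = 0≤* (0≤* (0≤term 0≤B k) 0≤B) (0≤recip k)

  sum-mono : ∀ {B} → 0ℚ ≤ B → ∀ {m n} → m ℕ.≤′ n → expSum B m ≤ expSum B n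
  sum-mono 0≤B ℕ.≤′-refl     = ≤-refl
  sum-mono 0≤B (ℕ.≤′-step {n} p) = ≤-trans (sum-mono 0≤B p) (p≤p+q (0≤term 0≤B n))

  term-bound : ∀ {x B} → ∣ x ∣ ≤ B → ∀ k → ∣ expTerm x k ∣ ≤ expTerm B k
  term-bound {x} {B} x≤B zero    = ≤-refl
  term-bound {x} {B} x≤B (suc k) = begin
    ∣ expTerm x k * x * recip k ∣           ≡⟨ ∣p*q∣≡∣p∣*∣q∣ (expTerm x k * x) (recip k) ⟩
    ∣ expTerm x k * x ∣ * ∣ recip k ∣       ≡⟨ cong₂ _*_ (∣p*q∣≡∣p∣*∣q∣ (expTerm x k) x) (0≤p⇒∣p∣≡p (0≤recip k)) ⟩
    ∣ expTerm x k ∣ * ∣ x ∣ * recip k       ≤⟨ *-monoˡ (0≤recip k) (*-mono (0≤∣p∣ (expTerm x k)) 0≤B (term-bound x≤B k) x≤B) ⟩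
    expTerm B k * B * recip k               ∎
    where 0≤B = ≤-trans (0≤∣p∣ x) x≤B

  -- The derivative of xᵏ / k!.
  expTerm′ : ℚ → ℕ → ℚ
  expTerm′ x zero    = 0ℚ
  expTerm′ x (suc k) = expTerm x k

  term-rec : ∀ B k → expTerm B k + expTerm′ B k * B ≡ expTerm B k * fromℕ (suc k)
  term-rec B zero    = solve 1 (λ b → con 1ℚ :+ con 0ℚ :* b := con 1ℚ :* con 1ℚ) refl B
  term-rec B (suc k) = begin-equality
    t * B * r + t * B              ≡⟨ cong (λ s → t * B * r + s) (sym (*-identityʳ (t * B))) ⟩
    t * B * r + t * B * 1ℚ         ≡⟨ cong (λ s → t * B * r + t * B * s) (sym (recip-inverse k)) ⟩
    t * B * r + t * B * (r * n)    ≡⟨ solve 4 (λ t b r n → t :* b :* r :+ t :* b :* (r :* n) := t :* b :* r :* (con 1ℚ :+ n)) refl t B r n ⟩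
    t * B * r * (1ℚ + n)           ≡⟨ cong (λ s → t * B * r * s) (sym (fromℕ-suc (suc k))) ⟩
    t * B * r * fromℕ (suc (suc k)) ∎
    where
    t = expTerm B k
    r = recip k
    n = fromℕ (suc k)

  term-lipschitz : ∀ {x y B} → ∣ x ∣ ≤ B → ∣ y ∣ ≤ B → ∀ k →
                   ∣ expTerm x k - expTerm y k ∣ ≤ ∣ x - y ∣ * expTerm′ B k
  term-lipschitz {x} {y} {B} x≤B y≤B zero    = ≤-reflexive (sym (*-zeroʳ ∣ x - y ∣))
  term-lipschitz {x} {y} {B} x≤B y≤B (suc k) = begin
    ∣ tx * x * r - ty * y * r ∣
      ≡⟨ cong ∣_∣ (solve 3 (λ a b r → a :* r :- b :* r := (a :- b) :* r) refl (tx * x) (ty * y) r) ⟩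
    ∣ (tx * x - ty * y) * r ∣
      ≡⟨ trans (∣p*q∣≡∣p∣*∣q∣ (tx * x - ty * y) r) (cong (∣ tx * x - ty * y ∣ *_) (0≤p⇒∣p∣≡p (0≤recip k))) ⟩
    ∣ tx * x - ty * y ∣ * r
      ≤⟨ *-monoˡ (0≤recip k) (*-diff tx x ty y) ⟩
    (∣ tx ∣ * D + ∣ tx - ty ∣ * ∣ y ∣) * r
      ≤⟨ *-monoˡ (0≤recip k) (+-mono-≤
           (*-monoˡ (0≤∣p∣ (x - y)) (term-bound x≤B k))
           (*-mono (0≤∣p∣ (tx - ty)) 0≤B (term-lipschitz x≤B y≤B k) y≤B)) ⟩
    (T * D + D * T′ * B) * r
      ≡⟨ solve 5 (λ t d t′ b r → (t :* d :+ d :* t′ :* b) :* r := d :* ((t :+ t′ :* b) :* r)) refl T D T′ B r ⟩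
    D * ((T + T′ * B) * r)
      ≡⟨ cong (λ s → D * (s * r)) (term-rec B k) ⟩
    D * (T * fromℕ (suc k) * r)
      ≡⟨ cong (D *_) (trans (solve 3 (λ t n r → t :* n :* r := t :* (r :* n)) refl T (fromℕ (suc k)) r)
                            (trans (cong (T *_) (recip-inverse k)) (*-identityʳ T))) ⟩
    D * T ∎
    where
    0≤B = ≤-trans (0≤∣p∣ x) x≤B
    tx = expTerm x k
    ty = expTerm y k
    r = recip k
    D = ∣ x - y ∣
    T = expTerm B k
    T′ = expTerm′ B k

  sum-lipschitz : ∀ {x y B} → ∣ x ∣ ≤ B → ∣ y ∣ ≤ B → ∀ n →
                  ∣ expSum x n - expSum y n ∣ ≤ ∣ x - y ∣ * expSum B n
  sum-lipschitz {x} {y} {B} x≤B y≤B zero    = ≤-reflexive (sym (*-zeroʳ ∣ x - y ∣))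
  sum-lipschitz {x} {y} {B} x≤B y≤B (suc n) =
    ≤-trans (shifted n) (*-monoʳ (0≤∣p∣ (x - y)) (p≤p+q (0≤term 0≤B n)))
    where
    0≤B = ≤-trans (0≤∣p∣ x) x≤B
    shifted : ∀ n → ∣ expSum x (suc n) - expSum y (suc n) ∣ ≤ ∣ x - y ∣ * expSum B n
    shifted zero    = ≤-reflexive (sym (*-zeroʳ ∣ x - y ∣))
    shifted (suc n) = begin
      ∣ (expSum x (suc n) + expTerm x (suc n)) - (expSum y (suc n) + expTerm y (suc n)) ∣
        ≤⟨ +-diff (expSum x (suc n)) (expTerm x (suc n)) (expSum y (suc n)) (expTerm y (suc n)) ⟩
      ∣ expSum x (suc n) - expSum y (suc n) ∣ + ∣ expTerm x (suc n) - expTerm y (suc n) ∣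
        ≤⟨ +-mono-≤ (shifted n) (term-lipschitz x≤B y≤B (suc n)) ⟩
      ∣ x - y ∣ * expSum B n + ∣ x - y ∣ * expTerm B n
        ≡⟨ sym (*-distribˡ-+ ∣ x - y ∣ (expSum B n) (expTerm B n)) ⟩
      ∣ x - y ∣ * (expSum B n + expTerm B n) ∎

  module Tail {B} (0≤B : 0ℚ ≤ B) (K : ℕ) (2B≤K : 2ℚ * B ≤ fromℕ K) where

    term-halves : ∀ k → K ℕ.≤ k → 2ℚ * expTerm B (suc k) ≤ expTerm B k
    term-halves k K≤k = begin
      2ℚ * (t * B * r)          ≡⟨ solve 4 (λ c t b r → c :* (t :* b :* r) := t :* ((c :* b) :* r)) refl 2ℚ t B r ⟩
      t * ((2ℚ * B) * r)        ≤⟨ *-monoʳ (0≤term 0≤B k) (*-monoˡ (0≤recip k)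
                                     (≤-trans 2B≤K
                                       (fromℕ-mono (ℕₚ.≤-trans K≤k (ℕₚ.n≤1+n k))))) ⟩
      t * (fromℕ (suc k) * r)   ≡⟨ cong (t *_) (trans (*-comm (fromℕ (suc k)) r) (recip-inverse k)) ⟩
      t * 1ℚ                    ≡⟨ *-identityʳ t ⟩
      t                         ∎
      where
      t = expTerm B k
      r = recip k

    potential : ℕ → ℚ
    potential n = expSum B n + 2ℚ * expTerm B n

    potential-anti : ∀ {m n} → K ℕ.≤ m → m ℕ.≤′ n → potential n ≤ potential m
    potential-anti K≤m ℕ.≤′-refl = ≤-refl
    potential-anti {m} K≤m (ℕ.≤′-step {n} m≤n) = begin
      (expSum B n + t) + 2ℚ * expTerm B (suc n)
        ≤⟨ +-monoʳ-≤ (expSum B n + t) (term-halves n (ℕₚ.≤-trans K≤m (ℕₚ.≤′⇒≤ m≤n))) ⟩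
      (expSum B n + t) + t
        ≡⟨ solve 2 (λ e t → (e :+ t) :+ t := e :+ (con 1ℚ :+ con 1ℚ) :* t) refl (expSum B n) t ⟩
      potential n
        ≤⟨ potential-anti K≤m m≤n ⟩
      potential m ∎
      where t = expTerm B n

    term-anti : ∀ {m n} → K ℕ.≤ m → m ℕ.≤′ n → expTerm B n ≤ expTerm B m
    term-anti K≤m ℕ.≤′-refl = ≤-refl
    term-anti {m} K≤m (ℕ.≤′-step {n} m≤n) = begin
      t               ≤⟨ p≤p+q (0≤term 0≤B (suc n)) ⟩
      t + t           ≡⟨ solve 1 (λ t → t :+ t := (con 1ℚ :+ con 1ℚ) :* t) refl t ⟩
      2ℚ * t          ≤⟨ term-halves n (ℕₚ.≤-trans K≤m (ℕₚ.≤′⇒≤ m≤n)) ⟩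
      expTerm B n     ≤⟨ term-anti K≤m m≤n ⟩
      expTerm B m     ∎
      where t = expTerm B (suc n)

    term→0 : ∀ ε → 0ℚ < ε → Eventually (λ n → expTerm B n ≤ ε)
    term→0 ε 0<ε = suc (K ℕ.⊔ N) , go
      where
      small = recip-small (expTerm B K * B) ε 0<ε
      N = proj₁ small
      go : ∀ n → suc (K ℕ.⊔ N) ℕ.≤ n → expTerm B n ≤ ε
      go (suc n) (ℕ.s≤s p) = ≤-trans
        (*-monoˡ (0≤recip n) (*-monoˡ 0≤B
          (term-anti ℕₚ.≤-refl (ℕₚ.≤⇒≤′ (ℕₚ.m⊔n≤o⇒m≤o K N p)))))
        (proj₂ small n (ℕₚ.m⊔n≤o⇒n≤o K N p))

    sum-tail : ∀ {m n} → K ℕ.≤ m → m ℕ.≤ n →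
               ∣ expSum B n - expSum B m ∣ ≤ 2ℚ * expTerm B m
    sum-tail {m} {n} K≤m m≤n = subst (_≤ 2ℚ * expTerm B m)
      (sym (0≤p⇒∣p∣≡p (subst (_≤ expSum B n - expSum B m) (+-inverseʳ (expSum B m))
        (+-monoˡ-≤ (- expSum B m) (sum-mono 0≤B (ℕₚ.≤⇒≤′ m≤n))))))
      (p≤q+r⇒p-q≤r {expSum B n} {expSum B m} (≤-trans (p≤p+q (0≤* (<⇒≤ (positive⁻¹ 2ℚ)) (0≤term 0≤B n)))
        (potential-anti K≤m (ℕₚ.≤⇒≤′ m≤n))))

    sum-cauchy′ : Cauchy (expSum B)
    sum-cauchy′ = cauchy-by 2ℚ (positive⁻¹ 2ℚ) λ δ 0<δ → case term→0 δ 0<δ of λ where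
      (N , h) → K ℕ.⊔ N , λ m n p q →
        let small : ∀ i → K ℕ.⊔ N ℕ.≤ i → 2ℚ * expTerm B i ≤ 2ℚ * δ
            small i r = *-monoʳ (<⇒≤ (positive⁻¹ 2ℚ)) (h i (ℕₚ.m⊔n≤o⇒n≤o K N r))
        in [ (λ m≤n → subst (_≤ 2ℚ * δ) (∣-∣-comm (expSum B n) (expSum B m))
                        (≤-trans (sum-tail (ℕₚ.m⊔n≤o⇒m≤o K N p) m≤n) (small m p)))
           , (λ n≤m → ≤-trans (sum-tail (ℕₚ.m⊔n≤o⇒m≤o K N q) n≤m) (small n q))
           ]′ (ℕₚ.≤-total m n)

  sum-cauchy : ∀ {B} → 0ℚ ≤ B → Cauchy (expSum B)
  sum-cauchy {B} 0≤B = go (archimedean (2ℚ * B))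
    where
    go : (∃ λ K → 2ℚ * B ≤ fromℕ K) → Cauchy (expSum B)
    go (K , 2B≤K) = Tail.sum-cauchy′ 0≤B K 2B≤K

  sum-diff : ∀ {x B} → ∣ x ∣ ≤ B → ∀ {m n} → m ℕ.≤′ n →
             ∣ expSum x n - expSum x m ∣ ≤ expSum B n - expSum B m
  sum-diff {x} {B} x≤B {m} ℕ.≤′-refl = ≤-reflexive
    (trans (cong ∣_∣ (+-inverseʳ (expSum x m))) (sym (+-inverseʳ (expSum B m))))
  sum-diff {x} {B} x≤B {m} (ℕ.≤′-step {n} m≤n) = begin
    ∣ (Sn + expTerm x n) - Sm ∣        ≡⟨ cong ∣_∣ (shuffle Sn (expTerm x n) Sm) ⟩
    ∣ (Sn - Sm) + expTerm x n ∣        ≤⟨ ∣p+q∣≤∣p∣+∣q∣ (Sn - Sm) (expTerm x n) ⟩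
    ∣ Sn - Sm ∣ + ∣ expTerm x n ∣      ≤⟨ +-mono-≤ (sum-diff x≤B m≤n) (term-bound x≤B n) ⟩
    (Tn - Tm) + expTerm B n            ≡⟨ sym (shuffle Tn (expTerm B n) Tm) ⟩
    (Tn + expTerm B n) - Tm            ∎
    where
    Sn = expSum x n
    Sm = expSum x m
    Tn = expSum B n
    Tm = expSum B m
    shuffle : ∀ a b c → (a + b) - c ≡ (a - c) + b
    shuffle = solve 3 (λ a b c → (a :+ b) :- c := (a :- c) :+ b) refl

  sum-diff′ : ∀ {x B} → ∣ x ∣ ≤ B → ∀ m n →
              ∣ expSum x m - expSum x n ∣ ≤ ∣ expSum B m - expSum B n ∣
  sum-diff′ {x} {B} x≤B m n with ℕₚ.≤-total m n
  ... | inj₁ m≤n = subst₂ _≤_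
        (∣-∣-comm (expSum x n) (expSum x m)) (∣-∣-comm (expSum B n) (expSum B m))
        (≤-trans (sum-diff x≤B (ℕₚ.≤⇒≤′ m≤n)) (p≤∣p∣ _))
  ... | inj₂ n≤m = ≤-trans (sum-diff x≤B (ℕₚ.≤⇒≤′ n≤m)) (p≤∣p∣ _)

  exp-cauchy : ∀ {u} → Cauchy u → Cauchy (λ n → expSum (u n) n)
  exp-cauchy {u} cu = go (bounded cu)
    where
    est : ∀ {B C δ} → 0ℚ < C → 0ℚ < δ → ∀ m n →
          ∣ u m ∣ ≤ B → ∣ u n ∣ ≤ B → ∣ expSum B m ∣ ≤ C →
          ∣ u m - u n ∣ ≤ δ → ∣ expSum B m - expSum B n ∣ ≤ δ →
          ∣ expSum (u m) m - expSum (u n) n ∣ ≤ (C + 1ℚ) * δ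
    est {B} {C} {δ} 0<C 0<δ m n um≤B un≤B Sm≤C du≤δ dS≤δ = begin
      ∣ expSum (u m) m - expSum (u n) n ∣
        ≡⟨ cong ∣_∣ (solve 3 (λ a b c → a :- c := (a :- b) :+ (b :- c)) refl
             (expSum (u m) m) (expSum (u n) m) (expSum (u n) n)) ⟩
      ∣ (expSum (u m) m - expSum (u n) m) + (expSum (u n) m - expSum (u n) n) ∣
        ≤⟨ ∣p+q∣≤∣p∣+∣q∣ (expSum (u m) m - expSum (u n) m) (expSum (u n) m - expSum (u n) n) ⟩
      ∣ expSum (u m) m - expSum (u n) m ∣ + ∣ expSum (u n) m - expSum (u n) n ∣
        ≤⟨ +-mono-≤
             (≤-trans (sum-lipschitz um≤B un≤B m)
               (*-mono (0≤∣p∣ (u m - u n)) (<⇒≤ 0<C) du≤δ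
                 (≤-trans (p≤∣p∣ (expSum B m)) Sm≤C)))
             (≤-trans (sum-diff′ un≤B m n) dS≤δ) ⟩
      δ * C + δ
        ≡⟨ solve 2 (λ d c → d :* c :+ d := (c :+ con 1ℚ) :* d) refl δ C ⟩
      (C + 1ℚ) * δ ∎

    go′ : ∀ {B} → Eventually (λ n → ∣ u n ∣ ≤ B) → Cauchy (expSum B) →
          (∃ λ C → 0ℚ < C × Eventually (λ n → ∣ expSum B n ∣ ≤ C)) →
          Cauchy (λ n → expSum (u n) n)
    go′ {B} (K , hB) cS (C , 0<C , L , hC) =
      cauchy-by (C + 1ℚ) (+-mono-< 0<C 0<1) λ δ 0<δ →
        case (modulus cu δ 0<δ , modulus cS δ 0<δ) of λ where
          ((M , hu) , (N , hS)) → (K ℕ.⊔ L) ℕ.⊔ (M ℕ.⊔ N) , λ m n p q →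
            let pKL = ℕₚ.m⊔n≤o⇒m≤o (K ℕ.⊔ L) (M ℕ.⊔ N) p
                qKL = ℕₚ.m⊔n≤o⇒m≤o (K ℕ.⊔ L) (M ℕ.⊔ N) q
                pMN = ℕₚ.m⊔n≤o⇒n≤o (K ℕ.⊔ L) (M ℕ.⊔ N) p
                qMN = ℕₚ.m⊔n≤o⇒n≤o (K ℕ.⊔ L) (M ℕ.⊔ N) q
            in est 0<C 0<δ m n
                 (hB m (ℕₚ.m⊔n≤o⇒m≤o K L pKL))
                 (hB n (ℕₚ.m⊔n≤o⇒m≤o K L qKL))
                 (hC m (ℕₚ.m⊔n≤o⇒n≤o K L pKL))
                 (hu m n (ℕₚ.m⊔n≤o⇒m≤o M N pMN) (ℕₚ.m⊔n≤o⇒m≤o M N qMN))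
                 (hS m n (ℕₚ.m⊔n≤o⇒n≤o M N pMN) (ℕₚ.m⊔n≤o⇒n≤o M N qMN))

    go : (∃ λ B → 0ℚ < B × Eventually (λ n → ∣ u n ∣ ≤ B)) →
         Cauchy (λ n → expSum (u n) n)
    go (B , 0<B , hB) = go′ hB cS (bounded cS)
      where
      cS : Cauchy (expSum B)
      cS = sum-cauchy (<⇒≤ 0<B)

open CauchyLemmas
open ExpLemmas using (exp-cauchy)

infix  4 _≃_ _≤_ _<_ _≥_
infixl 6 _+_ _-_
infixl 7 _*_
infix  8 -_

_≤_ : ℝ → ℝ → Set
x ≤ y = ∀ ε → 0ℚ ℚ.< ε → Eventually (λ n → seq x n ℚ.≤ seq y n ℚ.+ ε)

_≥_ : ℝ → ℝ → Set
x ≥ y = y ≤ x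

_<_ : ℝ → ℝ → Set
x < y = ∃ λ ε → 0ℚ ℚ.< ε × Eventually (λ n → seq x n ℚ.+ ε ℚ.≤ seq y n)

_≃_ : ℝ → ℝ → Set
x ≃ y = x ≤ y × y ≤ x

fromℚ : ℚ → ℝ
fromℚ q = mkℝ (λ _ → q) (const-cauchy q)

0ℝ 1ℝ 2ℝ ½ℝ : ℝ
0ℝ = fromℚ 0ℚ
1ℝ = fromℚ 1ℚ
2ℝ = fromℚ (+ 2 ℚ./ 1)
½ℝ = fromℚ ½

_+_ : ℝ → ℝ → ℝ
mkℝ u cu + mkℝ v cv = mkℝ (λ n → u n ℚ.+ v n) (+-cauchy cu cv)

-_ : ℝ → ℝ
- mkℝ u cu = mkℝ (λ n → ℚ.- u n) (neg-cauchy cu)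

_-_ : ℝ → ℝ → ℝ
x - y = x + (- y)

_*_ : ℝ → ℝ → ℝ
mkℝ u cu * mkℝ v cv = mkℝ (λ n → u n ℚ.* v n) (*-cauchy cu cv)

∣_∣ : ℝ → ℝ
∣ mkℝ u cu ∣ = mkℝ (λ n → ℚ.∣ u n ∣) (∣∣-cauchy cu)

-- On a sequence u converging to x, the diagonal Σ_{k<n} (uₙ)ᵏ / k! tends to eˣ,
-- because the series converges locally uniformly.
exp : ℝ → ℝ
exp (mkℝ u cu) = mkℝ (λ n → expSum (u n) n) (exp-cauchy cu)

-- Only reciprocals of negative numbers are needed.
recip⁻ : (x : ℝ) → x < 0ℝ → ℝ
recip⁻ (mkℝ u cu) (δ , 0<δ , N , h) =
  mkℝ (λ n → inv (u n)) (inv-cauchy δ 0<δ (N , away) cu)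
  where
  open ℚₚ
  open +-*-Solver using (solve; _:+_; _:-_; :-_; _:=_; con)
  away : ∀ n → N ℕ.≤ n → δ ℚ.≤ ℚ.∣ u n ∣
  away n N≤n = ≤-trans
    (subst₂ ℚ._≤_
      (solve 2 (λ a d → a :+ d :+ (:- a) := d) refl (u n) δ)
      (solve 1 (λ a → con 0ℚ :+ (:- a) := :- a) refl (u n))
      (+-monoˡ-≤ (ℚ.- u n) (h n N≤n)))
    (≤-trans (p≤∣p∣ (ℚ.- u n)) (≤-reflexive (∣-p∣≡∣p∣ (u n))))

x<1⇒x-1<0 : ∀ x → x < 1ℝ → x - 1ℝ < 0ℝ
x<1⇒x-1<0 (mkℝ u _) (δ , 0<δ , N , h) = δ , 0<δ , N , λ n N≤n →
  subst (ℚ._≤ 0ℚ)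
    (solve 2 (λ a d → a :+ d :- con 1ℚ := a :- con 1ℚ :+ d) refl (u n) δ)
    (ℚₚ.+-monoˡ-≤ (ℚ.- 1ℚ) (h n N≤n))
  where open +-*-Solver using (solve; _:+_; _:-_; _:=_; con)

f : (x : ℝ) → x < 1ℝ → ℝ
f x x<1 = ½ℝ * (1ℝ - x) * (1ℝ - exp (2ℝ * x * recip⁻ (x - 1ℝ) (x<1⇒x-1<0 x x<1)))

-- β ≤ ½, so that β lies in the domain of f.
β<1 : ∀ α β γ → α ≥ β → γ ≥ 0ℝ → α + β + γ ≃ 1ℝ → β < 1ℝ
β<1 (mkℝ a _) (mkℝ b _) (mkℝ c _) α≥β γ≥0 (sum≤1 , _)
  with α≥β δ 0<δ | γ≥0 δ 0<δ | sum≤1 δ 0<δ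
  where
  δ = + 1 ℚ./ 6
  0<δ = ℚₚ.positive⁻¹ δ
... | K , hK | L , hL | M , hM =
  δ′ , ℚₚ.positive⁻¹ δ′ , (K ℕ.⊔ L) ℕ.⊔ M , λ n p →
    let pKL = ℕₚ.m⊔n≤o⇒m≤o (K ℕ.⊔ L) M p in
    bound (a n) (b n) (c n)
      (hK n (ℕₚ.m⊔n≤o⇒m≤o K L pKL)) (hL n (ℕₚ.m⊔n≤o⇒n≤o K L pKL))
      (hM n (ℕₚ.m⊔n≤o⇒n≤o (K ℕ.⊔ L) M p))
  where
  open ℚ using (_/_) renaming (_+_ to _+q_; _*_ to _*q_; -_ to -q_; _≤_ to _≤q_)
  open ℚₚ
  open +-*-Solver using (solve; _:+_; _:*_; _:-_; :-_; _:=_; con)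
  δ = + 1 / 6
  δ′ = + 1 / 4
  bound : ∀ a b c → b ≤q a +q δ → 0ℚ ≤q c +q δ → a +q b +q c ≤q 1ℚ +q δ →
          b +q δ′ ≤q 1ℚ
  bound a b c h₁ h₂ h₃ = subst₂ _≤q_
    (solve 3 (λ a b c → con ½ :* (b :+ con 0ℚ :+ (a :+ b :+ c)) :+
                        (con ½ :* (:- (a :+ c)) :+ con δ′) := b :+ con δ′) refl a b c)
    (solve 2 (λ a c → con ½ :* (a :+ con δ :+ (c :+ con δ) :+ (con 1ℚ :+ con δ)) :+
                        (con ½ :* (:- (a :+ c)) :+ con δ′) := con 1ℚ) refl a c)
    (+-monoˡ-≤ (½ *q (-q (a +q c)) +q δ′)
      (*-monoʳ (<⇒≤ (positive⁻¹ ½)) (+-mono-≤ (+-mono-≤ h₁ h₂) h₃)))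

-- A permutation matrix P acts by (P v)ᵢ = v_{π i} for a permutation π.
record _∈S (s : Vector ℝ 3) : Set where
  field
    α β γ   : ℝ
    α≥β     : α ≥ β
    β≥γ     : β ≥ γ
    γ≥0     : γ ≥ 0ℝ
    sum≃1   : α + β + γ ≃ 1ℝ
    γ≥f[β]  : γ ≥ f β (β<1 α β γ α≥β γ≥0 sum≃1)
    π       : Permutation′ 3
    s≃Pαβγ  : ∀ i → s i ≃ (α ∷ β ∷ γ ∷ []) (π ⟨$⟩ʳ i)

‖_‖₁ : ∀ {n} → Vector ℝ n → ℝ
‖ v ‖₁ = foldr _+_ 0ℝ (map ∣_∣ v)

-- A multigraph, loops allowed, with four labelled half-edges. The two
-- ends of an edge are named by Bool, in an arbitrary order.
record HalfEdgeGraph : Set₁ where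
  field
    Vertex       : Set
    Edge         : Set
    finiteVertex : ∃ λ n → Vertex ↔ Fin n
    finiteEdge   : ∃ λ n → Edge ↔ Fin n
    edgeAt       : Edge → Bool → Vertex
    halfAt       : Fin 4 → Vertex

  -- An edge-end or a half-edge. A loop contributes two darts at its vertex.
  data Dart : Set where
    end  : Edge → Bool → Dart
    half : Fin 4 → Dart

  at : Dart → Vertex
  at (end e i) = edgeAt e i
  at (half h)  = halfAt h

  HasDegree : Vertex → ℕ → Set
  HasDegree v k = (∃ λ d → at d ≡ v) ↔ Fin k

record Gadget : Set₁ where
  field
    graph    : HalfEdgeGraph
    4regular : ∀ v → HalfEdgeGraph.HasDegree graph v 4

  open HalfEdgeGraph graph public

module _ (G : Gadget) where

  open Gadget G

  -- A perfect matching of the darts at each vertex.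
  record Matching : Set where
    field
      mate         : Dart → Dart
      local        : ∀ d → at (mate d) ≡ at d
      involutive   : ∀ d → mate (mate d) ≡ d
      irreflexive  : ∀ d → mate d ≢ d

  module _ (M : Matching) where

    open Matching M

    -- Entering a vertex through d, the trail leaves it through mate d;
    -- if this is an end of an edge, the next vertex is entered through
    -- the other end of that edge.
    data _↝_ : Dart → Dart → Set where
      traverse : ∀ {d e i} → mate d ≡ end e i → d ↝ end e (not i)

    Route : Fin 4 → Fin 4 → Set
    Route a b = ∃ λ d → Star _↝_ (half a) d × mate d ≡ half b

    ClosedTrail : Set
    ClosedTrail = ∃ λ d → TransClosure _↝_ d d

  -- VR({a,b},{c,d}), where two matchings are identified when they agree
  -- on every dart.
  VR : (a b c d : Fin 4) → Setoid 0ℓ 0ℓ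
  VR a b c d = record
    { Carrier       = Σ Matching λ M → Route M a b × Route M c d × ¬ ClosedTrail M
    ; _≈_           = _≗_ on (Matching.mate ∘ proj₁)
    ; isEquivalence = record
      { refl  = λ _ → refl
      ; sym   = λ p d → sym (p d)
      ; trans = λ p q d → trans (p d) (q d)
      }
    }

  record HasSignature (σ : Vector ℚ 3) : Set where
    field
      a b c  : ℕ
      card-a : Inverse (VR 0F 1F 2F 3F) (setoid (Fin a))
      card-b : Inverse (VR 0F 2F 1F 3F) (setoid (Fin b))
      card-c : Inverse (VR 0F 3F 1F 2F) (setoid (Fin c))

    N : ℕ
    N = a ℕ.+ b ℕ.+ c

    field
      .{{N>0}} : ℕ.NonZero N
      σ≗abc/N  : σ ≗ (+ a ℚ./ N) ∷ (+ b ℚ./ N) ∷ (+ c ℚ./ N) ∷ []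

{-# OPTIONS --safe #-}

-- Give a gadget with counts (a, b, c) for the pairings 01|23, 02|13, 03|12 the
-- coordinates p = a/(b+c) and q = (b-c)/(b+c). Series composition adds the p's
-- and multiplies the q's, since two adjacent pairings 01|23 close up a trail.
-- A vertex is (1/2, 0), and exchanging the first two pairings turns (p, 0) into
-- (r, 1-2r) with r = 1/(2p+1); this realizes (r, 1-2r) for rational 0 < r ≤ 1/2.
-- With β in the role of a, S lies in the region max(0, 1-2p) ≤ q ≤ exp(-2p). For
-- small y = 1/M, composing (jy/2, 1-jy) with k-j copies of (y/2, 1-y) gives
-- p = ky/2, while q descends in steps of at most y from (1-y)ᵏ ≈ exp(-2p) at
-- j = 1 to max(0, 1-2p), so a discrete intermediate value argument applies.

module Submission where

-- Normalizing the counts so that `a` becomes β gives p = β/(1-β), hence 2β/(β-1) = -2p, and the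
-- other two entries are (1 ± q)/(2(1+p)). This is where the region comes from: γ ≥ f(β) reads q ≤
-- exp(-2p), γ ≤ β reads q ≥ 1-2p, γ ≤ α reads q ≥ 0, and β ≤ 1/2 reads p ≤ 1. Two obstacles shape
-- the formalization. Matchings are functions on darts, compared only pointwise, so every count is a
-- bijection of setoids. And real inequalities cannot be decided: they only hold up to a slack for
-- all late terms of the Cauchy sequences. So the gadget is chosen for one rational triple that
-- satisfies the conditions of S up to δ, with exp truncated at the same index. All errors are kept
-- linear in δ with explicit constants, and δ is computed from ε at the end.

open import Defs hiding (_≤_; _<_; _≥_; _+_; _-_; _*_; -_; ∣_∣; _≃_)
open import Data.Bool.Base using (Bool; true; false; not)
open import Data.Fin.Base as Fin using (Fin; zero; suc)
open import Data.Fin.Patterns using (0F; 1F; 2F; 3F)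
open import Data.Fin.Permutation
  using (Permutation′; _⟨$⟩ʳ_; _⟨$⟩ˡ_; inverseˡ; inverseʳ; lift₀; transpose; _∘ₚ_)
open import Data.Integer.Base as ℤ using (+_)
import Data.Integer.Properties as ℤₚ
open import Data.Nat.Base as ℕ using (ℕ; zero; suc)
import Data.Nat.Properties as ℕₚ
open import Data.Product using (Σ; ∃; _×_; _,_; proj₁; proj₂; map₂)
open import Data.Rational as ℚ using (ℚ; 0ℚ; 1ℚ; ½) hiding (module ℚ)
open import Data.Sum.Base using (_⊎_; inj₁; inj₂; [_,_]′)
open import Data.Vec.Functional using (Vector; map; zipWith)
open import Function.Base using (_∘_; id; _on_)
open import Function.Bundles using (_↔_; Inverse; mk↔ₛ′)
open import Function.Construct.Composition using (_↔-∘_; inverse)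
open import Relation.Binary.PropositionalEquality
  using (_≡_; _≢_; _≗_; refl; sym; trans; cong; cong₂; subst; subst₂; setoid)
open import Relation.Nullary.Decidable using (yes; no; ¬?; _→-dec_; _×-dec_; from-yes)
open import Relation.Nullary.Negation using (¬_; contradiction)

-- Trails and counts

module _ where

  open import Data.Bool.Properties using (not-involutive; not-¬)
  open import Data.Empty using (⊥; ⊥-elim)
  open import Data.Fin.Properties using (pigeonhole; all?; any?; _≟_; +↔⊎; *↔×; 2↔Bool)
  open import Data.Maybe.Base using (Maybe; just; nothing)
  open import Data.Maybe.Properties using (≡-dec)
  open import Data.Product.Function.NonDependent.Propositional using (_×-↔_)
  open import Data.Product.Function.NonDependent.Setoid using (_×-inverse_)
  open import Data.Product.Relation.Binary.Pointwise.NonDependent as × using (_×ₛ_)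
  open import Data.Sum.Function.Propositional using (_⊎-↔_)
  open import Data.Sum.Function.Setoid using (_⊎-inverse_)
  open import Data.Sum.Relation.Binary.Pointwise as ⊎ using (_⊎ₛ_; inj₁; inj₂)
  open import Data.Unit.Base using (⊤; tt)
  open import Function.Bundles using (Injection)
  open import Function.Construct.Identity using (↔-id)
  open import Function.Construct.Symmetry using (↔-sym)
  open import Function.Properties.Inverse using (Inverse⇒Injection)
  open import Level using (0ℓ)
  open import Relation.Binary.Bundles using (Setoid)
  open import Relation.Binary.Construct.Closure.ReflexiveTransitive
    using (Star; ε; _◅_; _◅◅_; gmap; reverse)
  open import Relation.Binary.Construct.Closure.Transitive
    using (TransClosure; [_]; _∷_; _∷ʳ_)
  open HalfEdgeGraph using (end; half)

  -- The pairing with number i joins half-edge 0 to half-edge i + 1.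
  partner : Fin 3 → Fin 4 → Fin 4
  partner 0F 0F = 1F
  partner 0F 1F = 0F
  partner 0F 2F = 3F
  partner 0F 3F = 2F
  partner 1F 0F = 2F
  partner 1F 1F = 3F
  partner 1F 2F = 0F
  partner 1F 3F = 1F
  partner 2F 0F = 3F
  partner 2F 1F = 2F
  partner 2F 2F = 1F
  partner 2F 3F = 0F

  -- The four implications allow `a` and `b` to meet the pair of 0 and `suc i` only by being that
  -- pair; otherwise `a ≢ b` leaves just the complementary pair. A finite check by evaluation.
  partner-determined : ∀ i a b → a ≢ b →
    (a ≡ 0F → b ≡ suc i) → (b ≡ 0F → a ≡ suc i) →
    (a ≡ suc i → b ≡ 0F) → (b ≡ suc i → a ≡ 0F) → b ≡ partner i a
  partner-determined = from-yes (all? λ i → all? λ a → all? λ b →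
    ¬? (a ≟ b) →-dec ((a ≟ 0F) →-dec (b ≟ suc i)) →-dec
    ((b ≟ 0F) →-dec (a ≟ suc i)) →-dec ((a ≟ suc i) →-dec (b ≟ 0F)) →-dec
    ((b ≟ suc i) →-dec (a ≟ 0F)) →-dec (b ≟ partner i a))

  -- Trails followed by one matching

  module Trails (G : Gadget) (M : Matching G) where

    open Gadget G hiding (end; half)
    open Matching M

    infix 4 _⇝_
    _⇝_ : Dart → Dart → Set
    _⇝_ = _↝_ G M

    -- Routes with an arbitrary starting dart: `Route G M a b` unfolds to `Exit b (half a)`, so a
    -- route is used directly as an exit.
    Exit : Fin 4 → Dart → Set
    Exit b d = ∃ λ d′ → Star _⇝_ d d′ × mate d′ ≡ half b

    Exits : Dart → Set
    Exits d = ∃ λ b → Exit b d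

    extend : ∀ {b d d′} → Star _⇝_ d d′ → Exit b d′ → Exit b d
    extend p (d , q , m) = d , p ◅◅ q , m

    deterministic : ∀ {d x y} → d ⇝ x → d ⇝ y → x ≡ y
    deterministic (traverse p) (traverse q) with refl ← trans (sym p) q = refl

    exit-stuck : ∀ {b d x} → mate d ≡ half b → ¬ d ⇝ x
    exit-stuck p (traverse q) with () ← trans (sym p) q

    exit-unique : ∀ {b c d} → Exit b d → Exit c d → b ≡ c
    exit-unique (_ , p , m) (_ , q , n) = go p m q n
      where
      go : ∀ {b c d x y} → Star _⇝_ d x → mate x ≡ half b →
           Star _⇝_ d y → mate y ≡ half c → b ≡ c
      go ε p ε q with refl ← trans (sym p) q = refl
      go ε p (t ◅ _) _ = contradiction t (exit-stuck p)
      go (s ◅ _) _ ε q = contradiction s (exit-stuck q)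
      go (s ◅ ss) p (t ◅ ts) q with refl ← deterministic s t = go ss p ts q

    -- Reversal exchanges the two ends of the traversed edge, and at each vertex `mate` exchanges
    -- arrival and departure.
    reverse-step : ∀ {d d′} → d ⇝ d′ → mate d′ ⇝ mate d
    reverse-step (traverse {e = e} {i} p) = subst (mate (end e (not i)) ⇝_)
      (trans (cong (end e) (not-involutive i)) (sym p))
      (traverse (involutive (end e (not i))))

    reverse-path : ∀ {d d′} → Star _⇝_ d d′ → Star _⇝_ (mate d′) (mate d)
    reverse-path = gmap {U = _⇝_} mate id ∘ reverse {U = λ x y → mate x ⇝ mate y} reverse-step

    reverse-route : ∀ {a b} → Route G M a b → Route G M b a
    reverse-route {a} {b} (d , p , m) = mate (half a)
      , subst (λ x → Star _⇝_ x (mate (half a))) m (reverse-path p) , involutive (half a)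

    -- A trail leading from d to mate d coincides with its own reversal, so its
    -- middle would be a fixed point of mate or of the exchange of edge ends.
    no-reversal : ∀ {d d′} → Star _⇝_ d d′ → d′ ≢ mate d
    no-reversal p = go _ p ℕₚ.≤-refl
      where
      length : ∀ {x y} → Star _⇝_ x y → ℕ
      length ε       = 0
      length (_ ◅ p) = ℕ.suc (length p)

      unsnoc : ∀ {x y z} → x ⇝ y → (p : Star _⇝_ y z) →
               ∃ λ w → Σ (Star _⇝_ x w) λ q → w ⇝ z × length q ≡ length p
      unsnoc s ε       = _ , ε , s , refl
      unsnoc s (t ◅ p) with unsnoc t p
      ... | w , q , u , e = w , s ◅ q , u , cong ℕ.suc e

      go : ∀ n {x y} (p : Star _⇝_ x y) → length p ℕ.≤ n → y ≢ mate x
      go _ ε _ e = irreflexive _ (sym e)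
      go _ (traverse p ◅ ε) _ e with trans e p
      ... | q = contradiction (sym (end-injectiveʳ q)) (not-¬ refl)
        where
        end-injectiveʳ : ∀ {e e′ i j} → end e i ≡ end e′ j → i ≡ j
        end-injectiveʳ refl = refl
      go (ℕ.suc (ℕ.suc n)) {x} (s ◅ t ◅ p) (ℕ.s≤s (ℕ.s≤s l)) refl with unsnoc t p
      ... | w , q , u , e = go n q (subst (ℕ._≤ n) (sym e) l)
        (trans (sym (involutive w)) (cong mate (deterministic
          (subst (_⇝ mate w) (involutive x) (reverse-step u)) s)))

    route-irreflexive : ∀ {a} → ¬ Route G M a a
    route-irreflexive {a} (d , p , m) = no-reversal p (trans (sym (involutive d)) (cong mate m))

    -- Steps are deterministic, so a closed trail through `d` can be rotated along the exit path to
    -- its last dart, where no step is possible.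
    exits⇒¬closed-through : ∀ {b d} → Exit b d → ¬ TransClosure _⇝_ d d
    exits⇒¬closed-through (_ , ε , p) [ s ]   = exit-stuck p s
    exits⇒¬closed-through (_ , ε , p) (s ∷ _) = exit-stuck p s
    exits⇒¬closed-through (_ , s ◅ p , m) c = exits⇒¬closed-through (_ , p , m) (rotate s c)
      where
      rotate : ∀ {x y} → x ⇝ y → TransClosure _⇝_ x x → TransClosure _⇝_ y y
      rotate s [ t ]   with refl ← deterministic s t = [ t ]
      rotate s (t ∷ c) with refl ← deterministic s t = c ∷ʳ s

    exits⇒¬closed : (∀ d → Exits d) → ¬ ClosedTrail G M
    exits⇒¬closed h (d , c) = exits⇒¬closed-through (proj₂ (h d)) c

    private
      step : ∀ d → (∃ λ b → mate d ≡ half b) ⊎ (∃ λ d′ → d ⇝ d′)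
      step d with mate d in eq
      ... | end e i = inj₂ (_ , traverse eq)
      ... | half b  = inj₁ (b , refl)

      -- If the trail does not leave, it yields `n + 1` darts, each reached from every earlier one
      -- by at least one step, so that a repetition among them is a closed trail.
      walk : ∀ n d → Exits d ⊎
        Σ (Fin (ℕ.suc n) → Dart) λ w → w 0F ≡ d ×
          (∀ {i j} → i Fin.< j → TransClosure _⇝_ (w i) (w j))
      walk ℕ.zero    d = inj₂ ((λ _ → d) , refl , λ { {0F} {0F} () })
      walk (ℕ.suc n) d with step d
      ... | inj₁ (b , m) = inj₁ (b , d , ε , m)
      ... | inj₂ (d′ , s) with walk n d′
      ...   | inj₁ (b , x) = inj₁ (b , extend (s ◅ ε) x)
      ...   | inj₂ (w , refl , h) = inj₂ (w′ , refl , h′)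
        where
        w′ : Fin (ℕ.suc (ℕ.suc n)) → Dart
        w′ zero    = d
        w′ (suc i) = w i
        h′ : ∀ {i j} → i Fin.< j → TransClosure _⇝_ (w′ i) (w′ j)
        h′ {zero}  {suc zero}    _ = [ s ]
        h′ {zero}  {suc (suc j)} _ = s ∷ h (ℕ.s≤s ℕ.z≤n)
        h′ {suc i} {suc j} (ℕ.s≤s p) = h p

      darts : Dart ↔ ((Edge × Bool) ⊎ Fin 4)
      darts = mk↔ₛ′
        (λ { (end e i) → inj₁ (e , i) ; (half b) → inj₂ b })
        (λ { (inj₁ (e , i)) → end e i ; (inj₂ b) → half b })
        (λ { (inj₁ _) → refl ; (inj₂ _) → refl })
        (λ { (end _ _) → refl ; (half _) → refl })

      finiteDart : ∃ λ n → Dart ↔ Fin n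
      finiteDart = _ , ↔-sym +↔⊎ ↔-∘ (((↔-sym *↔× ↔-∘ (proj₂ finiteEdge ×-↔ ↔-sym 2↔Bool)) ⊎-↔ ↔-id _) ↔-∘ darts)

    ¬closed⇒exits : ¬ ClosedTrail G M → ∀ d → Exits d
    ¬closed⇒exits ¬c d with walk (proj₁ finiteDart) d
    ... | inj₁ x = x
    ... | inj₂ (w , _ , h)
      with pigeonhole (ℕₚ.n<1+n _) (Inverse.to (proj₂ finiteDart) ∘ w)
    ...   | i , j , i<j , eq = contradiction
      (w i , subst (TransClosure _⇝_ (w i)) (sym (to-injective eq)) (h i<j)) ¬c
      where
      to-injective = Injection.injective (Inverse⇒Injection (proj₂ finiteDart))

    route-from-0 : ¬ ClosedTrail G M → ∃ λ i → Route G M 0F (suc i)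
    route-from-0 ¬c with ¬closed⇒exits ¬c (half 0F)
    ... | zero  , r = contradiction r route-irreflexive
    ... | suc i , r = i , r

    -- Every half-edge exits somewhere; reversibility and `exit-unique` make the exits a
    -- fixed-point-free involution, so the route from 0 determines the other one.
    route-partner : ¬ ClosedTrail G M → ∀ {i} → Route G M 0F (suc i) →
                    ∀ a → Route G M a (partner i a)
    route-partner ¬c {i} r a with ¬closed⇒exits ¬c (half a)
    ... | b , x = subst (λ b → Route G M a b) (partner-determined i a b
      (λ { refl → route-irreflexive x })
      (λ { refl → exit-unique x r })
      (λ { refl → exit-unique (reverse-route x) r })
      (λ { refl → exit-unique x (reverse-route r) })
      (λ { refl → exit-unique (reverse-route x) (reverse-route r) })) x

  -- Keeps only the route from half-edge 0, since the second route of `VR` follows from the absence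
  -- of closed trails. One index then covers all three pairings.
  Valid : (G : Gadget) → Fin 3 → Setoid 0ℓ 0ℓ
  Valid G i = record
    { Carrier       = Σ (Matching G) λ M → Route G M 0F (suc i) × ¬ ClosedTrail G M
    ; _≈_           = _≗_ on (Matching.mate ∘ proj₁)
    ; isEquivalence = record
      { refl  = λ _ → refl
      ; sym   = λ p d → sym (p d)
      ; trans = λ p q d → trans (p d) (q d)
      }
    }

  VR↔Valid : ∀ G i c → Inverse (VR G 0F (suc i) c (partner i c)) (Valid G i)
  VR↔Valid G i c = record
    { to        = λ (M , r , _ , ¬c) → M , r , ¬c
    ; from      = λ (M , r , ¬c) → M , r , Trails.route-partner G M ¬c r c , ¬c
    ; to-cong   = id
    ; from-cong = id
    ; inverse   = id , id
    }

  _HasCounts_ : Gadget → (Fin 3 → ℕ) → Set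
  G HasCounts n = ∀ i → Inverse (Valid G i) (setoid (Fin (n i)))

  module _ {G : Gadget} {M M′ : Matching G} (M≗M′ : Matching.mate M ≗ Matching.mate M′) where

    ↝-resp-≗ : ∀ {d d′} → _↝_ G M d d′ → _↝_ G M′ d d′
    ↝-resp-≗ (traverse p) = traverse (trans (sym (M≗M′ _)) p)

    route-resp-≗ : ∀ {a b} → Route G M a b → Route G M′ a b
    route-resp-≗ (d , p , m) = d , gmap id ↝-resp-≗ p , trans (sym (M≗M′ d)) m

    Valid-index-unique : ∀ {i j} → Route G M 0F (suc i) → Route G M′ 0F (suc j) → i ≡ j
    Valid-index-unique r s with refl ← Trails.exit-unique G M′ (route-resp-≗ r) s = refl

  gmap⁺ : {A B : Set} {R : A → A → Set} {S : B → B → Set} (f : A → B) →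
          (∀ {x y} → R x y → S (f x) (f y)) → ∀ {x y} → TransClosure R x y → TransClosure S (f x) (f y)
  gmap⁺ f h [ r ]    = [ h r ]
  gmap⁺ f h (r ∷ rs) = h r ∷ gmap⁺ f h rs

  _▻⁺_ : {A : Set} {R : A → A → Set} → ∀ {x y z} → Star R x y → R y z → TransClosure R x z
  ε        ▻⁺ s = [ s ]
  (r ◅ rs) ▻⁺ s = r ∷ (rs ▻⁺ s)

  ΣBool↔⊎ : {A : Bool → Set} → Σ Bool A ↔ (A false ⊎ A true)
  ΣBool↔⊎ = mk↔ₛ′
    (λ { (false , x) → inj₁ x ; (true , x) → inj₂ x })
    (λ { (inj₁ x) → false , x ; (inj₂ x) → true , x })
    (λ { (inj₁ _) → refl ; (inj₂ _) → refl })
    (λ { (false , _) → refl ; (true , _) → refl })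

  finite-⊎ : {A B : Set} → (∃ λ n → A ↔ Fin n) → (∃ λ n → B ↔ Fin n) → ∃ λ n → (A ⊎ B) ↔ Fin n
  finite-⊎ (_ , f) (_ , g) = _ , ↔-sym +↔⊎ ↔-∘ (f ⊎-↔ g)

  _⊗_ : ∀ {A B : Setoid 0ℓ 0ℓ} {m n} → Inverse A (setoid (Fin m)) → Inverse B (setoid (Fin n)) →
        Inverse (A ×ₛ B) (setoid (Fin (m ℕ.* n)))
  f ⊗ g = inverse (f ×-inverse g) (inverse ×.Pointwise-≡↔≡ (↔-sym *↔×))

  _⊕_ : ∀ {A B : Setoid 0ℓ 0ℓ} {m n} → Inverse A (setoid (Fin m)) → Inverse B (setoid (Fin n)) →
        Inverse (A ⊎ₛ B) (setoid (Fin (m ℕ.+ n)))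
  f ⊕ g = inverse (f ⊎-inverse g) (inverse (⊎.Pointwise-≡↔≡ _ _) (↔-sym +↔⊎))

  fibre-≡ : {A B : Set} {h : A → B} {b : B} {x y : ∃ λ a → h a ≡ b} →
            proj₁ x ≡ proj₁ y → x ≡ y
  fibre-≡ {x = _ , refl} {_ , refl} refl = refl

  -- Series composition: half-edges 2 and 3 of G false are joined to half-edges
  -- 0 and 1 of G true.
  module Series (G : Bool → Gadget) where

    private
      module G s = Gadget (G s)
      module T s = Trails (G s)

    -- A half-edge of G s either becomes an end of a new edge or stays a half-edge.
    port : Bool → Fin 4 → Bool ⊎ Fin 4
    port false 0F = inj₂ 0F
    port false 1F = inj₂ 1F
    port false 2F = inj₁ false
    port false 3F = inj₁ true
    port true  0F = inj₁ false
    port true  1F = inj₁ true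
    port true  2F = inj₂ 2F
    port true  3F = inj₂ 3F

    inner : Bool → Bool → Fin 4
    inner false false = 2F
    inner false true  = 3F
    inner true  false = 0F
    inner true  true  = 1F

    outer : Fin 4 → Bool
    outer 0F = false
    outer 1F = false
    outer 2F = true
    outer 3F = true

    graph : HalfEdgeGraph
    graph = record
      { Vertex       = Σ Bool G.Vertex
      ; Edge         = Σ Bool G.Edge ⊎ Bool
      ; finiteVertex = map₂ (_↔-∘ ΣBool↔⊎) (finite-⊎ (G.finiteVertex false) (G.finiteVertex true))
      ; finiteEdge   = finite-⊎
          (map₂ (_↔-∘ ΣBool↔⊎) (finite-⊎ (G.finiteEdge false) (G.finiteEdge true)))
          (2 , ↔-sym 2↔Bool)
      ; edgeAt       = λ { (inj₁ (s , e)) i → s , G.edgeAt s e i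
                         -- End `s` of a joining edge lies in `G s`, so the `not` in `traverse` is
                         -- the change of component.
                         ; (inj₂ j)       s → s , G.halfAt s (inner s j) }
      ; halfAt       = λ h → outer h , G.halfAt (outer h) h
      }

    open HalfEdgeGraph graph hiding (end; half)

    ι : ∀ s → G.Dart s → Dart
    ι s (end e i) = end (inj₁ (s , e)) i
    ι s (half h)  = [ (λ j → end (inj₂ j) s) , half ]′ (port s h)

    split : Dart → Σ Bool G.Dart
    split (end (inj₁ (s , e)) i) = s , end e i
    split (end (inj₂ j) s)       = s , half (inner s j)
    split (half h)               = outer h , half h

    ι-inner : ∀ s j → ι s (half (inner s j)) ≡ end (inj₂ j) s
    ι-inner false false = refl
    ι-inner false true  = refl
    ι-inner true  false = refl
    ι-inner true  true  = refl

    split-ι : ∀ s d → split (ι s d) ≡ (s , d)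
    split-ι s     (end e i) = refl
    split-ι false (half 0F) = refl
    split-ι false (half 1F) = refl
    split-ι false (half 2F) = refl
    split-ι false (half 3F) = refl
    split-ι true  (half 0F) = refl
    split-ι true  (half 1F) = refl
    split-ι true  (half 2F) = refl
    split-ι true  (half 3F) = refl

    ι-split : ∀ d → ι (proj₁ (split d)) (proj₂ (split d)) ≡ d
    ι-split (end (inj₁ _) _) = refl
    ι-split (end (inj₂ j) s) = ι-inner s j
    ι-split (half 0F)        = refl
    ι-split (half 1F)        = refl
    ι-split (half 2F)        = refl
    ι-split (half 3F)        = refl

    ι-injective : ∀ {s d d′} → ι s d ≡ ι s d′ → d ≡ d′
    ι-injective {s} {d} {d′} e
      with refl ← trans (sym (split-ι s d)) (trans (cong split e) (split-ι s d′)) = refl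

    at-split : ∀ d → at d ≡ (proj₁ (split d) , G.at (proj₁ (split d)) (proj₂ (split d)))
    at-split (end (inj₁ _) _) = refl
    at-split (end (inj₂ _) _) = refl
    at-split (half _)         = refl

    at-ι : ∀ s d → at (ι s d) ≡ (s , G.at s d)
    at-ι s d = trans (at-split (ι s d)) (cong (λ (s , d) → s , G.at s d) (split-ι s d))

    darts-at : ∀ s v → (∃ λ d → at d ≡ (s , v)) ↔ (∃ λ d → G.at s d ≡ v)
    darts-at s v = mk↔ₛ′
      (λ (d , p) → to (split d) (trans (sym (at-split d)) p))
      (λ (d , p) → ι s d , trans (at-ι s d) (cong (s ,_) p))
      (λ (d , p) → to-split d p _)
      (λ (d , p) → fibre-≡ (from-to (split d) (trans (sym (at-split d)) p) (ι-split d)))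
      where
      to : ((s′ , d) : Σ Bool G.Dart) → (s′ , G.at s′ d) ≡ (s , v) → ∃ λ d → G.at s d ≡ v
      to (_ , d) refl = d , refl
      to-split : ∀ d (p : G.at s d ≡ v) q → to (split (ι s d)) q ≡ (d , p)
      to-split d refl q with split (ι s d) | split-ι s d
      to-split d refl refl | _ | refl = refl
      from-to : ∀ x q {d} → ι (proj₁ x) (proj₂ x) ≡ d → ι s (proj₁ (to x q)) ≡ d
      from-to (_ , _) refl e = e

    series : Gadget
    series = record
      { graph    = graph
      ; 4regular = λ (s , v) → Gadget.4regular (G s) v ↔-∘ darts-at s v
      }

    -- The half-edge reached from half-edge a of G s in at most n traversals, if
    -- G false and G true are traversed by the pairings π false and π true.
    chase : (Bool → Fin 3) → ℕ → Bool → Fin 4 → Maybe (Fin 4)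
    chase π ℕ.zero    s a = nothing
    chase π (ℕ.suc n) s a with port s (partner (π s) a)
    ... | inj₁ j = chase π n (not s) (inner (not s) j)
    ... | inj₂ b = just b

    -- `restricts` is all that relates a matching of the composite to those of its components, so
    -- the facts below serve both `restrict` and `join`.
    module Restriction (M : Matching series) (N : ∀ s → Matching (G s))
      (restricts : ∀ s d → Matching.mate M (ι s d) ≡ ι s (Matching.mate (N s) d)) where

      open Matching M
      open Trails series M
      private
        module N s = Matching (N s)
        module TN s = Trails (G s) (N s)

      lift-step : ∀ s {d d′} → TN._⇝_ s d d′ → ι s d ⇝ ι s d′
      lift-step s (traverse p) = traverse (trans (restricts s _) (cong (ι s) p))

      lift-path : ∀ s {d d′} → Star (TN._⇝_ s) d d′ → Star _⇝_ (ι s d) (ι s d′)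
      lift-path s = gmap (ι s) (lift-step s)

      lift-closed : ∀ s → ClosedTrail (G s) (N s) → ClosedTrail series M
      lift-closed s (d , c) = ι s d , gmap⁺ (ι s) (lift-step s) c

      port-half : ∀ s {h} {x} → port s h ≡ x → ι s (half h) ≡ [ (λ j → end (inj₂ j) s) , half ]′ x
      port-half s refl = refl

      cross : ∀ s {b d j} → TN.Exit s b d → port s b ≡ inj₁ j →
              TransClosure _⇝_ (ι s d) (ι (not s) (half (inner (not s) j)))
      cross s {j = j} (d , p , m) eq = subst (TransClosure _⇝_ _) (sym (ι-inner (not s) j))
        (lift-path s p ▻⁺ traverse (trans (restricts s d) (trans (cong (ι s) m) (port-half s eq))))

      leave : ∀ s {b c d} → TN.Exit s b d → port s b ≡ inj₂ c → Exit c (ι s d)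
      leave s (d , p , m) eq = ι s d , lift-path s p
        , trans (restricts s d) (trans (cong (ι s) m) (port-half s eq))

      star : ∀ {x y} → TransClosure _⇝_ x y → Star _⇝_ x y
      star [ s ]   = s ◅ ε
      star (s ∷ c) = s ◅ star c

      -- A component without closed trails is left from each of its darts, so it suffices to know
      -- that the trails from half-edges of the components exit.
      all-exit : (∀ s → ¬ ClosedTrail (G s) (N s)) → (∀ s a → Exits (ι s (half a))) → ∀ d → Exits d
      all-exit ¬c h d = subst Exits (ι-split d) (go (proj₁ (split d)) (proj₂ (split d)))
        where
        go : ∀ s d → Exits (ι s d)
        go s d with TN.¬closed⇒exits s (¬c s) d
        ... | b , x with port s b in eq
        ...   | inj₁ j = map₂ (extend (star (cross s x eq))) (h (not s) (inner (not s) j))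
        ...   | inj₂ c = c , leave s x eq

      module _ (π : Bool → Fin 3) (routes : ∀ s a → Route (G s) (N s) a (partner (π s) a)) where

        chase-exit : ∀ n s a {b} → chase π n s a ≡ just b → Exit b (ι s (half a))
        chase-exit (ℕ.suc n) s a eq with port s (partner (π s) a) in p
        ... | inj₁ j = extend (star (cross s (routes s a) p)) (chase-exit n (not s) (inner (not s) j) eq)
        chase-exit (ℕ.suc n) s a refl | inj₂ b = leave s (routes s a) p

        -- Half-edges 2 and 3 of the first component, and 0 and 1 of the second, are connected
        -- inside their components; the two joining edges complete a circuit.
        parallel-closed : π false ≡ 0F → π true ≡ 0F → ClosedTrail series M
        parallel-closed p q = _ , gmap⁺ id id (star-++ (star c₁) c₂)
          where
          r : ∀ s → π s ≡ 0F → ∀ a → Route (G s) (N s) a (partner 0F a)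
          r s e a = subst (λ i → Route (G s) (N s) a (partner i a)) e (routes s a)
          c₁ = cross false (r false p 2F) refl
          c₂ = cross true (r true q 1F) refl
          star-++ : ∀ {x y z} → Star _⇝_ x y → TransClosure _⇝_ y z → TransClosure _⇝_ x z
          star-++ ε        c = c
          star-++ (s ◅ ss) c = s ∷ star-++ ss c

    -- `mate` keeps the vertex, and a vertex of the composite determines its component.
    restricted : ∀ (M : Matching series) s d → let open Matching M in
                 ∃ λ d′ → G.at s d′ ≡ G.at s d × mate (ι s d) ≡ ι s d′
    restricted M s d = go (split (mate (ι s d))) (ι-split (mate (ι s d)))
      (trans (sym (at-split (mate (ι s d)))) (trans (local (ι s d)) (at-ι s d)))
      where
      open Matching M
      same : ∀ {v w : G.Vertex s} → (s , v) ≡ (s , w) → v ≡ w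
      same refl = refl
      go : ∀ x → ι (proj₁ x) (proj₂ x) ≡ mate (ι s d) →
           (proj₁ x , G.at (proj₁ x) (proj₂ x)) ≡ (s , G.at s d) →
           ∃ λ d′ → G.at s d′ ≡ G.at s d × mate (ι s d) ≡ ι s d′
      go (s′ , d′) e p with refl ← cong proj₁ p = d′ , same p , sym e

    restrict : Matching series → ∀ s → Matching (G s)
    restrict M s = record
      { mate        = mate′
      ; local       = λ d → proj₁ (proj₂ (restricted M s d))
      ; involutive  = λ d → ι-injective (trans (sym (mate-ι (mate′ d)))
                        (trans (cong mate (sym (mate-ι d))) (involutive (ι s d))))
      ; irreflexive = λ d e → irreflexive (ι s d) (trans (mate-ι d) (cong (ι s) e))
      }
      where
      open Matching M
      mate′ : G.Dart s → G.Dart s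
      mate′ d = proj₁ (restricted M s d)
      mate-ι : ∀ d → mate (ι s d) ≡ ι s (mate′ d)
      mate-ι d = proj₂ (proj₂ (restricted M s d))

    restrict-ι : ∀ M s d → Matching.mate M (ι s d) ≡ ι s (Matching.mate (restrict M s) d)
    restrict-ι M s d = proj₂ (proj₂ (restricted M s d))

    join : (∀ s → Matching (G s)) → Matching series
    join N = record
      { mate        = mate′
      ; local       = λ d → trans (at-ι _ (N.mate _ (proj₂ (split d))))
                        (trans (cong (_ ,_) (N.local _ (proj₂ (split d)))) (sym (at-split d)))
      ; involutive  = λ d → trans (mate′-ι _ _) (trans (cong (ι _) (N.involutive _ _)) (ι-split d))
      ; irreflexive = λ d e → N.irreflexive _ _ (ι-injective (trans e (sym (ι-split d))))
      }
      where
      module N s = Matching (N s)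
      mate′ : Dart → Dart
      mate′ d = ι (proj₁ (split d)) (N.mate (proj₁ (split d)) (proj₂ (split d)))
      mate′-ι : ∀ s d → mate′ (ι s d) ≡ ι s (N.mate s d)
      mate′-ι s d = cong (λ (s , d) → ι s (N.mate s d)) (split-ι s d)

    join-ι : ∀ N s d → Matching.mate (join N) (ι s d) ≡ ι s (Matching.mate (N s) d)
    join-ι N s d = cong (λ (s , d) → ι s (Matching.mate (N s) d)) (split-ι s d)

    -- `1F` and `2F` carry two strands across, straight or crossed, and form a group of order two;
    -- `0F` sends both strands back and absorbs either of them. The difference of the counts of `1F`
    -- and `2F` is the nontrivial character of this group, which is why q multiplies.
    _∙_ : Fin 3 → Fin 3 → Maybe (Fin 3)
    0F ∙ 0F = nothing
    0F ∙ 1F = just 0F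
    0F ∙ 2F = just 0F
    1F ∙ 0F = just 0F
    1F ∙ 1F = just 1F
    1F ∙ 2F = just 2F
    2F ∙ 0F = just 0F
    2F ∙ 1F = just 2F
    2F ∙ 2F = just 1F

    pair : {A : Set} → A → A → Bool → A
    pair x y false = x
    pair x y true  = y

    -- Three traversals suffice: a trail sent back by one component passes through the other, since
    -- not both pairings are `0F`. Checked by evaluation over all cases.
    chase-0 : ∀ i j k → i ∙ j ≡ just k → chase (pair i j) 3 false 0F ≡ just (suc k)
    chase-0 = from-yes (all? λ i → all? λ j → all? λ k →
      ≡-dec _≟_ (i ∙ j) (just k) →-dec ≡-dec _≟_ (chase (pair i j) 3 false 0F) (just (suc k)))

    chase-just : ∀ i j k → i ∙ j ≡ just k → ∀ s a → ∃ λ b → chase (pair i j) 3 s a ≡ just b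
    chase-just i j k e = λ { false → proj₁ (go i j k e) ; true → proj₂ (go i j k e) }
      where
      go = from-yes (all? λ i → all? λ j → all? λ k → ≡-dec _≟_ (i ∙ j) (just k) →-dec
        ((all? λ a → any? λ b → ≡-dec _≟_ (chase (pair i j) 3 false a) (just b)) ×-dec
         (all? λ a → any? λ b → ≡-dec _≟_ (chase (pair i j) 3 true a) (just b))))

    -- The equivalence ignores the indices `i` and `j`: by `Valid-index-unique` they are determined
    -- by the matchings.
    Pairs : Fin 3 → Setoid 0ℓ 0ℓ
    Pairs k = record
      { Carrier = ∃ λ i → ∃ λ j → i ∙ j ≡ just k ×
                  Setoid.Carrier (Valid (G false) i) × Setoid.Carrier (Valid (G true) j)
      ; _≈_ = λ (_ , _ , _ , (M , _) , (N , _)) (_ , _ , _ , (M′ , _) , (N′ , _)) →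
          (Matching.mate M ≗ Matching.mate M′) × (Matching.mate N ≗ Matching.mate N′)
      ; isEquivalence = record
        { refl  = (λ _ → refl) , (λ _ → refl)
        ; sym   = λ (p , q) → (sym ∘ p) , (sym ∘ q)
        ; trans = λ (p , q) (p′ , q′) → (λ d → trans (p d) (p′ d)) , (λ d → trans (q d) (q′ d))
        }
      }

    Valid↔Pairs : ∀ k → Inverse (Valid series k) (Pairs k)
    Valid↔Pairs k = record
      { to        = to
      ; from      = from
      ; to-cong   = λ {(M , _)} {(M′ , _)} p → restrict-cong M M′ p false , restrict-cong M M′ p true
      ; from-cong = λ {(_ , _ , _ , (M , _) , (N , _))} {(_ , _ , _ , (M′ , _) , (N′ , _))} (p , q) →
          join-cong {join-dependent M N} {join-dependent M′ N′} λ { false → p ; true → q }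
      ; inverse   =
          (λ {(_ , _ , _ , (M , _) , (N , _))} {(L , _)} p → let K = join-dependent M N in
            (λ d → trans (restrict-cong L (join K) p false d) (restrict-join K false d)) ,
            (λ d → trans (restrict-cong L (join K) p true d) (restrict-join K true d)))
        , (λ {(L , _)} {(_ , _ , _ , (M , _) , (N , _))} (p , q) d →
            trans (join-cong {join-dependent M N} {restrict L} (λ { false → p ; true → q }) d)
                  (trans (sym (restrict-ι L _ _)) (cong (Matching.mate L) (ι-split d))))
      }
      where
      restrict-cong : ∀ M M′ → Matching.mate M ≗ Matching.mate M′ →
                      ∀ s → Matching.mate (restrict M s) ≗ Matching.mate (restrict M′ s)
      restrict-cong M M′ p s d = ι-injective
        (trans (sym (restrict-ι M s d)) (trans (p (ι s d)) (restrict-ι M′ s d)))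

      restrict-join : ∀ N s → Matching.mate (restrict (join N) s) ≗ Matching.mate (N s)
      restrict-join N s d = ι-injective (trans (sym (restrict-ι (join N) s d)) (join-ι N s d))

      join-cong : ∀ {N N′ : ∀ s → Matching (G s)} → (∀ s → Matching.mate (N s) ≗ Matching.mate (N′ s)) →
                  Matching.mate (join N) ≗ Matching.mate (join N′)
      join-cong p d = cong (ι _) (p _ _)

      join-dependent : Matching (G false) → Matching (G true) → ∀ s → Matching (G s)
      join-dependent M N false = M
      join-dependent M N true  = N

      from : Setoid.Carrier (Pairs k) → Setoid.Carrier (Valid series k)
      from (i , j , e , (M₁ , r₁ , ¬c₁) , (M₂ , r₂ , ¬c₂)) = join N
        , chase-exit (pair i j) routes 3 false 0F (chase-0 i j k e)
        , Trails.exits⇒¬closed series (join N) (all-exit ¬closed λ s a →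
            map₂ (chase-exit (pair i j) routes 3 s a) (chase-just i j k e s a))
        where
        N = join-dependent M₁ M₂
        open Restriction (join N) N (join-ι N)
        ¬closed : ∀ s → ¬ ClosedTrail (G s) (N s)
        ¬closed false = ¬c₁
        ¬closed true  = ¬c₂
        routes : ∀ s a → Route (G s) (N s) a (partner (pair i j s) a)
        routes false = T.route-partner false M₁ ¬c₁ r₁
        routes true  = T.route-partner true M₂ ¬c₂ r₂

      to : Setoid.Carrier (Valid series k) → Setoid.Carrier (Pairs k)
      to (M , r , ¬c) = i , j , i∙j≡k , (N false , route₁ , ¬closed false) , (N true , route₂ , ¬closed true)
        where
        N = restrict M
        open Restriction M N (restrict-ι M)
        ¬closed : ∀ s → ¬ ClosedTrail (G s) (N s)
        ¬closed s = ¬c ∘ lift-closed s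
        i = proj₁ (T.route-from-0 false (N false) (¬closed false))
        j = proj₁ (T.route-from-0 true (N true) (¬closed true))
        route₁ = proj₂ (T.route-from-0 false (N false) (¬closed false))
        route₂ = proj₂ (T.route-from-0 true (N true) (¬closed true))
        routes : ∀ s a → Route (G s) (N s) a (partner (pair i j s) a)
        routes false = T.route-partner false (N false) (¬closed false) route₁
        routes true  = T.route-partner true (N true) (¬closed true) route₂
        ∙-nothing : ∀ i j → i ∙ j ≡ nothing → i ≡ 0F × j ≡ 0F
        ∙-nothing = from-yes (all? λ i → all? λ j →
          ≡-dec _≟_ (i ∙ j) nothing →-dec ((i ≟ 0F) ×-dec (j ≟ 0F)))
        i∙j≡k : i ∙ j ≡ just k
        i∙j≡k with i ∙ j in e
        ... | nothing = contradiction (parallel-closed (pair i j) routes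
                          (proj₁ (∙-nothing i j e)) (proj₂ (∙-nothing i j e))) ¬c
        ... | just k′ with refl ← Trails.exit-unique series M r
                             (chase-exit (pair i j) routes 3 false 0F (chase-0 i j k′ e)) = refl

    seriesCounts : (n₁ n₂ : Fin 3 → ℕ) → Fin 3 → ℕ
    seriesCounts n₁ n₂ 0F = n₁ 0F ℕ.* (n₂ 1F ℕ.+ n₂ 2F) ℕ.+ (n₁ 1F ℕ.+ n₁ 2F) ℕ.* n₂ 0F
    seriesCounts n₁ n₂ 1F = n₁ 1F ℕ.* n₂ 1F ℕ.+ n₁ 2F ℕ.* n₂ 2F
    seriesCounts n₁ n₂ 2F = n₁ 1F ℕ.* n₂ 2F ℕ.+ n₁ 2F ℕ.* n₂ 1F

    private
      V₁ V₂ : Fin 3 → Setoid 0ℓ 0ℓ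
      V₁ = Valid (G false)
      V₂ = Valid (G true)

    Sums : Fin 3 → Setoid 0ℓ 0ℓ
    Sums 0F = (V₁ 0F ×ₛ (V₂ 1F ⊎ₛ V₂ 2F)) ⊎ₛ ((V₁ 1F ⊎ₛ V₁ 2F) ×ₛ V₂ 0F)
    Sums 1F = (V₁ 1F ×ₛ V₂ 1F) ⊎ₛ (V₁ 2F ×ₛ V₂ 2F)
    Sums 2F = (V₁ 1F ×ₛ V₂ 2F) ⊎ₛ (V₁ 2F ×ₛ V₂ 1F)

    Pairs↔Sums : ∀ k → Inverse (Pairs k) (Sums k)
    Pairs↔Sums k = record
      { to        = to k
      ; from      = from k
      ; to-cong   = λ {x} {y} → to-cong k x y
      ; from-cong = from-cong k
      ; inverse   = (λ {x} {y} p → Setoid.trans (Sums k) (to-cong k y (from k x) p) (to-from k x))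
                  , (λ {x} {y} p → Setoid.trans (Pairs k) {from k y} {from k (to k x)} {x} (from-cong k p) (from-to k x))
      }
      where
      to : ∀ k → Setoid.Carrier (Pairs k) → Setoid.Carrier (Sums k)
      to _ (0F , 1F , refl , x , y) = inj₁ (x , inj₁ y)
      to _ (0F , 2F , refl , x , y) = inj₁ (x , inj₂ y)
      to _ (1F , 0F , refl , x , y) = inj₂ (inj₁ x , y)
      to _ (2F , 0F , refl , x , y) = inj₂ (inj₂ x , y)
      to _ (1F , 1F , refl , x , y) = inj₁ (x , y)
      to _ (2F , 2F , refl , x , y) = inj₂ (x , y)
      to _ (1F , 2F , refl , x , y) = inj₁ (x , y)
      to _ (2F , 1F , refl , x , y) = inj₂ (x , y)

      from : ∀ k → Setoid.Carrier (Sums k) → Setoid.Carrier (Pairs k)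
      from 0F (inj₁ (x , inj₁ y)) = 0F , 1F , refl , x , y
      from 0F (inj₁ (x , inj₂ y)) = 0F , 2F , refl , x , y
      from 0F (inj₂ (inj₁ x , y)) = 1F , 0F , refl , x , y
      from 0F (inj₂ (inj₂ x , y)) = 2F , 0F , refl , x , y
      from 1F (inj₁ (x , y))      = 1F , 1F , refl , x , y
      from 1F (inj₂ (x , y))      = 2F , 2F , refl , x , y
      from 2F (inj₁ (x , y))      = 1F , 2F , refl , x , y
      from 2F (inj₂ (x , y))      = 2F , 1F , refl , x , y

      to-cong : ∀ k x y → Setoid._≈_ (Pairs k) x y → Setoid._≈_ (Sums k) (to k x) (to k y)
      to-cong k (i , j , e , (M , r , c) , (N , s , d)) (_ , _ , e′ , (M′ , r′ , c′) , (N′ , s′ , d′)) (p , q)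
        -- Pointwise equal matchings have equal pairings, so both arguments fall into the same
        -- summand.
        with refl ← Valid-index-unique {M = M} {M′} p r r′ | refl ← Valid-index-unique {M = N} {N′} q s s′
        = go i j e e′
        where
        go : ∀ {k} i j {r s r′ s′} (e e′ : i ∙ j ≡ just k) → Setoid._≈_ (Sums k)
             (to k (i , j , e , (M , r , c) , (N , s , d))) (to k (i , j , e′ , (M′ , r′ , c′) , (N′ , s′ , d′)))
        go 0F 1F refl refl = inj₁ (p , inj₁ q)
        go 0F 2F refl refl = inj₁ (p , inj₂ q)
        go 1F 0F refl refl = inj₂ (inj₁ p , q)
        go 2F 0F refl refl = inj₂ (inj₂ p , q)
        go 1F 1F refl refl = inj₁ (p , q)
        go 2F 2F refl refl = inj₂ (p , q)
        go 1F 2F refl refl = inj₁ (p , q)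
        go 2F 1F refl refl = inj₂ (p , q)

      from-cong : ∀ k {x y} → Setoid._≈_ (Sums k) x y → Setoid._≈_ (Pairs k) (from k x) (from k y)
      from-cong 0F (inj₁ (p , inj₁ q)) = p , q
      from-cong 0F (inj₁ (p , inj₂ q)) = p , q
      from-cong 0F (inj₂ (inj₁ p , q)) = p , q
      from-cong 0F (inj₂ (inj₂ p , q)) = p , q
      from-cong 1F (inj₁ (p , q))      = p , q
      from-cong 1F (inj₂ (p , q))      = p , q
      from-cong 2F (inj₁ (p , q))      = p , q
      from-cong 2F (inj₂ (p , q))      = p , q

      to-from : ∀ k x → Setoid._≈_ (Sums k) (to k (from k x)) x
      to-from 0F (inj₁ (x , inj₁ y)) = Setoid.refl (Sums 0F)
      to-from 0F (inj₁ (x , inj₂ y)) = Setoid.refl (Sums 0F)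
      to-from 0F (inj₂ (inj₁ x , y)) = Setoid.refl (Sums 0F)
      to-from 0F (inj₂ (inj₂ x , y)) = Setoid.refl (Sums 0F)
      to-from 1F (inj₁ (x , y))      = Setoid.refl (Sums 1F)
      to-from 1F (inj₂ (x , y))      = Setoid.refl (Sums 1F)
      to-from 2F (inj₁ (x , y))      = Setoid.refl (Sums 2F)
      to-from 2F (inj₂ (x , y))      = Setoid.refl (Sums 2F)

      from-to : ∀ k x → Setoid._≈_ (Pairs k) (from k (to k x)) x
      from-to _ (0F , 1F , refl , x , y) = (λ _ → refl) , (λ _ → refl)
      from-to _ (0F , 2F , refl , x , y) = (λ _ → refl) , (λ _ → refl)
      from-to _ (1F , 0F , refl , x , y) = (λ _ → refl) , (λ _ → refl)
      from-to _ (2F , 0F , refl , x , y) = (λ _ → refl) , (λ _ → refl)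
      from-to _ (1F , 1F , refl , x , y) = (λ _ → refl) , (λ _ → refl)
      from-to _ (2F , 2F , refl , x , y) = (λ _ → refl) , (λ _ → refl)
      from-to _ (1F , 2F , refl , x , y) = (λ _ → refl) , (λ _ → refl)
      from-to _ (2F , 1F , refl , x , y) = (λ _ → refl) , (λ _ → refl)

    series-counts : ∀ {n₁ n₂} → G false HasCounts n₁ → G true HasCounts n₂ →
                    series HasCounts seriesCounts n₁ n₂
    series-counts {n₁} {n₂} f g k = inverse (Valid↔Pairs k) (inverse (Pairs↔Sums k) (go k))
      where
      go : ∀ k → Inverse (Sums k) (setoid (Fin (seriesCounts n₁ n₂ k)))
      go 0F = (f 0F ⊗ (g 1F ⊕ g 2F)) ⊕ ((f 1F ⊕ f 2F) ⊗ g 0F)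
      go 1F = (f 1F ⊗ g 1F) ⊕ (f 2F ⊗ g 2F)
      go 2F = (f 1F ⊗ g 2F) ⊕ (f 2F ⊗ g 1F)

  -- Transport of matchings and relabelling of half-edges

  module Transfer {G H : Gadget}
    (to : Gadget.Dart G → Gadget.Dart H) (from : Gadget.Dart H → Gadget.Dart G)
    (to-from : ∀ d → to (from d) ≡ d) (from-to : ∀ d → from (to d) ≡ d)
    (to-at : ∀ {d d′} → Gadget.at G d ≡ Gadget.at G d′ → Gadget.at H (to d) ≡ Gadget.at H (to d′))
    (edge : Gadget.Edge G → Gadget.Edge H) (to-end : ∀ e i → to (end e i) ≡ end (edge e) i)
    (ρ : Fin 4 → Fin 4) (to-half : ∀ h → to (half h) ≡ half (ρ h))
    where

    module _ (M : Matching G) where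

      open Matching M

      push : Matching H
      push = record
        { mate        = λ d → to (mate (from d))
        ; local       = λ d → trans (to-at (local (from d))) (cong (Gadget.at H) (to-from d))
        ; involutive  = λ d → trans (cong (to ∘ mate) (from-to _))
                          (trans (cong to (involutive (from d))) (to-from d))
        ; irreflexive = λ d e → irreflexive (from d) (trans (sym (from-to _)) (cong from e))
        }

      push-mate : ∀ d → Matching.mate push (to d) ≡ to (mate d)
      push-mate d = cong (to ∘ mate) (from-to d)

      push-step : ∀ {d d′} → _↝_ G M d d′ → _↝_ H push (to d) (to d′)
      push-step (traverse {d} {e} {i} p) = subst (_↝_ H push (to d)) (sym (to-end e _))
        (traverse (trans (push-mate d) (trans (cong to p) (to-end e i))))

      push-route : ∀ {a b} → Route G M a b → Route H push (ρ a) (ρ b)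
      push-route {a} {b} (d , p , m) = to d
        , subst (λ x → Star (_↝_ H push) x (to d)) (to-half a) (gmap to push-step p)
        , trans (push-mate d) (trans (cong to m) (to-half b))

      push-closed : ClosedTrail G M → ClosedTrail H push
      push-closed (d , c) = to d , gmap⁺ to push-step c

  module Relabel (G : Gadget) (π : Permutation′ 3) where

    open Gadget G hiding (end; half)

    private
      -- With half-edge 0 fixed, permuting half-edges 1, 2, 3 acts on the three pairings by `π`,
      -- because pairing `i` is named by the partner `suc i` of 0.
      ρ = lift₀ π

    relabelledGraph : HalfEdgeGraph
    relabelledGraph = record
      { Vertex       = Vertex
      ; Edge         = Edge
      ; finiteVertex = finiteVertex
      ; finiteEdge   = finiteEdge
      ; edgeAt       = edgeAt
      ; halfAt       = halfAt ∘ (ρ ⟨$⟩ʳ_)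
      }

    private
      module G′ = HalfEdgeGraph relabelledGraph

      old : G′.Dart → Dart
      old (end e i) = end e i
      old (half h)  = half (ρ ⟨$⟩ʳ h)

      new : Dart → G′.Dart
      new (end e i) = end e i
      new (half h)  = half (ρ ⟨$⟩ˡ h)

      old-new : ∀ d → old (new d) ≡ d
      old-new (end _ _) = refl
      old-new (half _)  = cong half (inverseʳ ρ)

      new-old : ∀ d → new (old d) ≡ d
      new-old (end _ _) = refl
      new-old (half _)  = cong half (inverseˡ ρ)

      at-old : ∀ d → at (old d) ≡ G′.at d
      at-old (end _ _) = refl
      at-old (half _)  = refl

      at-new : ∀ d → G′.at (new d) ≡ at d
      at-new d = trans (sym (at-old (new d))) (cong at (old-new d))

    relabel : Gadget
    relabel = record
      { graph    = relabelledGraph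
      ; 4regular = λ v → Gadget.4regular G v ↔-∘ mk↔ₛ′
          (λ (d , p) → old d , trans (at-old d) p)
          (λ (d , p) → new d , trans (at-new d) p)
          (λ (d , _) → fibre-≡ (old-new d))
          (λ (d , _) → fibre-≡ (new-old d))
      }

    private
      module Old = Transfer {relabel} {G} old new old-new new-old
        (λ {d} {d′} p → trans (at-old d) (trans p (sym (at-old d′)))) id (λ _ _ → refl) (ρ ⟨$⟩ʳ_) (λ _ → refl)
      module New = Transfer {G} {relabel} new old new-old old-new
        (λ {d} {d′} p → trans (at-new d) (trans p (sym (at-new d′)))) id (λ _ _ → refl) (ρ ⟨$⟩ˡ_) (λ _ → refl)

    closed-resp-≗ : ∀ {G M M′} → Matching.mate {G} M ≗ Matching.mate M′ → ClosedTrail G M → ClosedTrail G M′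
    closed-resp-≗ {G} {M} {M′} p (d , c) = d , gmap⁺ id (↝-resp-≗ {G} {M} {M′} p) c

    Valid-relabel : ∀ i → Inverse (Valid relabel i) (Valid G (π ⟨$⟩ʳ i))
    Valid-relabel i = record
      { to        = λ (M , r , ¬c) → Old.push M , Old.push-route M r
                  , λ c → ¬c (closed-resp-≗ {relabel} {New.push (Old.push M)} {M} (new-old-mate M) (New.push-closed (Old.push M) c))
      ; from      = λ (M , r , ¬c) → New.push M
                  , subst (Route relabel (New.push M) 0F) (cong suc (inverseˡ π)) (New.push-route M r)
                  , λ c → ¬c (closed-resp-≗ {G} {Old.push (New.push M)} {M} (old-new-mate M) (Old.push-closed (New.push M) c))
      ; to-cong   = λ p d → cong old (p (new d))
      ; from-cong = λ p d → cong new (p (old d))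
      ; inverse   = (λ {(M , _)} p d → trans (cong old (p (new d))) (old-new-mate M d))
                  , (λ {(M , _)} p d → trans (cong new (p (old d))) (new-old-mate M d))
      }
      where
      new-old-mate : ∀ M → Matching.mate (New.push (Old.push M)) ≗ Matching.mate M
      new-old-mate M d = trans (new-old _) (cong (Matching.mate M) (new-old d))
      old-new-mate : ∀ M → Matching.mate (Old.push (New.push M)) ≗ Matching.mate M
      old-new-mate M d = trans (old-new _) (cong (Matching.mate M) (old-new d))

    relabel-counts : ∀ {n} → G HasCounts n → relabel HasCounts (n ∘ (π ⟨$⟩ʳ_))
    relabel-counts f i = inverse (Valid-relabel i) (f (π ⟨$⟩ʳ i))

  -- The one-vertex gadget

  vertex : Gadget
  vertex = record
    { graph = record
      { Vertex       = ⊤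
      ; Edge         = ⊥
      ; finiteVertex = 1 , mk↔ₛ′ (λ _ → 0F) (λ _ → tt) (λ { 0F → refl ; (suc ()) }) (λ _ → refl)
      ; finiteEdge   = 0 , mk↔ₛ′ ⊥-elim (λ ()) (λ ()) (λ ())
      ; edgeAt       = λ ()
      ; halfAt       = λ _ → tt
      }
    ; 4regular = λ _ → mk↔ₛ′ (λ { (half h , _) → h ; (end () _ , _) }) (λ h → half h , refl) (λ _ → refl)
                             (λ { (half _ , refl) → refl ; (end () _ , _) })
    }

  vertex-counts : vertex HasCounts (λ _ → 1)
  vertex-counts i = record
    { to        = λ _ → 0F
    ; from      = λ _ → M , (half 0F , ε , cong half (partner-0 i))
                    , Trails.exits⇒¬closed vertex M (λ { (half h) → partner i h , half h , ε , refl ; (end () _) })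
    ; to-cong   = λ _ → refl
    ; from-cong = λ _ _ → refl
    ; inverse   = (λ { {0F} _ → refl ; {suc ()} }) , (λ {x} _ → unique x)
    }
    where
    open Gadget vertex using (Dart)
    partner-involutive : ∀ i a → partner i (partner i a) ≡ a
    partner-involutive 0F = λ { 0F → refl ; 1F → refl ; 2F → refl ; 3F → refl }
    partner-involutive 1F = λ { 0F → refl ; 1F → refl ; 2F → refl ; 3F → refl }
    partner-involutive 2F = λ { 0F → refl ; 1F → refl ; 2F → refl ; 3F → refl }
    partner-irreflexive : ∀ i a → partner i a ≢ a
    partner-irreflexive 0F = λ { 0F () ; 1F () ; 2F () ; 3F () }
    partner-irreflexive 1F = λ { 0F () ; 1F () ; 2F () ; 3F () }
    partner-irreflexive 2F = λ { 0F () ; 1F () ; 2F () ; 3F () }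
    half-injective : ∀ {a b} → _≡_ {A = Dart} (half a) (half b) → a ≡ b
    half-injective refl = refl
    M : Matching vertex
    M = record
      { mate        = λ { (half h) → half (partner i h) ; (end () _) }
      ; local       = λ _ → refl
      ; involutive  = λ { (half h) → cong half (partner-involutive i h) ; (end () _) }
      ; irreflexive = λ { (half h) e → partner-irreflexive i h (half-injective e) ; (end () _) }
      }
    partner-0 : ∀ i → partner i 0F ≡ suc i
    partner-0 = λ { 0F → refl ; 1F → refl ; 2F → refl }
    -- Without edges every route is a single passage, so the matching is the pairing itself.
    unique : ((N , _) : ∃ λ N → Route vertex N 0F (suc i) × ¬ ClosedTrail vertex N) →
             Matching.mate M ≗ Matching.mate N
    unique _ (end () _)
    unique (N , r , ¬c) (half h) with Trails.route-partner vertex N ¬c r h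
    ... | _ , ε , m = sym m
    ... | _ , (traverse {e = ()} _ ◅ _) , _

open RationalLemmas
import Data.Rational.Properties as ℚₚ
open import Data.Rational.Solver using (module +-*-Solver)
open import Data.Vec.Functional using ([]; _∷_)
open +-*-Solver using (solve; _:+_; _:*_; _:-_; :-_; _:=_; con)

-- Rational coordinates and estimates

module _ where

  open import Algebra.Properties.CommutativeMonoid.Sum ℕₚ.+-0-commutativeMonoid using (sum-permute)
  import Data.Rational.Unnormalised.Base as ℚᵘ
  import Data.Rational.Unnormalised.Properties as ℚᵘₚ
  open ExpLemmas
  open ℚ using (_+_; _*_; _-_; -_; ∣_∣; _≤_; _<_; _/_)
  open ℚₚ hiding (_≟_)

  fromℕ-+ : ∀ m n → fromℕ (m ℕ.+ n) ≡ fromℕ m + fromℕ n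
  fromℕ-+ zero    n = sym (ℚₚ.+-identityˡ (fromℕ n))
  fromℕ-+ (suc m) n = begin-equality
    fromℕ (suc (m ℕ.+ n))         ≡⟨ fromℕ-suc (m ℕ.+ n) ⟩
    1ℚ + fromℕ (m ℕ.+ n)          ≡⟨ cong (λ x → 1ℚ + x) (fromℕ-+ m n) ⟩
    1ℚ + (fromℕ m + fromℕ n)      ≡⟨ sym (ℚₚ.+-assoc 1ℚ (fromℕ m) (fromℕ n)) ⟩
    (1ℚ + fromℕ m) + fromℕ n      ≡⟨ cong (_+ fromℕ n) (sym (fromℕ-suc m)) ⟩
    fromℕ (suc m) + fromℕ n       ∎
    where open ≤-Reasoning

  fromℕ-* : ∀ m n → fromℕ (m ℕ.* n) ≡ fromℕ m * fromℕ n
  fromℕ-* zero    n = sym (ℚₚ.*-zeroˡ (fromℕ n))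
  fromℕ-* (suc m) n = begin-equality
    fromℕ (n ℕ.+ m ℕ.* n)          ≡⟨ fromℕ-+ n (m ℕ.* n) ⟩
    fromℕ n + fromℕ (m ℕ.* n)      ≡⟨ cong (λ x → fromℕ n + x) (fromℕ-* m n) ⟩
    fromℕ n + fromℕ m * fromℕ n    ≡⟨ solve 2 (λ m n → n :+ m :* n := (con 1ℚ :+ m) :* n) refl (fromℕ m) (fromℕ n) ⟩
    (1ℚ + fromℕ m) * fromℕ n       ≡⟨ cong (_* fromℕ n) (sym (fromℕ-suc m)) ⟩
    fromℕ (suc m) * fromℕ n        ∎
    where open ≤-Reasoning

  /≡*recip : ∀ a k → + a / suc k ≡ fromℕ a * recip k
  /≡*recip a k = toℚᵘ-injective
    (ℚᵘₚ.≃-trans (toℚᵘ-fromℚᵘ (ℚᵘ.mkℚᵘ (+ a) k))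
    (ℚᵘₚ.≃-sym (ℚᵘₚ.≃-trans (toℚᵘ-homo-* (fromℕ a) (recip k))
    (ℚᵘₚ.≃-trans (ℚᵘₚ.*-cong (toℚᵘ-fromℚᵘ (ℚᵘ.mkℚᵘ (+ a) 0)) (toℚᵘ-fromℚᵘ (ℚᵘ.mkℚᵘ (+ 1) k)))
      (ℚᵘ.*≡* (cong₂ ℤ._*_ (ℤₚ.*-identityʳ (+ a)) (cong (+_ ∘ suc) (sym (ℕₚ.+-identityʳ k)))))))))

  /-unique : ∀ a n .{{_ : ℕ.NonZero n}} v → v * fromℕ n ≡ fromℕ a → + a / n ≡ v
  /-unique a (suc k) v e = begin-equality
    + a / suc k                    ≡⟨ /≡*recip a k ⟩
    fromℕ a * recip k              ≡⟨ cong (_* recip k) (sym e) ⟩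
    v * fromℕ (suc k) * recip k    ≡⟨ solve 3 (λ v n r → v :* n :* r := v :* (r :* n)) refl v (fromℕ (suc k)) (recip k) ⟩
    v * (recip k * fromℕ (suc k))  ≡⟨ cong (v *_) (recip-inverse k) ⟩
    v * 1ℚ                         ≡⟨ ℚₚ.*-identityʳ v ⟩
    v                              ∎
    where open ≤-Reasoning

  counts⇒signature : ∀ {G n} → G HasCounts n → .{{_ : ℕ.NonZero (n 0F ℕ.+ n 1F ℕ.+ n 2F)}} →
                     HasSignature G (λ i → + n i / (n 0F ℕ.+ n 1F ℕ.+ n 2F))
  counts⇒signature {G} {n} f = record
    { a       = n 0F
    ; b       = n 1F
    ; c       = n 2F
    ; card-a  = inverse (VR↔Valid G 0F 2F) (f 0F)
    ; card-b  = inverse (VR↔Valid G 1F 1F) (f 1F)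
    ; card-c  = inverse (VR↔Valid G 2F 1F) (f 2F)
    ; σ≗abc/N = λ { 0F → refl ; 1F → refl ; 2F → refl }
    }

  -- Ratios are stated as products with `S`, so that composition needs no division; `0<S` lets the
  -- counts determine p and q.
  record Realizes (p q : ℚ) : Set₁ where
    field
      gadget : Gadget
      n      : Fin 3 → ℕ
      counts : gadget HasCounts n
    S : ℚ
    S = fromℕ (n 1F) + fromℕ (n 2F)
    field
      0<S    : 0ℚ < S
      n₀≡pS  : fromℕ (n 0F) ≡ p * S
      diff≡qS : fromℕ (n 1F) - fromℕ (n 2F) ≡ q * S

  realizes-vertex : Realizes ½ 0ℚ
  realizes-vertex = record
    { gadget  = vertex
    ; n       = λ _ → 1
    ; counts  = vertex-counts
    ; 0<S     = positive⁻¹ (1ℚ + 1ℚ)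
    ; n₀≡pS   = refl
    ; diff≡qS = refl
    }

  -- `S` and `n 1F - n 2F` are multiplicative, while `n 0F` obeys the product rule n₀ S′ + S n₀′, so
  -- its quotient by `S` is additive.
  realizes-series : ∀ {p q p′ q′} → Realizes p q → Realizes p′ q′ → Realizes (p + p′) (q * q′)
  realizes-series {p} {q} {p′} {q′} r r′ = record
    { gadget  = Series.series G
    ; n       = Series.seriesCounts G R.n R′.n
    ; counts  = Series.series-counts G R.counts R′.counts
    ; 0<S     = subst (0ℚ <_) (sym S≡) (0<* R.0<S R′.0<S)
    ; n₀≡pS   = begin-equality
        fromℕ (R.n 0F ℕ.* (R′.n 1F ℕ.+ R′.n 2F) ℕ.+ (R.n 1F ℕ.+ R.n 2F) ℕ.* R′.n 0F)
          ≡⟨ fromℕ-+ (R.n 0F ℕ.* (R′.n 1F ℕ.+ R′.n 2F)) _ ⟩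
        fromℕ (R.n 0F ℕ.* (R′.n 1F ℕ.+ R′.n 2F)) + fromℕ ((R.n 1F ℕ.+ R.n 2F) ℕ.* R′.n 0F)
          ≡⟨ cong₂ _+_ (fromℕ-* (R.n 0F) _) (fromℕ-* (R.n 1F ℕ.+ R.n 2F) _) ⟩
        fromℕ (R.n 0F) * fromℕ (R′.n 1F ℕ.+ R′.n 2F) + fromℕ (R.n 1F ℕ.+ R.n 2F) * fromℕ (R′.n 0F)
          ≡⟨ cong₂ _+_ (cong₂ _*_ R.n₀≡pS (fromℕ-+ (R′.n 1F) _)) (cong₂ _*_ (fromℕ-+ (R.n 1F) _) R′.n₀≡pS) ⟩
        (p * R.S) * R′.S + R.S * (p′ * R′.S)
          ≡⟨ solve 4 (λ p s p′ s′ → (p :* s) :* s′ :+ s :* (p′ :* s′) := (p :+ p′) :* (s :* s′)) refl p R.S p′ R′.S ⟩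
        (p + p′) * (R.S * R′.S)
          ≡⟨ cong ((p + p′) *_) (sym S≡) ⟩
        (p + p′) * S ∎
    ; diff≡qS = begin-equality
        fromℕ (R.n 1F ℕ.* R′.n 1F ℕ.+ R.n 2F ℕ.* R′.n 2F) - fromℕ (R.n 1F ℕ.* R′.n 2F ℕ.+ R.n 2F ℕ.* R′.n 1F)
          ≡⟨ cong₂ _-_ n₁≡ n₂≡ ⟩
        (b * b′ + c * c′) - (b * c′ + c * b′)
          ≡⟨ solve 4 (λ b c b′ c′ → (b :* b′ :+ c :* c′) :- (b :* c′ :+ c :* b′) := (b :- c) :* (b′ :- c′)) refl b c b′ c′ ⟩
        (b - c) * (b′ - c′)
          ≡⟨ cong₂ _*_ R.diff≡qS R′.diff≡qS ⟩
        (q * R.S) * (q′ * R′.S)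
          ≡⟨ solve 4 (λ q s q′ s′ → (q :* s) :* (q′ :* s′) := (q :* q′) :* (s :* s′)) refl q R.S q′ R′.S ⟩
        (q * q′) * (R.S * R′.S)
          ≡⟨ cong ((q * q′) *_) (sym S≡) ⟩
        (q * q′) * S ∎
    }
    where
    open ≤-Reasoning
    module R = Realizes r
    module R′ = Realizes r′
    G : Bool → Gadget
    G false = R.gadget
    G true  = R′.gadget
    b = fromℕ (R.n 1F)
    c = fromℕ (R.n 2F)
    b′ = fromℕ (R′.n 1F)
    c′ = fromℕ (R′.n 2F)
    product-sum : ∀ k l m n → fromℕ (k ℕ.* l ℕ.+ m ℕ.* n) ≡ fromℕ k * fromℕ l + fromℕ m * fromℕ n
    product-sum k l m n = trans (fromℕ-+ (k ℕ.* l) (m ℕ.* n)) (cong₂ _+_ (fromℕ-* k l) (fromℕ-* m n))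
    n₁≡ = product-sum (R.n 1F) (R′.n 1F) (R.n 2F) (R′.n 2F)
    n₂≡ = product-sum (R.n 1F) (R′.n 2F) (R.n 2F) (R′.n 1F)
    S = fromℕ (R.n 1F ℕ.* R′.n 1F ℕ.+ R.n 2F ℕ.* R′.n 2F) + fromℕ (R.n 1F ℕ.* R′.n 2F ℕ.+ R.n 2F ℕ.* R′.n 1F)
    S≡ : S ≡ R.S * R′.S
    S≡ = trans (cong₂ _+_ n₁≡ n₂≡)
      (solve 4 (λ b c b′ c′ → (b :* b′ :+ c :* c′) :+ (b :* c′ :+ c :* b′) := (b :+ c) :* (b′ :+ c′)) refl b c b′ c′)

  infixr 8 _^_
  _^_ : ℚ → ℕ → ℚ
  x ^ zero  = 1ℚ
  x ^ suc n = x * x ^ n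

  realizes-power : ∀ {p q r s} → Realizes p q → Realizes r s → ∀ k → Realizes (p + fromℕ k * r) (q * s ^ k)
  realizes-power {p} {q} {r} {s} R R′ zero = subst₂ Realizes
    (sym (trans (cong (λ x → p + x) (ℚₚ.*-zeroˡ r)) (ℚₚ.+-identityʳ p))) (sym (ℚₚ.*-identityʳ q)) R
  realizes-power {p} {q} {r} {s} R R′ (suc k) = subst₂ Realizes
    (trans (solve 3 (λ p k r → r :+ (p :+ k :* r) := p :+ (con 1ℚ :+ k) :* r) refl p (fromℕ k) r)
           (cong (λ x → p + x * r) (sym (fromℕ-suc k))))
    (solve 3 (λ q s x → s :* (q :* x) := q :* (s :* x)) refl q s (s ^ k))
    (realizes-series R′ (realizes-power R R′ k))

  -- At q = 0 the counts of `1F` and `2F` are both S/2, so the exchange makes the new `S` equal to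
  -- (p + 1/2) times the old one. The hypothesis says p′ = 1/(2p + 1).
  realizes-swap : ∀ {p p′} → Realizes p 0ℚ → p′ * (p + ½) ≡ ½ → Realizes p′ (1ℚ - (p′ + p′))
  realizes-swap {p} {p′} r e = record
    { gadget  = Relabel.relabel R.gadget τ
    ; n       = R.n ∘ (τ ⟨$⟩ʳ_)
    ; counts  = Relabel.relabel-counts R.gadget τ R.counts
    ; 0<S     = ℚₚ.<-≤-trans 0<c (subst (c ≤_) (ℚₚ.+-comm c (fromℕ (R.n 0F))) (p≤p+q (0≤fromℕ (R.n 0F))))
    ; n₀≡pS   = begin-equality
        b                        ≡⟨ b≡ ⟩
        ½ * R.S                  ≡⟨ cong (_* R.S) (sym e) ⟩
        p′ * (p + ½) * R.S       ≡⟨ ℚₚ.*-assoc p′ (p + ½) R.S ⟩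
        p′ * ((p + ½) * R.S)     ≡⟨ cong (p′ *_) (sym S≡) ⟩
        p′ * S                   ∎
    ; diff≡qS = begin-equality
        fromℕ (R.n 0F) - c                             ≡⟨ cong₂ _-_ R.n₀≡pS c≡ ⟩
        p * R.S - ½ * R.S                              ≡⟨ solve 2 (λ p s → p :* s :- con ½ :* s := (p :+ con ½) :* s :- (con ½ :+ con ½) :* s) refl p R.S ⟩
        (p + ½) * R.S - (½ + ½) * R.S                  ≡⟨ cong (λ x → (p + ½) * R.S - (x + x) * R.S) (sym e) ⟩
        (p + ½) * R.S - (p′ * (p + ½) + p′ * (p + ½)) * R.S
          ≡⟨ solve 3 (λ x p′ s → x :* s :- (p′ :* x :+ p′ :* x) :* s := (con 1ℚ :- (p′ :+ p′)) :* (x :* s)) refl (p + ½) p′ R.S ⟩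
        (1ℚ - (p′ + p′)) * ((p + ½) * R.S)             ≡⟨ cong ((1ℚ - (p′ + p′)) *_) (sym S≡) ⟩
        (1ℚ - (p′ + p′)) * S ∎
    }
    where
    open ≤-Reasoning
    module R = Realizes r
    τ = transpose 0F 1F
    b = fromℕ (R.n 1F)
    c = fromℕ (R.n 2F)
    S = fromℕ (R.n 0F) + c
    c≡ : c ≡ ½ * R.S
    c≡ = trans (solve 2 (λ b c → c := con ½ :* (b :+ c) :- con ½ :* (b :- c)) refl b c)
      (trans (cong (λ x → ½ * R.S - ½ * x) R.diff≡qS)
        (solve 1 (λ s → con ½ :* s :- con ½ :* (con 0ℚ :* s) := con ½ :* s) refl R.S))
    b≡ : b ≡ ½ * R.S
    b≡ = trans (solve 2 (λ b c → b := con ½ :* (b :+ c) :+ con ½ :* (b :- c)) refl b c)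
      (trans (cong (λ x → ½ * R.S + ½ * x) R.diff≡qS)
        (solve 1 (λ s → con ½ :* s :+ con ½ :* (con 0ℚ :* s) := con ½ :* s) refl R.S))
    0<c : 0ℚ < c
    0<c = subst (0ℚ <_) (sym c≡) (0<* (positive⁻¹ ½) R.0<S)
    S≡ : S ≡ (p + ½) * R.S
    S≡ = trans (cong₂ _+_ R.n₀≡pS c≡) (sym (ℚₚ.*-distribʳ-+ R.S p ½))

  recip-half : ∀ m → recip (suc (m ℕ.+ m)) ≡ ½ * recip m
  recip-half m = begin-equality
    x                                      ≡⟨ sym (ℚₚ.*-identityʳ x) ⟩
    x * 1ℚ                                 ≡⟨ cong (x *_) (sym (recip-inverse m)) ⟩
    x * (recip m * M)                      ≡⟨ solve 3 (λ x r M → x :* (r :* M) := x :* (M :+ M) :* (con ½ :* r)) refl x (recip m) M ⟩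
    x * (M + M) * (½ * recip m)            ≡⟨ cong (λ y → x * y * (½ * recip m)) 2M≡ ⟩
    x * fromℕ (suc (suc (m ℕ.+ m))) * (½ * recip m)
                                           ≡⟨ cong (_* (½ * recip m)) (recip-inverse (suc (m ℕ.+ m))) ⟩
    1ℚ * (½ * recip m)                     ≡⟨ ℚₚ.*-identityˡ (½ * recip m) ⟩
    ½ * recip m                            ∎
    where
    open ≤-Reasoning
    x = recip (suc (m ℕ.+ m))
    M = fromℕ (suc m)
    2M≡ : M + M ≡ fromℕ (suc (suc (m ℕ.+ m)))
    2M≡ = trans (sym (fromℕ-+ (suc m) (suc m))) (cong (fromℕ ∘ suc) (ℕₚ.+-suc m m))

  -- A series of 2m + 1 vertices has coordinates (m + 1/2, 0), and the swap turns this into p =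
  -- 1/(2m + 2).
  realizes-unit : ∀ m → Realizes (½ * recip m) (1ℚ - recip m)
  realizes-unit m = subst₂ Realizes (recip-half m)
    (trans (cong (λ x → 1ℚ - (x + x)) (recip-half m))
           (solve 1 (λ r → con 1ℚ :- (con ½ :* r :+ con ½ :* r) := con 1ℚ :- r) refl (recip m)))
    (realizes-swap (subst (Realizes (½ + K * ½)) (ℚₚ.*-zeroˡ (0ℚ ^ k)) (realizes-power realizes-vertex realizes-vertex k))
      (begin-equality
        x * (½ + K * ½ + ½)          ≡⟨ solve 2 (λ x K → x :* (con ½ :+ K :* con ½ :+ con ½) := x :* (con 1ℚ :+ (con 1ℚ :+ K)) :* con ½) refl x K ⟩
        x * (1ℚ + (1ℚ + K)) * ½      ≡⟨ cong (λ y → x * (1ℚ + y) * ½) (sym (fromℕ-suc k)) ⟩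
        x * (1ℚ + fromℕ (suc k)) * ½ ≡⟨ cong (λ y → x * y * ½) (sym (fromℕ-suc (suc k))) ⟩
        x * fromℕ (suc (suc k)) * ½  ≡⟨ cong (_* ½) (recip-inverse (suc k)) ⟩
        ½                            ∎))
    where
    open ≤-Reasoning
    k = m ℕ.+ m
    K = fromℕ k
    x = recip (suc k)

  -- One vertex forces q = 0, and 2d copies of the unit for `recip i` raise p to 1/2 + d/(i+1). The
  -- swap then gives (i+1)/(2(i+1+d)), which is J y/2.
  realizes-multiple : ∀ i d → let y = recip (i ℕ.+ d); J = fromℕ (suc i) in
                      Realizes (J * (½ * y)) (1ℚ - J * y)
  realizes-multiple i d = subst (Realizes p′)
    (solve 2 (λ J y → con 1ℚ :- (J :* (con ½ :* y) :+ J :* (con ½ :* y)) := con 1ℚ :- J :* y) refl J y)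
    (realizes-swap (subst (Realizes (½ + fromℕ (d ℕ.+ d) * (½ * r))) (ℚₚ.*-zeroˡ ((1ℚ - r) ^ (d ℕ.+ d)))
                          (realizes-power realizes-vertex (realizes-unit i) (d ℕ.+ d)))
      (begin-equality
        p′ * (½ + fromℕ (d ℕ.+ d) * (½ * r) + ½)
          ≡⟨ cong (λ x → p′ * (½ + x * (½ * r) + ½)) (fromℕ-+ d d) ⟩
        p′ * (½ + (D + D) * (½ * r) + ½)
          ≡⟨ solve 4 (λ J y D r → J :* (con ½ :* y) :* (con ½ :+ (D :+ D) :* (con ½ :* r) :+ con ½) :=
               con ½ :* y :* (J :* con 1ℚ :+ r :* J :* D)) refl J y D r ⟩
        ½ * y * (J * 1ℚ + r * J * D)
          ≡⟨ cong (λ x → ½ * y * (J * 1ℚ + x * D)) (recip-inverse i) ⟩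
        ½ * y * (J * 1ℚ + 1ℚ * D)
          ≡⟨ solve 3 (λ y J D → con ½ :* y :* (J :* con 1ℚ :+ con 1ℚ :* D) := con ½ :* (y :* (J :+ D))) refl y J D ⟩
        ½ * (y * (J + D))
          ≡⟨ cong (λ x → ½ * (y * x)) (sym (fromℕ-+ (suc i) d)) ⟩
        ½ * (y * fromℕ (suc (i ℕ.+ d)))
          ≡⟨ cong (½ *_) (recip-inverse (i ℕ.+ d)) ⟩
        ½ ∎))
    where
    open ≤-Reasoning
    y = recip (i ℕ.+ d)
    r = recip i
    J = fromℕ (suc i)
    D = fromℕ d
    p′ = J * (½ * y)

  realizes-mixed : ∀ i d l → let y = recip (i ℕ.+ d) in
                   Realizes (fromℕ (suc i ℕ.+ l) * (½ * y)) ((1ℚ - fromℕ (suc i) * y) * (1ℚ - y) ^ l)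
  realizes-mixed i d l = subst (λ x → Realizes x ((1ℚ - J * y) * (1ℚ - y) ^ l))
    (trans (sym (ℚₚ.*-distribʳ-+ (½ * y) J (fromℕ l))) (cong (_* (½ * y)) (sym (fromℕ-+ (suc i) l))))
    (realizes-power (realizes-multiple i d) (realizes-unit (i ℕ.+ d)) l)
    where
    y = recip (i ℕ.+ d)
    J = fromℕ (suc i)

  fromℕ≢0⇒nonZero : ∀ {n} → fromℕ n ≢ 0ℚ → ℕ.NonZero n
  fromℕ≢0⇒nonZero {zero}  0≢0 = contradiction refl 0≢0
  fromℕ≢0⇒nonZero {suc n} _   = _

  -- The middle entry β plays the role of `n 0F`, hence the transposition composed with `π`. The
  -- factor `w` = 1/(1+p) turns multiples of `S` into shares of the total count.
  signature : ∀ {p q w} → Realizes p q → w * (1ℚ + p) ≡ 1ℚ → (π : Permutation′ 3) →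
    let v = (½ * (1ℚ + q) * w) ∷ (p * w) ∷ (½ * (1ℚ - q) * w) ∷ [] in
    ∃ λ (G : Gadget) → ∃ λ (σ : Vector ℚ 3) → HasSignature G σ × (∀ i → σ i ≡ v (π ⟨$⟩ʳ i))
  signature {p} {q} {w} r e π = Relabel.relabel R.gadget ρ , (λ i → + n′ i / N)
    , counts⇒signature (Relabel.relabel-counts R.gadget ρ R.counts)
    , λ i → /-unique (n′ i) N (v (π ⟨$⟩ʳ i)) (value (π ⟨$⟩ʳ i))
    where
    open ≤-Reasoning
    module R = Realizes r
    ρ = π ∘ₚ transpose 0F 1F
    n′ = R.n ∘ (ρ ⟨$⟩ʳ_)
    N = n′ 0F ℕ.+ n′ 1F ℕ.+ n′ 2F
    v = (½ * (1ℚ + q) * w) ∷ (p * w) ∷ (½ * (1ℚ - q) * w) ∷ []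
    N≡ : fromℕ N ≡ (1ℚ + p) * R.S
    N≡ = begin-equality
      fromℕ N
        ≡⟨ cong fromℕ (trans (ℕₚ.+-assoc (n′ 0F) _ _)
             (cong (λ x → n′ 0F ℕ.+ (n′ 1F ℕ.+ x)) (sym (ℕₚ.+-identityʳ (n′ 2F))))) ⟩
      fromℕ (n′ 0F ℕ.+ (n′ 1F ℕ.+ (n′ 2F ℕ.+ 0)))
        ≡⟨ cong fromℕ (sym (sum-permute R.n ρ)) ⟩
      fromℕ (R.n 0F ℕ.+ (R.n 1F ℕ.+ (R.n 2F ℕ.+ 0)))
        ≡⟨ cong (λ x → fromℕ (R.n 0F ℕ.+ (R.n 1F ℕ.+ x))) (ℕₚ.+-identityʳ (R.n 2F)) ⟩
      fromℕ (R.n 0F ℕ.+ (R.n 1F ℕ.+ R.n 2F))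
        ≡⟨ trans (fromℕ-+ (R.n 0F) _) (cong₂ _+_ R.n₀≡pS (fromℕ-+ (R.n 1F) (R.n 2F))) ⟩
      p * R.S + R.S
        ≡⟨ solve 2 (λ p s → p :* s :+ s := (con 1ℚ :+ p) :* s) refl p R.S ⟩
      (1ℚ + p) * R.S ∎
    wN≡S : w * fromℕ N ≡ R.S
    wN≡S = trans (cong (w *_) N≡) (trans (sym (ℚₚ.*-assoc w (1ℚ + p) R.S))
      (trans (cong (_* R.S) e) (ℚₚ.*-identityˡ R.S)))
    b = fromℕ (R.n 1F)
    c = fromℕ (R.n 2F)
    scale : ∀ x → x * w * fromℕ N ≡ x * R.S
    scale x = trans (ℚₚ.*-assoc x w (fromℕ N)) (cong (x *_) wN≡S)
    value : ∀ k → v k * fromℕ N ≡ fromℕ (R.n (transpose 0F 1F ⟨$⟩ʳ k))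
    value 0F = trans (scale (½ * (1ℚ + q))) (trans
      (solve 2 (λ q s → con ½ :* (con 1ℚ :+ q) :* s := con ½ :* s :+ con ½ :* (q :* s)) refl q R.S)
      (trans (cong (λ x → ½ * R.S + ½ * x) (sym R.diff≡qS))
        (solve 2 (λ b c → con ½ :* (b :+ c) :+ con ½ :* (b :- c) := b) refl b c)))
    value 1F = trans (scale p) (sym R.n₀≡pS)
    value 2F = trans (scale (½ * (1ℚ - q))) (trans
      (solve 2 (λ q s → con ½ :* (con 1ℚ :- q) :* s := con ½ :* s :- con ½ :* (q :* s)) refl q R.S)
      (trans (cong (λ x → ½ * R.S - ½ * x) (sym R.diff≡qS))
        (solve 2 (λ b c → con ½ :* (b :+ c) :- con ½ :* (b :- c) := c) refl b c)))
    instance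
      N-nonZero : ℕ.NonZero N
      N-nonZero = fromℕ≢0⇒nonZero λ N≡0 →
        ℚₚ.<⇒≢ R.0<S (trans (sym (ℚₚ.*-zeroʳ w)) (trans (cong (w *_) (sym N≡0)) wN≡S))

  -- Taylor estimates and Euler's approximation of the exponential

  ≤-slack : ∀ {x y} → x ≤ y → 0ℚ ≤ y - x
  ≤-slack {x} {y} h = subst (_≤ y - x) (+-inverseʳ x) (+-monoˡ-≤ (- x) h)

  -- Reduces an inequality to a ring identity: `d` is a nonnegative combination of the slacks of
  -- known inequalities, and the solver checks the rest.
  ≤-by : ∀ {x y d} → 0ℚ ≤ d → y ≡ x + d → x ≤ y
  ≤-by {x} 0≤d e = subst (x ≤_) (sym e) (p≤p+q 0≤d)

  remainder : ℚ → ℚ → ℕ → ℚ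
  remainder a h k = expTerm (a + h) k - expTerm a k - h * expTerm′ a k

  -- The second derivative of xᵏ / k!.
  expTerm″ : ℚ → ℕ → ℚ
  expTerm″ x zero    = 0ℚ
  expTerm″ x (suc k) = expTerm′ x k

  expTerm′-bound : ∀ {x B} → ∣ x ∣ ≤ B → ∀ k → ∣ expTerm′ x k ∣ ≤ expTerm′ B k
  expTerm′-bound x≤B zero    = ≤-refl
  expTerm′-bound x≤B (suc k) = term-bound x≤B k

  -- `term-rec` rewrites the linear term h t as h (t + t′ a)/(k+1), so that all three terms share
  -- the factor `recip k` and can be regrouped around the previous remainder.
  remainder-suc : ∀ a h k →
    remainder a h (suc k) ≡ ((a + h) * remainder a h k + h * h * expTerm′ a k) * recip k
  remainder-suc a h k = begin-equality
    s * (a + h) * r - t * a * r - h * t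
      ≡⟨ cong (λ x → s * (a + h) * r - t * a * r - h * x) t≡ ⟩
    s * (a + h) * r - t * a * r - h * ((t + t′ * a) * r)
      ≡⟨ solve 6 (λ s a h r t t′ → s :* (a :+ h) :* r :- t :* a :* r :- h :* ((t :+ t′ :* a) :* r) :=
           ((a :+ h) :* (s :- t :- h :* t′) :+ h :* h :* t′) :* r) refl s a h r t t′ ⟩
    ((a + h) * (s - t - h * t′) + h * h * t′) * r ∎
    where
    open ≤-Reasoning
    s = expTerm (a + h) k
    t = expTerm a k
    t′ = expTerm′ a k
    r = recip k
    t≡ : t ≡ (t + t′ * a) * r
    t≡ = begin-equality
      t                            ≡⟨ sym (*-identityʳ t) ⟩
      t * 1ℚ                       ≡⟨ cong (t *_) (sym (recip-inverse k)) ⟩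
      t * (r * fromℕ (suc k))      ≡⟨ solve 3 (λ t r n → t :* (r :* n) := t :* n :* r) refl t r (fromℕ (suc k)) ⟩
      t * fromℕ (suc k) * r        ≡⟨ cong (_* r) (sym (term-rec a k)) ⟩
      (t + t′ * a) * r             ∎

  0≤x² : ∀ x → 0ℚ ≤ x * x
  0≤x² x with ≤-total 0ℚ x
  ... | inj₁ 0≤x = 0≤* 0≤x 0≤x
  ... | inj₂ x≤0 = subst (0ℚ ≤_) (solve 1 (λ x → (:- x) :* (:- x) := x :* x) refl x) (0≤* 0≤-x 0≤-x)
    where
    0≤-x : 0ℚ ≤ - x
    0≤-x = neg-antimono-≤ x≤0

  module _ {a h B : ℚ} (a≤B : ∣ a ∣ ≤ B) (a+h≤B : ∣ a + h ∣ ≤ B) where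

    private
      0≤B : 0ℚ ≤ B
      0≤B = ≤-trans (0≤∣p∣ a) a≤B

    -- The induction step of `remainder-bound`: by `term-rec` the left side is k/(k+1) times the
    -- right side.
    expTerm″-rec : ∀ k → (B * expTerm″ B k + expTerm′ B k) * recip k ≤ expTerm′ B k
    expTerm″-rec zero    = ≤-reflexive (solve 1 (λ b → (b :* con 0ℚ :+ con 0ℚ) :* con 1ℚ := con 0ℚ) refl B)
    expTerm″-rec (suc k) = begin
      (B * t′ + t) * r           ≡⟨ cong (_* r) (trans (solve 3 (λ b t′ t → b :* t′ :+ t := t :+ t′ :* b) refl B t′ t) (term-rec B k)) ⟩
      t * fromℕ (suc k) * r      ≤⟨ *-monoˡ (0≤recip (suc k)) (*-monoʳ (0≤term 0≤B k) (fromℕ-mono (ℕₚ.n≤1+n (suc k)))) ⟩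
      t * fromℕ (suc (suc k)) * r
        ≡⟨ trans (solve 3 (λ t n r → t :* n :* r := t :* (r :* n)) refl t (fromℕ (suc (suc k))) r)
             (trans (cong (t *_) (recip-inverse (suc k))) (*-identityʳ t)) ⟩
      t                          ∎
      where
      open ≤-Reasoning
      t = expTerm B k
      t′ = expTerm′ B k
      r = recip (suc k)

    remainder-bound : ∀ k → ∣ remainder a h k ∣ ≤ h * h * expTerm″ B k
    remainder-bound zero    = ≤-reflexive (trans
      (cong ∣_∣ (solve 1 (λ h → con 1ℚ :- con 1ℚ :- h :* con 0ℚ := con 0ℚ) refl h)) (sym (*-zeroʳ (h * h))))
    remainder-bound (suc k) = begin
      ∣ remainder a h (suc k) ∣
        ≡⟨ cong ∣_∣ (remainder-suc a h k) ⟩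
      ∣ ((a + h) * R + h * h * t′) * r ∣
        ≡⟨ trans (∣p*q∣≡∣p∣*∣q∣ ((a + h) * R + h * h * t′) r) (cong (∣ (a + h) * R + h * h * t′ ∣ *_) (0≤p⇒∣p∣≡p (0≤recip k))) ⟩
      ∣ (a + h) * R + h * h * t′ ∣ * r
        ≤⟨ *-monoˡ (0≤recip k) (∣p+q∣≤∣p∣+∣q∣ ((a + h) * R) (h * h * t′)) ⟩
      (∣ (a + h) * R ∣ + ∣ h * h * t′ ∣) * r
        ≡⟨ cong (_* r) (cong₂ _+_ (∣p*q∣≡∣p∣*∣q∣ (a + h) R)
             (trans (∣p*q∣≡∣p∣*∣q∣ (h * h) t′) (cong (_* ∣ t′ ∣) (0≤p⇒∣p∣≡p (0≤x² h))))) ⟩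
      (∣ a + h ∣ * ∣ R ∣ + h * h * ∣ t′ ∣) * r
        ≤⟨ *-monoˡ (0≤recip k) (+-mono-≤
             (*-mono (0≤∣p∣ (a + h)) (≤-trans (0≤∣p∣ R) (remainder-bound k)) a+h≤B (remainder-bound k))
             (*-monoʳ (0≤x² h) (expTerm′-bound a≤B k))) ⟩
      (B * (h * h * expTerm″ B k) + h * h * expTerm′ B k) * r
        ≡⟨ solve 5 (λ b h t″ t′ r → (b :* (h :* h :* t″) :+ h :* h :* t′) :* r := h :* h :* ((b :* t″ :+ t′) :* r)) refl B h (expTerm″ B k) (expTerm′ B k) r ⟩
      h * h * ((B * expTerm″ B k + expTerm′ B k) * r)
        ≤⟨ *-monoʳ (0≤x² h) (expTerm″-rec k) ⟩
      h * h * expTerm′ B k ∎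
      where
      open ≤-Reasoning
      R = remainder a h k
      t′ = expTerm′ a k
      r = recip k

    -- The derivative of the partial sum with n + 1 terms is the partial sum with n terms, hence the
    -- two lengths. The bound adds up `remainder-bound`.
    expSum-taylor : ∀ n → ∣ expSum (a + h) (suc n) - expSum a (suc n) - h * expSum a n ∣ ≤ h * h * expSum B n
    expSum-taylor n = ≤-trans (go n) (*-monoʳ (0≤x² h) (expSum′≤ n))
      where
      open ≤-Reasoning
      -- The sum of `expTerm″ B k` over k ≤ n: the partial sum of exp B shifted by two indices.
      expSum′ : ℕ → ℚ
      expSum′ zero    = 0ℚ
      expSum′ (suc n) = expSum B n
      expSum′-suc : ∀ n → expSum′ (suc n) ≡ expSum′ n + expTerm′ B n
      expSum′-suc zero    = refl
      expSum′-suc (suc n) = refl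
      expSum′≤ : ∀ n → expSum′ n ≤ expSum B n
      expSum′≤ zero    = ≤-refl
      expSum′≤ (suc n) = p≤p+q (0≤term 0≤B n)
      go : ∀ n → ∣ expSum (a + h) (suc n) - expSum a (suc n) - h * expSum a n ∣ ≤ h * h * expSum′ n
      go zero = ≤-reflexive (trans
        (cong ∣_∣ (solve 1 (λ h → con 0ℚ :+ con 1ℚ :- (con 0ℚ :+ con 1ℚ) :- h :* con 0ℚ := con 0ℚ) refl h)) (sym (*-zeroʳ (h * h))))
      go (suc n) = begin
        ∣ (s + σ) - (t + τ) - h * (t₀ + τ₀) ∣
          ≡⟨ cong ∣_∣ (solve 7 (λ s σ t τ h t₀ τ₀ → (s :+ σ) :- (t :+ τ) :- h :* (t₀ :+ τ₀) :=
               (s :- t :- h :* t₀) :+ (σ :- τ :- h :* τ₀)) refl s σ t τ h t₀ τ₀) ⟩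
        ∣ (s - t - h * t₀) + remainder a h (suc n) ∣
          ≤⟨ ∣p+q∣≤∣p∣+∣q∣ (s - t - h * t₀) (remainder a h (suc n)) ⟩
        ∣ s - t - h * t₀ ∣ + ∣ remainder a h (suc n) ∣
          ≤⟨ +-mono-≤ (go n) (remainder-bound (suc n)) ⟩
        h * h * expSum′ n + h * h * expTerm′ B n
          ≡⟨ trans (sym (*-distribˡ-+ (h * h) (expSum′ n) (expTerm′ B n))) (cong (h * h *_) (sym (expSum′-suc n))) ⟩
        h * h * expSum′ (suc n) ∎
        where
        s = expSum (a + h) (suc n)
        σ = expTerm (a + h) (suc n)
        t = expSum a (suc n)
        τ = expTerm a (suc n)
        t₀ = expSum a n
        τ₀ = expTerm a n

  expSum-0 : ∀ n → expSum 0ℚ (suc n) ≡ 1ℚ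
  expSum-0 zero    = refl
  expSum-0 (suc n) = trans (cong₂ _+_ (expSum-0 n)
    (trans (cong (_* recip n) (*-zeroʳ (expTerm 0ℚ n))) (*-zeroˡ (recip n)))) (+-identityʳ 1ℚ)

  -- Euler's approximation (1 - y)ᵏ of e⁻ᵏʸ: one factor changes the error by O(y²).
  expSum-power : ∀ {B y} → 0ℚ ≤ y → y ≤ 1ℚ → ∀ n k → fromℕ k * y ≤ B →
    ∣ expSum (- (fromℕ k * y)) (suc n) - (1ℚ - y) ^ k ∣ ≤ fromℕ k * (y * y * expSum B n + y * expTerm B n)
  expSum-power {B} {y} 0≤y y≤1 n zero    _ = ≤-reflexive (trans
    (cong ∣_∣ (trans (cong (λ x → expSum x (suc n) - 1ℚ) (cong -_ (*-zeroˡ y))) (trans (cong (_- 1ℚ) (expSum-0 n)) refl)))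
    (sym (*-zeroˡ (y * y * expSum B n + y * expTerm B n))))
  expSum-power {B} {y} 0≤y y≤1 n (suc k) ky≤B = begin
    ∣ expSum (- (fromℕ (suc k) * y)) (suc n) - (1ℚ - y) * P ∣
      ≡⟨ cong (λ x → ∣ expSum x (suc n) - (1ℚ - y) * P ∣) a+h≡ ⟩
    ∣ expSum (a + h) (suc n) - (1ℚ - y) * P ∣
      -- Three errors: the inherited one times 1 - y, the Taylor remainder, and y times the last
      -- term, since the derivative has one term fewer.
      ≡⟨ cong ∣_∣ (solve 5 (λ s e t y P → s :- (con 1ℚ :- y) :* P :=
           (con 1ℚ :- y) :* ((e :+ t) :- P) :+ (s :- (e :+ t) :- (:- y) :* e :+ y :* t)) refl
           (expSum (a + h) (suc n)) (expSum a n) (expTerm a n) y P) ⟩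
    ∣ (1ℚ - y) * D + (T + y * expTerm a n) ∣
      ≤⟨ ≤-trans (∣p+q∣≤∣p∣+∣q∣ ((1ℚ - y) * D) (T + y * expTerm a n))
           (+-monoʳ-≤ ∣ (1ℚ - y) * D ∣ (∣p+q∣≤∣p∣+∣q∣ T (y * expTerm a n))) ⟩
    ∣ (1ℚ - y) * D ∣ + (∣ T ∣ + ∣ y * expTerm a n ∣)
      ≡⟨ cong₂ (λ u v → u + (∣ T ∣ + v)) (trans (∣p*q∣≡∣p∣*∣q∣ (1ℚ - y) D) (cong (_* ∣ D ∣) (0≤p⇒∣p∣≡p (≤-slack y≤1))))
           (trans (∣p*q∣≡∣p∣*∣q∣ y (expTerm a n)) (cong (_* ∣ expTerm a n ∣) (0≤p⇒∣p∣≡p 0≤y))) ⟩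
    (1ℚ - y) * ∣ D ∣ + (∣ T ∣ + y * ∣ expTerm a n ∣)
      ≤⟨ +-mono-≤ (*-mono (≤-slack y≤1) (≤-trans (0≤∣p∣ D) IH) 1-y≤1 IH)
           (+-mono-≤ (expSum-taylor a≤B a+h≤B n) (*-monoʳ 0≤y (term-bound a≤B n))) ⟩
    1ℚ * (fromℕ k * η) + (h * h * expSum B n + y * expTerm B n)
      ≡⟨ solve 4 (λ k y e t → con 1ℚ :* (k :* (y :* y :* e :+ y :* t)) :+ ((:- y) :* (:- y) :* e :+ y :* t) :=
           (con 1ℚ :+ k) :* (y :* y :* e :+ y :* t)) refl (fromℕ k) y (expSum B n) (expTerm B n) ⟩
    (1ℚ + fromℕ k) * η
      ≡⟨ cong (_* η) (sym (fromℕ-suc k)) ⟩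
    fromℕ (suc k) * η ∎
    where
    open ≤-Reasoning
    a = - (fromℕ k * y)
    h = - y
    P = (1ℚ - y) ^ k
    D = expSum a (suc n) - P
    T = expSum (a + h) (suc n) - expSum a (suc n) - h * expSum a n
    η = y * y * expSum B n + y * expTerm B n
    a+h≡ : - (fromℕ (suc k) * y) ≡ a + h
    a+h≡ = trans (cong (λ x → - (x * y)) (fromℕ-suc k))
      (solve 2 (λ k y → :- ((con 1ℚ :+ k) :* y) := (:- (k :* y)) :+ (:- y)) refl (fromℕ k) y)
    0≤ky : ∀ k → 0ℚ ≤ fromℕ k * y
    0≤ky k = 0≤* (0≤fromℕ k) 0≤y
    neg-abs : ∀ k → ∣ - (fromℕ k * y) ∣ ≡ fromℕ k * y
    neg-abs k = trans (∣-p∣≡∣p∣ (fromℕ k * y)) (0≤p⇒∣p∣≡p (0≤ky k))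
    k≤B : fromℕ k * y ≤ B
    k≤B = ≤-trans (*-monoˡ 0≤y (fromℕ-mono (ℕₚ.n≤1+n k))) ky≤B
    a≤B : ∣ a ∣ ≤ B
    a≤B = subst (_≤ B) (sym (neg-abs k)) k≤B
    a+h≤B : ∣ a + h ∣ ≤ B
    a+h≤B = subst (_≤ B) (trans (sym (neg-abs (suc k))) (cong ∣_∣ a+h≡)) ky≤B
    1-y≤1 : 1ℚ - y ≤ 1ℚ
    1-y≤1 = ≤-by 0≤y (solve 1 (λ y → con 1ℚ := con 1ℚ :- y :+ y) refl y)
    IH : ∣ D ∣ ≤ fromℕ k * η
    IH = expSum-power 0≤y y≤1 n k k≤B

  -- The first index with c ≤ g i + η works: as long as g i + η < c, the next value, at most g i +
  -- η, is still below c.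
  discrete-IVT : ∀ (g : ℕ → ℚ) {c η} k → 0ℚ ≤ η → g 0 ≤ c + η → c ≤ g k + η →
                 (∀ i → i ℕ.< k → g (suc i) ≤ g i + η) → ∃ λ i → i ℕ.≤ k × ∣ g i - c ∣ ≤ η
  discrete-IVT g {c} {η} k 0≤η g0≤ c≤ step with ℚₚ._≤?_ c (g 0 + η)
  ... | yes c≤g0 = 0 , ℕ.z≤n , ∣∣-lub (p≤q+r⇒p-q≤r g0≤)
    (subst (_≤ η) (solve 2 (λ g c → c :- g := :- (g :- c)) refl (g 0) c) (p≤q+r⇒p-q≤r c≤g0))
  discrete-IVT g zero    0≤η g0≤ c≤ step | no c≰ = contradiction c≤ c≰
  discrete-IVT g {c} (suc k) 0≤η g0≤ c≤ step | no c≰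
    with discrete-IVT (g ∘ suc) k 0≤η
           (≤-trans (step 0 (ℕ.s≤s ℕ.z≤n)) (≤-trans (<⇒≤ (≰⇒> c≰)) (p≤p+q 0≤η)))
           c≤ (λ i i<k → step (suc i) (ℕ.s≤s i<k))
  ... | i , i≤k , h = suc i , ℕ.s≤s i≤k , h

  -- In units of δ, b is met up to 3 and the exponent up to 48 = 4 · 3 · 4, where 4 bounds both
  -- 2(1+p) and 1/(1-b). The coefficient of δ C is 50 = 48 + 2, with `C` a bound for the partial
  -- sums of exp 3.
  3ℚ 4ℚ 48ℚ 50ℚ : ℚ
  3ℚ = + 3 / 1
  4ℚ = + 4 / 1
  48ℚ = + 48 / 1
  50ℚ = + 50 / 1

  0≤½ : 0ℚ ≤ ½
  0≤½ = <⇒≤ (positive⁻¹ ½)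

  ½≤1 : ½ ≤ 1ℚ
  ½≤1 = from-yes (½ ≤? 1ℚ)

  p≤1⇒p*q≤q : ∀ {p q} → 0ℚ ≤ q → p ≤ 1ℚ → p * q ≤ q
  p≤1⇒p*q≤q {p} {q} 0≤q p≤1 = subst (p * q ≤_) (*-identityˡ q) (*-monoˡ 0≤q p≤1)

  p*q≤∣p∣*∣q∣ : ∀ p q → p * q ≤ ∣ p ∣ * ∣ q ∣
  p*q≤∣p∣*∣q∣ p q = subst (p * q ≤_) (∣p*q∣≡∣p∣*∣q∣ p q) (p≤∣p∣ (p * q))

  module _ {x : ℚ} (0≤x : 0ℚ ≤ x) (x≤1 : x ≤ 1ℚ) where

    0≤^ : ∀ n → 0ℚ ≤ x ^ n
    0≤^ zero    = 0≤1
    0≤^ (suc n) = 0≤* 0≤x (0≤^ n)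

    ^≤1 : ∀ n → x ^ n ≤ 1ℚ
    ^≤1 zero    = ≤-refl
    ^≤1 (suc n) = ≤-trans (p≤1⇒p*q≤q (0≤^ n) x≤1) (^≤1 n)

  -- The grid of mixtures

  module Mixtures (m : ℕ) where

    y M : ℚ
    y = recip m
    M = fromℕ (suc m)

    0≤y : 0ℚ ≤ y
    0≤y = 0≤recip m

    y*M≡1 : y * M ≡ 1ℚ
    y*M≡1 = recip-inverse m

    y≤1 : y ≤ 1ℚ
    y≤1 = subst (_≤ 1ℚ) (*-identityʳ y) (subst (y * 1ℚ ≤_) y*M≡1
      (*-monoʳ 0≤y (fromℕ-mono {1} {suc m} (ℕ.s≤s ℕ.z≤n))))

    0≤1-y : 0ℚ ≤ 1ℚ - y
    0≤1-y = ≤-slack y≤1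

    1-y≤1 : 1ℚ - y ≤ 1ℚ
    1-y≤1 = ≤-by 0≤y (solve 1 (λ y → con 1ℚ := con 1ℚ :- y :+ y) refl y)

    -- Indices are one less than multiplicities: `k` stands for p = (k+1)y/2, and likewise `i` below
    -- for the multiple (i+1)y.
    p w β : ℕ → ℚ
    p k = fromℕ (suc k) * (½ * y)
    w k = inv (1ℚ + p k)
    β k = p k * w k

    0≤p : ∀ k → 0ℚ ≤ p k
    0≤p k = 0≤* (0≤fromℕ (suc k)) (0≤* 0≤½ 0≤y)

    1≤1+p : ∀ k → 1ℚ ≤ 1ℚ + p k
    1≤1+p k = p≤p+q (0≤p k)

    0<1+p : ∀ k → 0ℚ < 1ℚ + p k
    0<1+p k = <-≤-trans 0<1 (1≤1+p k)

    w-inverse : ∀ k → w k * (1ℚ + p k) ≡ 1ℚ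
    w-inverse k = trans (*-comm (w k) (1ℚ + p k))
      (inv-inverseʳ (1ℚ + p k) (λ e → <⇒≢ (0<1+p k) (sym e)))

    0≤w : ∀ k → 0ℚ ≤ w k
    0≤w k = <⇒≤ (0<inv (0<1+p k))

    w≤1 : ∀ k → w k ≤ 1ℚ
    w≤1 k = inv-anti 0<1 (1≤1+p k)

    w≡1-β : ∀ k → w k ≡ 1ℚ - β k
    w≡1-β k = trans (solve 2 (λ w p → w := w :* (con 1ℚ :+ p) :- p :* w) refl (w k) (p k))
      (cong (_- β k) (w-inverse k))

    β-0 : β 0 ≤ y
    β-0 = begin
      β 0                  ≡⟨ *-comm (p 0) (w 0) ⟩
      w 0 * p 0            ≤⟨ p≤1⇒p*q≤q (0≤p 0) (w≤1 0) ⟩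
      1ℚ * (½ * y)         ≡⟨ *-identityˡ (½ * y) ⟩
      ½ * y                ≤⟨ p≤1⇒p*q≤q 0≤y ½≤1 ⟩
      y                    ∎
      where open ≤-Reasoning

    -- For p/(1+p) the increment is exactly w(k) w(k+1) y/2, and each w is at most 1.
    β-suc : ∀ k → β (suc k) ≤ β k + y
    β-suc k = begin
      β (suc k)                              ≡⟨ β≡ ⟩
      β k + w k * (w (suc k) * (½ * y))      ≤⟨ +-monoʳ-≤ (β k)
        (≤-trans (p≤1⇒p*q≤q (0≤* (0≤w (suc k)) 0≤½y) (w≤1 k))
        (≤-trans (p≤1⇒p*q≤q 0≤½y (w≤1 (suc k)))
                 (p≤1⇒p*q≤q 0≤y ½≤1))) ⟩
      β k + y                                ∎
      where
      open ≤-Reasoning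
      0≤½y : 0ℚ ≤ ½ * y
      0≤½y = 0≤* 0≤½ 0≤y
      p-suc : p (suc k) ≡ p k + ½ * y
      p-suc = trans (cong (_* (½ * y)) (fromℕ-suc (suc k)))
        (solve 2 (λ k h → (con 1ℚ :+ k) :* h := k :* h :+ h) refl (fromℕ (suc k)) (½ * y))
      β≡ : β (suc k) ≡ β k + w k * (w (suc k) * (½ * y))
      β≡ = begin-equality
        p (suc k) * w (suc k)
          ≡⟨ solve 2 (λ p w → p :* w := con 1ℚ :* p :* w) refl (p (suc k)) (w (suc k)) ⟩
        1ℚ * p (suc k) * w (suc k)
          ≡⟨ cong₂ (λ x z → x * z * w (suc k)) (sym (w-inverse k)) p-suc ⟩
        w k * (1ℚ + p k) * (p k + ½ * y) * w (suc k)
          ≡⟨ solve 4 (λ w p h w′ → w :* (con 1ℚ :+ p) :* (p :+ h) :* w′ :=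
               p :* w :* (w′ :* (con 1ℚ :+ (p :+ h))) :+ w :* (w′ :* h)) refl (w k) (p k) (½ * y) (w (suc k)) ⟩
        β k * (w (suc k) * (1ℚ + (p k + ½ * y))) + w k * (w (suc k) * (½ * y))
          ≡⟨ cong (λ x → β k * x + w k * (w (suc k) * (½ * y)))
               (trans (cong (λ x → w (suc k) * (1ℚ + x)) (sym p-suc)) (w-inverse (suc k))) ⟩
        β k * 1ℚ + w k * (w (suc k) * (½ * y))
          ≡⟨ cong (_+ w k * (w (suc k) * (½ * y))) (*-identityʳ (β k)) ⟩
        β k + w k * (w (suc k) * (½ * y)) ∎

    -- Here p reaches 1, so β reaches 1/2, the largest middle entry in S.
    last : ℕ
    last = suc (m ℕ.+ m)

    p-last : p last ≡ 1ℚ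
    p-last = trans (cong (fromℕ (suc last) *_) (sym (recip-half m)))
      (trans (*-comm (fromℕ (suc last)) (recip last)) (recip-inverse last))

    β-last : β last ≡ ½
    β-last = cong₂ _*_ p-last (cong (λ x → inv (1ℚ + x)) p-last)

    p≤1 : ∀ {k} → k ℕ.≤ last → p k ≤ 1ℚ
    p≤1 {k} k≤last = subst (p k ≤_) p-last
      (*-monoˡ (0≤* 0≤½ 0≤y) (fromℕ-mono (ℕ.s≤s k≤last)))

    2p≡ky : ∀ k → fromℕ (suc k) * y ≡ p k + p k
    2p≡ky k = solve 2 (λ k y → k :* y := k :* (con ½ :* y) :+ k :* (con ½ :* y)) refl (fromℕ (suc k)) y

    -- `i` runs up to the smaller of k and m: at i = k no unit copies remain and q = 1-2p, while at
    -- i = m the first factor vanishes and q = 0.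
    q : ℕ → ℕ → ℚ
    q k i = (1ℚ - fromℕ (suc i) * y) * (1ℚ - y) ^ (k ℕ.∸ i)

    γ : ℕ → ℕ → ℚ
    γ k i = ½ * (1ℚ - q k i) * w k

    realizes : ∀ {k i} → i ℕ.≤ k → i ℕ.≤ m → Realizes (p k) (q k i)
    realizes {k} {i} i≤k i≤m = subst₂
      (λ m′ k′ → Realizes (fromℕ (suc k′) * (½ * recip m′))
        ((1ℚ - fromℕ (suc i) * recip m′) * (1ℚ - recip m′) ^ (k ℕ.∸ i)))
      (ℕₚ.m+[n∸m]≡n i≤m) (ℕₚ.m+[n∸m]≡n i≤k) (realizes-mixed i (m ℕ.∸ i) (k ℕ.∸ i))

    q-0 : ∀ k → q k 0 ≡ (1ℚ - y) ^ suc k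
    q-0 k = cong (λ x → (1ℚ - x) * (1ℚ - y) ^ k) (*-identityˡ y)

    -- Trading one unit copy for the next multiple lowers q by exactly R J y², which is at most y
    -- because J y ≤ 1.
    γ-suc : ∀ {k i} → i ℕ.< k → i ℕ.< m → γ k (suc i) ≤ γ k i + y
    γ-suc {k} {i} i<k i<m = begin
      ½ * (1ℚ - (1ℚ - J′ * y) * R) * w k
        ≡⟨ cong (λ x → ½ * (1ℚ - (1ℚ - x * y) * R) * w k) (fromℕ-suc (suc i)) ⟩
      ½ * (1ℚ - (1ℚ - (1ℚ + J) * y) * R) * w k
        ≡⟨ solve 4 (λ J y R w → con ½ :* (con 1ℚ :- (con 1ℚ :- (con 1ℚ :+ J) :* y) :* R) :* w :=
             con ½ :* (con 1ℚ :- (con 1ℚ :- J :* y) :* ((con 1ℚ :- y) :* R)) :* w :+ con ½ :* (w :* (R :* (J :* y :* y))))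
             refl J y R (w k) ⟩
      ½ * (1ℚ - (1ℚ - J * y) * ((1ℚ - y) * R)) * w k + ½ * (w k * (R * (J * y * y)))
        ≡⟨ cong (λ e → ½ * (1ℚ - (1ℚ - J * y) * (1ℚ - y) ^ e) * w k + ½ * (w k * (R * (J * y * y))))
             (sym (ℕₚ.+-∸-assoc 1 i<k)) ⟩
      γ k i + ½ * (w k * (R * (J * y * y)))
        ≤⟨ +-monoʳ-≤ (γ k i)
             (≤-trans (p≤1⇒p*q≤q (0≤* (0≤w k) (0≤* 0≤R (0≤* 0≤Jy 0≤y))) ½≤1)
             (≤-trans (p≤1⇒p*q≤q (0≤* 0≤R (0≤* 0≤Jy 0≤y)) (w≤1 k))
             (≤-trans (p≤1⇒p*q≤q (0≤* 0≤Jy 0≤y) (^≤1 0≤1-y 1-y≤1 (k ℕ.∸ suc i)))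
                      (p≤1⇒p*q≤q 0≤y Jy≤1)))) ⟩
      γ k i + y ∎
      where
      open ≤-Reasoning
      J = fromℕ (suc i)
      J′ = fromℕ (suc (suc i))
      R = (1ℚ - y) ^ (k ℕ.∸ suc i)
      0≤R : 0ℚ ≤ R
      0≤R = 0≤^ 0≤1-y 1-y≤1 (k ℕ.∸ suc i)
      0≤Jy : 0ℚ ≤ J * y
      0≤Jy = 0≤* (0≤fromℕ (suc i)) 0≤y
      Jy≤1 : J * y ≤ 1ℚ
      Jy≤1 = subst (J * y ≤_) (trans (*-comm M y) y*M≡1) (*-monoˡ 0≤y (fromℕ-mono (ℕ.s≤s (ℕₚ.<⇒≤ i<m))))

    γ-k : ∀ k → γ k k ≡ β k
    γ-k k = begin-equality
      ½ * (1ℚ - (1ℚ - fromℕ (suc k) * y) * (1ℚ - y) ^ (k ℕ.∸ k)) * w k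
        ≡⟨ cong (λ e → ½ * (1ℚ - (1ℚ - fromℕ (suc k) * y) * (1ℚ - y) ^ e) * w k) (ℕₚ.n∸n≡0 k) ⟩
      ½ * (1ℚ - (1ℚ - fromℕ (suc k) * y) * 1ℚ) * w k
        ≡⟨ solve 3 (λ k y w → con ½ :* (con 1ℚ :- (con 1ℚ :- k :* y) :* con 1ℚ) :* w := k :* (con ½ :* y) :* w)
             refl (fromℕ (suc k)) y (w k) ⟩
      β k ∎
      where open ≤-Reasoning

    γ-m : ∀ k → γ k m ≡ ½ * w k
    γ-m k = begin-equality
      ½ * (1ℚ - (1ℚ - M * y) * R) * w k    ≡⟨ cong (λ x → ½ * (1ℚ - (1ℚ - x) * R) * w k) (trans (*-comm M y) y*M≡1) ⟩
      ½ * (1ℚ - (1ℚ - 1ℚ) * R) * w k       ≡⟨ solve 2 (λ R w → con ½ :* (con 1ℚ :- (con 1ℚ :- con 1ℚ) :* R) :* w := con ½ :* w) refl R (w k) ⟩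
      ½ * w k                              ∎
      where
      open ≤-Reasoning
      R = (1ℚ - y) ^ (k ℕ.∸ m)

  -- Comparison of exp(2b/(b-1)) with powers of 1-y

  2≤3 : + 2 / 1 ≤ 3ℚ
  2≤3 = ≤-by {d = 1ℚ} 0≤1 refl

  module _ {δ b : ℚ} (¼≤1-b : + 1 / 4 ≤ 1ℚ - b) where

    private
      v : ℚ
      v = inv (b - 1ℚ)

      0≤1-b : 0ℚ ≤ 1ℚ - b
      0≤1-b = ≤-trans (<⇒≤ (positive⁻¹ (+ 1 / 4))) ¼≤1-b

      ∣b-1∣≡1-b : ∣ b - 1ℚ ∣ ≡ 1ℚ - b
      ∣b-1∣≡1-b = trans (∣-∣-comm b 1ℚ) (0≤p⇒∣p∣≡p 0≤1-b)

      [b-1]*v≡1 : (b - 1ℚ) * v ≡ 1ℚ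
      [b-1]*v≡1 = inv-inverseʳ (b - 1ℚ) λ e →
        <⇒≢ (<-≤-trans (positive⁻¹ (+ 1 / 4)) ¼≤1-b) (sym (trans (sym ∣b-1∣≡1-b) (cong ∣_∣ e)))

      ∣v∣≤4 : ∣ v ∣ ≤ 4ℚ
      ∣v∣≤4 = subst (_≤ 4ℚ) (sym (trans (∣inv∣ (b - 1ℚ)) (cong inv ∣b-1∣≡1-b)))
        (inv-anti {+ 1 / 4} (positive⁻¹ (+ 1 / 4)) ¼≤1-b)

      -- Quantifies that 2β/(β-1) = -2p for β = p w: writing 1 as (b-1)v, then as w(1+p), makes b -
      -- p w a factor.
      identity : ∀ b v p w → (b - 1ℚ) * v ≡ 1ℚ → w * (1ℚ + p) ≡ 1ℚ →
        (+ 2 / 1) * b * v - - (p + p) ≡ ((1ℚ + p) + (1ℚ + p)) * (b - p * w) * v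
      identity b v p w e₁ e₂ = begin-equality
        (+ 2 / 1) * b * v - - (p + p)
          ≡⟨ cong (λ x → (+ 2 / 1) * b * v - - x) (sym (*-identityʳ (p + p))) ⟩
        (+ 2 / 1) * b * v - - ((p + p) * 1ℚ)
          ≡⟨ cong (λ x → (+ 2 / 1) * b * v - - ((p + p) * x)) (sym e₁) ⟩
        (+ 2 / 1) * b * v - - ((p + p) * ((b - 1ℚ) * v))
          ≡⟨ solve 3 (λ b v p → con (+ 2 / 1) :* b :* v :- (:- ((p :+ p) :* ((b :- con 1ℚ) :* v))) :=
               ((con 1ℚ :+ p) :* b :+ (con 1ℚ :+ p) :* b :- (p :* con 1ℚ :+ p :* con 1ℚ)) :* v) refl b v p ⟩
        ((1ℚ + p) * b + (1ℚ + p) * b - (p * 1ℚ + p * 1ℚ)) * v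
          ≡⟨ cong (λ x → ((1ℚ + p) * b + (1ℚ + p) * b - (p * x + p * x)) * v) (sym e₂) ⟩
        ((1ℚ + p) * b + (1ℚ + p) * b - (p * (w * (1ℚ + p)) + p * (w * (1ℚ + p)))) * v
          ≡⟨ solve 4 (λ b v p w → ((con 1ℚ :+ p) :* b :+ (con 1ℚ :+ p) :* b :-
               (p :* (w :* (con 1ℚ :+ p)) :+ p :* (w :* (con 1ℚ :+ p)))) :* v :=
               ((con 1ℚ :+ p) :+ (con 1ℚ :+ p)) :* (b :- p :* w) :* v) refl b v p w ⟩
        ((1ℚ + p) + (1ℚ + p)) * (b - p * w) * v ∎
        where open ≤-Reasoning

    exponent-diff : ∀ {p w} → w * (1ℚ + p) ≡ 1ℚ → 0ℚ ≤ p → p ≤ 1ℚ → ∣ b - p * w ∣ ≤ 3ℚ * δ →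
                    ∣ (+ 2 / 1) * b * inv (b - 1ℚ) - - (p + p) ∣ ≤ 48ℚ * δ
    exponent-diff {p} {w} e 0≤p p≤1 b≈β = begin
      ∣ (+ 2 / 1) * b * v - - (p + p) ∣
        ≡⟨ cong ∣_∣ (identity b v p w [b-1]*v≡1 e) ⟩
      ∣ x * z * v ∣
        ≡⟨ trans (∣p*q∣≡∣p∣*∣q∣ (x * z) v) (cong (_* ∣ v ∣) (trans (∣p*q∣≡∣p∣*∣q∣ x z)
             (cong (_* ∣ z ∣) (0≤p⇒∣p∣≡p 0≤x)))) ⟩
      x * ∣ z ∣ * ∣ v ∣
        ≤⟨ *-mono (0≤* 0≤x (0≤∣p∣ z)) (<⇒≤ (positive⁻¹ 4ℚ))
             (*-mono 0≤x (≤-trans (0≤∣p∣ z) b≈β) x≤4 b≈β) ∣v∣≤4 ⟩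
      4ℚ * (3ℚ * δ) * 4ℚ
        ≡⟨ solve 1 (λ d → con 4ℚ :* (con 3ℚ :* d) :* con 4ℚ := con 48ℚ :* d) refl δ ⟩
      48ℚ * δ ∎
      where
      open ≤-Reasoning
      z = b - p * w
      x = (1ℚ + p) + (1ℚ + p)
      0≤x : 0ℚ ≤ x
      0≤x = 0≤+ (0≤+ 0≤1 0≤p) (0≤+ 0≤1 0≤p)
      x≤4 : x ≤ 4ℚ
      x≤4 = +-mono-≤ (+-monoʳ-≤ 1ℚ p≤1) (+-monoʳ-≤ 1ℚ p≤1)

  -- Passes through the sum at -ky: the Lipschitz bound pays for the exponent, Euler's approximation
  -- for the power. As 48δ ≤ 1, both exponents have absolute value at most 3.
  exp-power-diff : ∀ {δ C y} → 48ℚ * δ ≤ 1ℚ → 0ℚ ≤ C → 0ℚ ≤ y → y ≤ 1ℚ → y ≤ δ →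
    ∀ n → expSum 3ℚ n ≤ C → expSum 3ℚ (suc n) ≤ C → expTerm 3ℚ n ≤ δ →
    ∀ k u → fromℕ k * y ≤ + 2 / 1 → ∣ u - - (fromℕ k * y) ∣ ≤ 48ℚ * δ →
    ∣ expSum u (suc n) - (1ℚ - y) ^ k ∣ ≤ 50ℚ * (δ * C) + (δ + δ)
  exp-power-diff {δ} {C} {y} 48δ≤1 0≤C 0≤y y≤1 y≤δ n E≤C E′≤C t≤δ k u ky≤2 u≈u′ = begin
    ∣ E - Q ∣
      ≡⟨ cong ∣_∣ (solve 3 (λ e q x → e :- q := (e :- x) :+ (x :- q)) refl E Q E′) ⟩
    ∣ (E - E′) + (E′ - Q) ∣
      ≤⟨ ∣p+q∣≤∣p∣+∣q∣ (E - E′) (E′ - Q) ⟩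
    ∣ E - E′ ∣ + ∣ E′ - Q ∣
      ≤⟨ +-mono-≤
           (≤-trans (sum-lipschitz ∣u∣≤3 (≤-trans ∣u′∣≤2 2≤3) (suc n)) (*-mono (0≤∣p∣ (u - u′)) 0≤C u≈u′ E′≤C))
           (≤-trans (expSum-power 0≤y y≤1 n k (≤-trans ky≤2 2≤3))
             (*-monoʳ (0≤fromℕ k) (+-mono-≤ (*-monoʳ (0≤* 0≤y 0≤y) E≤C) (*-monoʳ 0≤y t≤δ)))) ⟩
    48ℚ * δ * C + fromℕ k * (y * y * C + y * δ)
      ≡⟨ cong (λ x → 48ℚ * δ * C + x)
           (solve 4 (λ k y C d → k :* (y :* y :* C :+ y :* d) := k :* y :* (y :* C :+ d)) refl (fromℕ k) y C δ) ⟩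
    48ℚ * δ * C + fromℕ k * y * (y * C + δ)
      ≤⟨ +-monoʳ-≤ (48ℚ * δ * C) (*-mono (0≤* (0≤fromℕ k) 0≤y) (0≤+ (0≤* 0≤δ 0≤C) 0≤δ)
           ky≤2 (+-monoˡ-≤ δ (*-monoˡ 0≤C y≤δ))) ⟩
    48ℚ * δ * C + (+ 2 / 1) * (δ * C + δ)
      ≡⟨ solve 2 (λ d C → con 48ℚ :* d :* C :+ con (+ 2 / 1) :* (d :* C :+ d) := con 50ℚ :* (d :* C) :+ (d :+ d)) refl δ C ⟩
    50ℚ * (δ * C) + (δ + δ) ∎
    where
    open ≤-Reasoning
    u′ = - (fromℕ k * y)
    E = expSum u (suc n)
    E′ = expSum u′ (suc n)
    Q = (1ℚ - y) ^ k
    0≤δ : 0ℚ ≤ δ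
    0≤δ = ≤-trans 0≤y y≤δ
    ∣u′∣≤2 : ∣ u′ ∣ ≤ + 2 / 1
    ∣u′∣≤2 = subst (_≤ + 2 / 1)
      (sym (trans (∣-p∣≡∣p∣ (fromℕ k * y)) (0≤p⇒∣p∣≡p (0≤* (0≤fromℕ k) 0≤y)))) ky≤2
    ∣u∣≤3 : ∣ u ∣ ≤ 3ℚ
    ∣u∣≤3 = ≤-trans (∣p∣≤∣q∣+∣p-q∣ u u′) (+-mono-≤ ∣u′∣≤2 (≤-trans u≈u′ 48δ≤1))

  module Approximation
    {δ D : ℚ} (0≤δ : 0ℚ ≤ δ) (48δ≤1 : 48ℚ * δ ≤ 1ℚ) (2δ≤D : δ + δ ≤ D)
    (m : ℕ) (y≤δ : recip m ≤ δ)
    {a b c : ℚ} (b≤a : b ≤ a + δ) (c≤b : c ≤ b + δ) (0≤c : 0ℚ ≤ c + δ)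
    (sum≤1 : a + b + c ≤ 1ℚ + δ) (1≤sum : 1ℚ ≤ a + b + c + δ)
    where

    open Mixtures m

    private

      0≤b+2δ : 0ℚ ≤ b + (δ + δ)
      0≤b+2δ = ≤-by (0≤+ (≤-slack c≤b) 0≤c)
        (solve 3 (λ b c d → b :+ (d :+ d) := con 0ℚ :+ ((b :+ d :- c) :+ (c :+ d))) refl b c δ)

      b≤½+2δ : b ≤ ½ + (δ + δ)
      b≤½+2δ = ≤-by (0≤* 0≤½ (0≤+ (0≤+ (≤-slack b≤a) 0≤c) (0≤+ (≤-slack sum≤1) 0≤δ)))
        (solve 4 (λ a b c d → con ½ :+ (d :+ d) := b :+ con ½ :*
          (((a :+ d :- b) :+ (c :+ d)) :+ ((con 1ℚ :+ d :- (a :+ b :+ c)) :+ d))) refl a b c δ)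

    ¼≤1-b : + 1 / 4 ≤ 1ℚ - b
    ¼≤1-b = ≤-by (0≤+ (≤-slack b≤½+2δ) (0≤+ (0≤* (<⇒≤ (positive⁻¹ (+ 1 / 24))) (≤-slack 48δ≤1)) (<⇒≤ (positive⁻¹ (+ 5 / 24)))))
      (solve 2 (λ b d → con 1ℚ :- b := con (+ 1 / 4) :+ ((con ½ :+ (d :+ d) :- b) :+
        (con (+ 1 / 24) :* (con 1ℚ :- con 48ℚ :* d) :+ con (+ 5 / 24)))) refl b δ)

    private

      1-b≤2 : 1ℚ - b ≤ 1ℚ + 1ℚ
      1-b≤2 = ≤-by (0≤+ 0≤b+2δ (0≤+ (0≤* (<⇒≤ (positive⁻¹ (+ 1 / 24))) (≤-slack 48δ≤1)) (<⇒≤ (positive⁻¹ (+ 23 / 24)))))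
        (solve 2 (λ b d → con 1ℚ :+ con 1ℚ := con 1ℚ :- b :+ ((b :+ (d :+ d)) :+
          (con (+ 1 / 24) :* (con 1ℚ :- con 48ℚ :* d) :+ con (+ 23 / 24)))) refl b δ)

      0≤1-b : 0ℚ ≤ 1ℚ - b
      0≤1-b = ≤-trans (<⇒≤ (positive⁻¹ (+ 1 / 4))) ¼≤1-b

      0≤3δ : 0ℚ ≤ 3ℚ * δ
      0≤3δ = 0≤* (<⇒≤ (positive⁻¹ 3ℚ)) 0≤δ

      y≤3δ : y ≤ 3ℚ * δ
      y≤3δ = ≤-by (0≤+ (≤-slack y≤δ) (0≤+ 0≤δ 0≤δ))
        (solve 2 (λ y d → con 3ℚ :* d := y :+ ((d :- y) :+ (d :+ d))) refl y δ)

    approx-b : ∃ λ k → k ℕ.≤ last × ∣ β k - b ∣ ≤ 3ℚ * δ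
    approx-b = discrete-IVT β last 0≤3δ
        (≤-trans β-0 (≤-by (0≤+ (≤-slack y≤δ) 0≤b+2δ)
          (solve 3 (λ y b d → b :+ con 3ℚ :* d := y :+ ((d :- y) :+ (b :+ (d :+ d)))) refl y b δ)))
        (subst (λ x → b ≤ x + 3ℚ * δ) (sym β-last) (≤-by (0≤+ (≤-slack b≤½+2δ) 0≤δ)
          (solve 2 (λ b d → con ½ :+ con 3ℚ :* d := b :+ ((con ½ :+ (d :+ d) :- b) :+ d)) refl b δ)))
        (λ k _ → ≤-trans (β-suc k) (+-monoʳ-≤ (β k) y≤3δ))

    -- `D` pays for the exponential and 3δ for replacing b by β. Since D ≥ 2δ, η also covers the
    -- slack at the upper end of the search for c.
    η : ℚ
    η = D + 3ℚ * δ

    private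

      0≤D : 0ℚ ≤ D
      0≤D = ≤-trans (0≤+ 0≤δ 0≤δ) 2δ≤D

      0≤η : 0ℚ ≤ η
      0≤η = 0≤+ 0≤D 0≤3δ

      5δ≤η : δ + δ + 3ℚ * δ ≤ η
      5δ≤η = +-monoˡ-≤ (3ℚ * δ) 2δ≤D

    module _ {E : ℚ} {k : ℕ} (β≈b : ∣ β k - b ∣ ≤ 3ℚ * δ)
      (f≤c : ½ * (1ℚ - b) * (1ℚ - E) ≤ c + δ) (∣E-Q∣≤D : ∣ E - (1ℚ - y) ^ suc k ∣ ≤ D) where

      private
        Q : ℚ
        Q = (1ℚ - y) ^ suc k

        b≈β : ∣ b - β k ∣ ≤ 3ℚ * δ
        b≈β = subst (_≤ 3ℚ * δ) (∣-∣-comm (β k) b) β≈b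

        γ-0≤ : γ k 0 ≤ c + η
        γ-0≤ = begin
          ½ * (1ℚ - q k 0) * w k
            ≡⟨ cong₂ (λ x z → ½ * (1ℚ - x) * z) (q-0 k) (w≡1-β k) ⟩
          ½ * (1ℚ - Q) * (1ℚ - β k)
            -- The truncated f(b), plus the effects of replacing E by Q and b by β.
            ≡⟨ solve 4 (λ Q b β E → con ½ :* (con 1ℚ :- Q) :* (con 1ℚ :- β) :=
                 con ½ :* (con 1ℚ :- b) :* (con 1ℚ :- E) :+ con ½ :* ((con 1ℚ :- b) :* (E :- Q) :+ (b :- β) :* (con 1ℚ :- Q)))
                 refl Q b (β k) E ⟩
          ½ * (1ℚ - b) * (1ℚ - E) + ½ * ((1ℚ - b) * (E - Q) + (b - β k) * (1ℚ - Q))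
            ≤⟨ +-mono-≤ f≤c (*-monoʳ 0≤½ (+-mono-≤
                 (≤-trans (p*q≤∣p∣*∣q∣ (1ℚ - b) (E - Q)) (*-mono (0≤∣p∣ (1ℚ - b)) 0≤D
                   (subst (_≤ 1ℚ + 1ℚ) (sym (0≤p⇒∣p∣≡p 0≤1-b)) 1-b≤2) ∣E-Q∣≤D))
                 (≤-trans (p*q≤∣p∣*∣q∣ (b - β k) (1ℚ - Q)) (*-mono (0≤∣p∣ (b - β k)) 0≤1
                   b≈β (subst (_≤ 1ℚ) (sym (0≤p⇒∣p∣≡p (≤-slack Q≤1))) 1-Q≤1))))) ⟩
          (c + δ) + ½ * ((1ℚ + 1ℚ) * D + 3ℚ * δ * 1ℚ)
            ≤⟨ ≤-by (0≤* 0≤½ 0≤δ)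
                 (solve 3 (λ c d D → c :+ (D :+ con 3ℚ :* d) := (c :+ d) :+
                   con ½ :* ((con 1ℚ :+ con 1ℚ) :* D :+ con 3ℚ :* d :* con 1ℚ) :+ con ½ :* d) refl c δ D) ⟩
          c + η ∎
          where
          open ≤-Reasoning
          Q≤1 : Q ≤ 1ℚ
          Q≤1 = ^≤1 0≤1-y 1-y≤1 (suc k)
          1-Q≤1 : 1ℚ - Q ≤ 1ℚ
          1-Q≤1 = ≤-by (0≤^ 0≤1-y 1-y≤1 (suc k)) (solve 1 (λ Q → con 1ℚ := con 1ℚ :- Q :+ Q) refl Q)

        c≤β : c ≤ β k + η
        c≤β = ≤-by (0≤+ (0≤+ (≤-slack c≤b) (≤-slack (≤-trans (p≤∣p∣ (b - β k)) b≈β))) (0≤+ (≤-slack 5δ≤η) 0≤δ))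
          (solve 5 (λ c b β d η → β :+ η := c :+ (((b :+ d :- c) :+ (con 3ℚ :* d :- (b :- β))) :+
            ((η :- (d :+ d :+ con 3ℚ :* d)) :+ d))) refl c b (β k) δ η)

        -- From c ≤ b ≤ a, twice c is at most a + c = 1-b, up to slack.
        c≤½w : c ≤ ½ * w k + η
        c≤½w = subst (λ x → c ≤ ½ * x + η) (sym (w≡1-β k))
          (≤-by (0≤+ (0≤* 0≤½ (0≤+ (0≤+ (≤-slack c≤b) (≤-slack b≤a))
                      (0≤+ (≤-slack sum≤1) (≤-slack (≤-trans (p≤∣p∣ (β k - b)) β≈b)))))
                    (0≤+ (≤-slack 5δ≤η) (0≤* (<⇒≤ (positive⁻¹ (+ 2 / 1))) 0≤δ)))
            (solve 6 (λ a b c β d η → con ½ :* (con 1ℚ :- β) :+ η := c :+ (con ½ :* (((b :+ d :- c) :+ (a :+ d :- b)) :+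
              ((con 1ℚ :+ d :- (a :+ b :+ c)) :+ (con 3ℚ :* d :- (β :- b)))) :+
              ((η :- (d :+ d :+ con 3ℚ :* d)) :+ con (+ 2 / 1) :* d))) refl a b c (β k) δ η))

        c≤γ : c ≤ γ k (k ℕ.⊓ m) + η
        c≤γ = [ (λ k≤m → subst (λ x → c ≤ x + η) (sym (trans (cong (γ k) (ℕₚ.m≤n⇒m⊓n≡m k≤m)) (γ-k k))) c≤β)
              , (λ m≤k → subst (λ x → c ≤ x + η) (sym (trans (cong (γ k) (ℕₚ.m≥n⇒m⊓n≡n m≤k)) (γ-m k))) c≤½w)
              ]′ (ℕₚ.≤-total k m)

        y≤η : y ≤ η
        y≤η = ≤-trans y≤3δ (subst (3ℚ * δ ≤_) (+-comm (3ℚ * δ) D) (p≤p+q 0≤D))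

      approx-c : ∃ λ i → i ℕ.≤ k ℕ.⊓ m × ∣ γ k i - c ∣ ≤ η
      approx-c = discrete-IVT (γ k) (k ℕ.⊓ m) 0≤η γ-0≤ c≤γ
          (λ i i< → ≤-trans (γ-suc (ℕₚ.<-≤-trans i< (ℕₚ.m⊓n≤m k m)) (ℕₚ.<-≤-trans i< (ℕₚ.m⊓n≤n k m)))
                      (+-monoʳ-≤ (γ k i) y≤η))

    error : ℚ
    error = η + 4ℚ * δ

    module _ {k i : ℕ} (β≈b : ∣ β k - b ∣ ≤ 3ℚ * δ) (γ≈c : ∣ γ k i - c ∣ ≤ η) where

      β-error : ∣ p k * w k - b ∣ ≤ error
      β-error = ≤-trans β≈b (≤-by (0≤+ 0≤η 0≤δ)
        (solve 2 (λ η d → η :+ con 4ℚ :* d := con 3ℚ :* d :+ (η :+ d)) refl η δ))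

      γ-error : ∣ ½ * (1ℚ - q k i) * w k - c ∣ ≤ error
      γ-error = ≤-trans γ≈c (p≤p+q (0≤* (<⇒≤ (positive⁻¹ 4ℚ)) 0≤δ))

      -- The realized entries sum to 1 because w = 1-β, so this error is at most the other two plus
      -- the slack of a + b + c: η + 3δ + δ.
      α-error : ∣ ½ * (1ℚ + q k i) * w k - a ∣ ≤ error
      α-error = begin
        ∣ ½ * (1ℚ + q k i) * w k - a ∣
          ≡⟨ cong ∣_∣ (trans (split (q k i) (w k) a) (cong (λ x → x - γ k i - a) (w≡1-β k))) ⟩
        ∣ 1ℚ - β k - γ k i - a ∣
          ≡⟨ cong ∣_∣ (rearrange (β k) (γ k i) a b c) ⟩
        ∣ (c - γ k i) + ((b - β k) + (1ℚ - (a + b + c))) ∣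
          ≤⟨ ≤-trans (∣p+q∣≤∣p∣+∣q∣ (c - γ k i) ((b - β k) + (1ℚ - (a + b + c))))
               (+-monoʳ-≤ ∣ c - γ k i ∣ (∣p+q∣≤∣p∣+∣q∣ (b - β k) (1ℚ - (a + b + c)))) ⟩
        ∣ c - γ k i ∣ + (∣ b - β k ∣ + ∣ 1ℚ - (a + b + c) ∣)
          ≤⟨ +-mono-≤ (subst (_≤ η) (∣-∣-comm (γ k i) c) γ≈c)
               (+-mono-≤ (subst (_≤ 3ℚ * δ) (∣-∣-comm (β k) b) β≈b) (∣∣-lub
                 (p≤q+r⇒p-q≤r {1ℚ} {a + b + c} {δ} 1≤sum)
                 (≤-by (≤-slack sum≤1) (solve 2 (λ s d → d := :- (con 1ℚ :- s) :+ (con 1ℚ :+ d :- s)) refl (a + b + c) δ)))) ⟩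
        η + (3ℚ * δ + δ)
          ≡⟨ cong (λ x → η + x) (solve 1 (λ d → con 3ℚ :* d :+ d := con 4ℚ :* d) refl δ) ⟩
        η + 4ℚ * δ ∎
        where
        open ≤-Reasoning
        split : ∀ q w a → ½ * (1ℚ + q) * w - a ≡ w - ½ * (1ℚ - q) * w - a
        split = solve 3 (λ q w a → con ½ :* (con 1ℚ :+ q) :* w :- a := w :- con ½ :* (con 1ℚ :- q) :* w :- a) refl
        rearrange : ∀ β γ a b c → 1ℚ - β - γ - a ≡ (c - γ) + ((b - β) + (1ℚ - (a + b + c)))
        rearrange = solve 5 (λ β γ a b c →
          con 1ℚ :- β :- γ :- a := (c :- γ) :+ ((b :- β) :+ (con 1ℚ :- (a :+ b :+ c)))) refl

-- Real targets

-- a, b, c stand for the n-th terms of α, β, γ; n is also where exp is truncated.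
record NearlyInS (δ : ℚ) (n : ℕ) (a b c : ℚ) : Set where
  constructor nearly
  open ℚ using (_≤_; _+_; _-_; _*_; _/_)
  field
    b≤a   : b ≤ a + δ
    c≤b   : c ≤ b + δ
    0≤c   : 0ℚ ≤ c + δ
    sum≤1 : a + b + c ≤ 1ℚ + δ
    1≤sum : 1ℚ ≤ a + b + c + δ
    f≤c   : ½ * (1ℚ - b) * (1ℚ - expSum ((+ 2 / 1) * b * inv (b - 1ℚ)) n) ≤ c + δ

Approximable : (a b c ε : ℚ) → Set₁
Approximable a b c ε = (π : Permutation′ 3) → ∃ λ (G : Gadget) → ∃ λ (σ : Vector ℚ 3) →
  HasSignature G σ × (∀ i → ℚ.∣ σ i ℚ.- (a ∷ b ∷ c ∷ []) (π ⟨$⟩ʳ i) ∣ ℚ.≤ ε)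

module _ where

  open CauchyLemmas using (bounded)
  open ExpLemmas using (sum-cauchy; module Tail)
  open ℚ using (_+_; _*_; _-_; -_; ∣_∣; _≤_; _<_)
  open ℚₚ

  approximable : ∀ {δ C} → 0ℚ ≤ δ → 48ℚ * δ ≤ 1ℚ → 0ℚ ≤ C →
    ∀ m → recip m ≤ δ → ∀ n → expSum 3ℚ n ≤ C → expSum 3ℚ (suc n) ≤ C → expTerm 3ℚ n ≤ δ →
    ∀ {a b c} → NearlyInS δ (suc n) a b c → Approximable a b c ((50ℚ * (δ * C) + (δ + δ)) + 3ℚ * δ + 4ℚ * δ)
  approximable {δ} {C} 0≤δ 48δ≤1 0≤C m y≤δ n E≤C E′≤C t≤δ {a} {b} {c} (nearly b≤a c≤b 0≤c sum≤1 1≤sum f≤c) = go approx-b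
    where
    open Mixtures m
    D : ℚ
    D = 50ℚ * (δ * C) + (δ + δ)
    2δ≤D : δ + δ ≤ D
    2δ≤D = ≤-by (0≤* (<⇒≤ (positive⁻¹ 50ℚ)) (0≤* 0≤δ 0≤C)) (+-comm (50ℚ * (δ * C)) (δ + δ))
    open Approximation {δ} {D} 0≤δ 48δ≤1 2δ≤D m y≤δ {a} {b} {c} b≤a c≤b 0≤c sum≤1 1≤sum
    go : (∃ λ k → k ℕ.≤ last × ∣ β k - b ∣ ≤ 3ℚ * δ) → Approximable a b c error
    go (k , k≤last , β≈b) π = pick (approx-c {E} {k} β≈b f≤c E-Q)
      where
      u E : ℚ
      u = (+ 2 ℚ./ 1) * b * inv (b - 1ℚ)
      E = expSum u (suc n)
      E-Q : ∣ E - (1ℚ - y) ^ suc k ∣ ≤ D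
      E-Q = exp-power-diff 48δ≤1 0≤C 0≤y y≤1 y≤δ n E≤C E′≤C t≤δ (suc k) u
        (subst (_≤ 1ℚ + 1ℚ) (sym (2p≡ky k)) (+-mono-≤ (p≤1 k≤last) (p≤1 k≤last)))
        (subst (λ x → ∣ u - - x ∣ ≤ 48ℚ * δ) (sym (2p≡ky k))
          (exponent-diff {δ} {b} ¼≤1-b {p k} {w k} (w-inverse k) (0≤p k) (p≤1 k≤last)
            (subst (_≤ 3ℚ * δ) (∣-∣-comm (β k) b) β≈b)))
      v : Vector ℚ 3
      v = a ∷ b ∷ c ∷ []
      v′ : ℕ → Vector ℚ 3
      v′ i = (½ * (1ℚ + q k i) * w k) ∷ (p k * w k) ∷ (½ * (1ℚ - q k i) * w k) ∷ []
      weaken : ∀ i → ∣ γ k i - c ∣ ≤ η →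
        (∃ λ (G : Gadget) → ∃ λ (σ : Vector ℚ 3) → HasSignature G σ × (∀ j → σ j ≡ v′ i (π ⟨$⟩ʳ j))) →
        ∃ λ (G : Gadget) → ∃ λ (σ : Vector ℚ 3) → HasSignature G σ × (∀ j → ∣ σ j - v (π ⟨$⟩ʳ j) ∣ ≤ error)
      weaken i γ≈c (G , σ , has , σ≡) = G , σ , has , λ j → subst
        (λ x → ∣ x - v (π ⟨$⟩ʳ j) ∣ ≤ error) (sym (σ≡ j)) (close (π ⟨$⟩ʳ j))
        where
        close : ∀ l → ∣ v′ i l - v l ∣ ≤ error
        close 0F = α-error {k} {i} β≈b γ≈c
        close 1F = β-error {k} {i} β≈b γ≈c
        close 2F = γ-error {k} {i} β≈b γ≈c
      pick : (∃ λ i → i ℕ.≤ k ℕ.⊓ m × ∣ γ k i - c ∣ ≤ η) → _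
      pick (i , i≤ , γ≈c) = weaken i γ≈c
        (signature (realizes (ℕₚ.≤-trans i≤ (ℕₚ.m⊓n≤m k m)) (ℕₚ.≤-trans i≤ (ℕₚ.m⊓n≤n k m))) (w-inverse k) π)

  -- One choice serves two ends: (50C + 48)δ = min(ε, 1) gives 48δ ≤ 1 and bounds the total error
  -- 50Cδ + 9δ by ε.
  approximation : ∀ ε → 0ℚ < ε → ∃ λ δ → 0ℚ < δ × ∃ λ N →
    ∀ n → N ℕ.≤ n → ∀ {a b c} → NearlyInS δ (suc n) a b c → Approximable a b c ε
  approximation ε 0<ε = go (bounded (sum-cauchy 0≤3))
    where
    0≤3 : 0ℚ ≤ 3ℚ
    0≤3 = <⇒≤ (positive⁻¹ 3ℚ)
    go : (∃ λ C → 0ℚ < C × Eventually (λ n → ∣ expSum 3ℚ n ∣ ≤ C)) → _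
    go (C , 0<C , N₁ , hC) = go′ (quotient (50ℚ * C + 48ℚ) (ε ⊓ 1ℚ) 0<K 0<ε⊓1)
      where
      open ℚ using (_⊓_)
      0<K : 0ℚ < 50ℚ * C + 48ℚ
      0<K = +-mono-< (0<* (positive⁻¹ 50ℚ) 0<C) (positive⁻¹ 48ℚ)
      0<ε⊓1 : 0ℚ < ε ⊓ 1ℚ
      0<ε⊓1 with ⊓-sel ε 1ℚ
      ... | inj₁ e = subst (0ℚ <_) (sym e) 0<ε
      ... | inj₂ e = subst (0ℚ <_) (sym e) 0<1
      go′ : (∃ λ δ → 0ℚ < δ × (50ℚ * C + 48ℚ) * δ ≡ ε ⊓ 1ℚ) → _
      go′ (δ , 0<δ , Kδ≡) = δ , 0<δ , N₁ ℕ.⊔ proj₁ small-term , λ n N≤n {a} {b} {c} near π →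
        let N₁≤n = ℕₚ.m⊔n≤o⇒m≤o N₁ (proj₁ small-term) N≤n in
        weaken (approximable 0≤δ 48δ≤1 0≤C m y≤δ n
          (bound n N₁≤n) (bound (suc n) (ℕₚ.≤-trans N₁≤n (ℕₚ.n≤1+n n)))
          (proj₂ small-term n (ℕₚ.m⊔n≤o⇒n≤o N₁ (proj₁ small-term) N≤n)) near π)
        where
        0≤δ = <⇒≤ 0<δ
        0≤C = <⇒≤ 0<C
        Kδ≤ : ∀ {x r} → ε ⊓ 1ℚ ≤ r → x ≤ (50ℚ * C + 48ℚ) * δ → x ≤ r
        Kδ≤ le h = ≤-trans h (≤-trans (≤-reflexive Kδ≡) le)
        48δ≤1 : 48ℚ * δ ≤ 1ℚ
        48δ≤1 = Kδ≤ (p⊓q≤q ε 1ℚ) (≤-by (0≤* (<⇒≤ (positive⁻¹ 50ℚ)) (0≤* 0≤δ 0≤C))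
          (solve 2 (λ d C → (con 50ℚ :* C :+ con 48ℚ) :* d := con 48ℚ :* d :+ con 50ℚ :* (d :* C)) refl δ C))
        error≤ε : (50ℚ * (δ * C) + (δ + δ)) + 3ℚ * δ + 4ℚ * δ ≤ ε
        error≤ε = Kδ≤ (p⊓q≤p ε 1ℚ) (≤-by (0≤* (<⇒≤ (positive⁻¹ (+ 39 ℚ./ 1))) 0≤δ)
          (solve 2 (λ d C → (con 50ℚ :* C :+ con 48ℚ) :* d := (con 50ℚ :* (d :* C) :+ (d :+ d)) :+ con 3ℚ :* d :+ con 4ℚ :* d :+ con (+ 39 ℚ./ 1) :* d) refl δ C))
        small-recip = recip-small 1ℚ δ 0<δ
        m = proj₁ small-recip
        y≤δ : recip m ≤ δ
        y≤δ = subst (_≤ δ) (*-identityˡ (recip m)) (proj₂ small-recip m ℕₚ.≤-refl)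
        -- `Tail` starts at an index K ≥ 2B, from which successive terms at least halve; here B = 3.
        6≤6 : (1ℚ + 1ℚ) * 3ℚ ≤ fromℕ 6
        6≤6 = ≤-refl
        small-term = Tail.term→0 0≤3 6 6≤6 δ 0<δ
        bound : ∀ n → N₁ ℕ.≤ n → expSum 3ℚ n ≤ C
        bound n le = ≤-trans (p≤∣p∣ (expSum 3ℚ n)) (hC n le)
        weaken : ∀ {v : Vector ℚ 3} → (∃ λ (G : Gadget) → ∃ λ (σ : Vector ℚ 3) →
                   HasSignature G σ × (∀ i → ∣ σ i - v i ∣ ≤ (50ℚ * (δ * C) + (δ + δ)) + 3ℚ * δ + 4ℚ * δ)) →
                 ∃ λ (G : Gadget) → ∃ λ (σ : Vector ℚ 3) → HasSignature G σ × (∀ i → ∣ σ i - v i ∣ ≤ ε)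
        weaken (G , σ , has , h) = G , σ , has , λ i → ≤-trans (h i) error≤ε

_∧ᴱ_ : ∀ {P Q : ℕ → Set} → Eventually P → Eventually Q → Eventually (λ n → P n × Q n)
(M , p) ∧ᴱ (N , q) = M ℕ.⊔ N , λ n le → p n (ℕₚ.m⊔n≤o⇒m≤o M N le) , q n (ℕₚ.m⊔n≤o⇒n≤o M N le)

eventually-all : ∀ {P : Fin 3 → ℕ → Set} → (∀ i → Eventually (P i)) → Eventually (λ n → ∀ i → P i n)
eventually-all h with h 0F ∧ᴱ (h 1F ∧ᴱ h 2F)
... | N , p = N , λ n le → λ where
  0F → proj₁ (p n le)
  1F → proj₁ (proj₂ (p n le))
  2F → proj₂ (proj₂ (p n le))

≃⇒close : ∀ {x y} → x Defs.≃ y → ∀ δ → 0ℚ ℚ.< δ → Eventually (λ n → ℚ.∣ seq x n ℚ.- seq y n ∣ ℚ.≤ δ)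
≃⇒close {x} {y} (x≤y , y≤x) δ 0<δ with x≤y δ 0<δ ∧ᴱ y≤x δ 0<δ
... | N , h = N , λ n le → ∣∣-lub (p≤q+r⇒p-q≤r {seq x n} {seq y n} {δ} (proj₁ (h n le)))
  (subst (ℚ._≤ δ) (solve 2 (λ x y → y :- x := :- (x :- y)) refl (seq x n) (seq y n))
    (p≤q+r⇒p-q≤r {seq y n} {seq x n} {δ} (proj₂ (h n le))))

triangle : ∀ w x y z {δ} → ℚ.∣ w ℚ.- x ∣ ℚ.≤ δ → ℚ.∣ x ℚ.- y ∣ ℚ.≤ δ → ℚ.∣ z ℚ.- y ∣ ℚ.≤ δ →
           ℚ.∣ w ℚ.- z ∣ ℚ.≤ δ ℚ.+ (δ ℚ.+ δ)
triangle w x y z {δ} p q r = begin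
  ∣ w - z ∣
    ≡⟨ cong ∣_∣ (solve 4 (λ w x y z → w :- z := (w :- x) :+ ((x :- y) :+ (y :- z))) refl w x y z) ⟩
  ∣ (w - x) + ((x - y) + (y - z)) ∣
    ≤⟨ ℚₚ.≤-trans (ℚₚ.∣p+q∣≤∣p∣+∣q∣ (w - x) ((x - y) + (y - z)))
         (ℚₚ.+-monoʳ-≤ ∣ w - x ∣ (ℚₚ.∣p+q∣≤∣p∣+∣q∣ (x - y) (y - z))) ⟩
  ∣ w - x ∣ + (∣ x - y ∣ + ∣ y - z ∣)
    ≤⟨ ℚₚ.+-mono-≤ p (ℚₚ.+-mono-≤ q (subst (_≤ δ) (∣-∣-comm z y) r)) ⟩
  δ + (δ + δ) ∎
  where
  open ℚ using (_+_; _-_; ∣_∣; _≤_)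
  open ℚₚ.≤-Reasoning

nearlyInS : ∀ {s} (s∈S : s ∈S) → let open _∈S s∈S in ∀ δ → 0ℚ ℚ.< δ →
            Eventually (λ n → NearlyInS δ n (seq α n) (seq β n) (seq γ n))
nearlyInS s∈S δ 0<δ with α≥β δ 0<δ ∧ᴱ (β≥γ δ 0<δ ∧ᴱ (γ≥0 δ 0<δ ∧ᴱ
    (proj₁ sum≃1 δ 0<δ ∧ᴱ (proj₂ sum≃1 δ 0<δ ∧ᴱ γ≥f[β] δ 0<δ))))
  where open _∈S s∈S
... | N , h = N , λ n le → let h₁ , h₂ , h₃ , h₄ , h₅ , h₆ = h n le in nearly h₁ h₂ h₃ h₄ h₅ h₆

-- A gadget found for one late rational term serves all later ones. The three η separate s from its
-- permuted triple, later terms from the chosen one, and the chosen one from the signature.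
approximates : ∀ {s} → s ∈S → ∀ {η} → 0ℚ ℚ.< η →
  (∃ λ δ → 0ℚ ℚ.< δ × ∃ λ N → ∀ n → N ℕ.≤ n → ∀ {a b c} → NearlyInS δ (suc n) a b c → Approximable a b c η) →
  ∃ λ (G : Gadget) → ∃ λ (σ : Vector ℚ 3) → HasSignature G σ ×
    Eventually λ k → ∀ i → ℚ.∣ seq (s i) k ℚ.- σ i ∣ ℚ.≤ η ℚ.+ (η ℚ.+ η)
approximates {s} s∈S {η} 0<η (δ , 0<δ , N₁ , approx) = go
  (nearlyInS s∈S δ 0<δ) (eventually-all λ i → ≃⇒close {s i} {v (π ⟨$⟩ʳ i)} (s≃Pαβγ i) η 0<η)
  (eventual-modulus 0F ∧ᴱ (eventual-modulus 1F ∧ᴱ eventual-modulus 2F))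
  where
  open _∈S s∈S
  v : Vector ℝ 3
  v = α ∷ β ∷ γ ∷ []
  Stable : Fin 3 → ℕ → Set
  Stable i N = ∀ k → N ℕ.≤ k → ℚ.∣ seq (v i) k ℚ.- seq (v i) N ∣ ℚ.≤ η
  eventual-modulus : ∀ i → Eventually (Stable i)
  eventual-modulus i with modulus (isCauchy (v i)) η 0<η
  ... | N , h = N , λ n N≤n k n≤k → h k n (ℕₚ.≤-trans N≤n n≤k) N≤n
  go : Eventually (λ n → NearlyInS δ n (seq α n) (seq β n) (seq γ n)) →
       Eventually (λ n → ∀ i → ℚ.∣ seq (s i) n ℚ.- seq (v (π ⟨$⟩ʳ i)) n ∣ ℚ.≤ η) →
       Eventually (λ n → Stable 0F n × Stable 1F n × Stable 2F n) →
       ∃ λ (G : Gadget) → ∃ λ (σ : Vector ℚ 3) → HasSignature G σ ×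
         Eventually λ k → ∀ i → ℚ.∣ seq (s i) k ℚ.- σ i ∣ ℚ.≤ η ℚ.+ (η ℚ.+ η)
  go (N₂ , near) (N₃ , s≈v) (N₄ , stable) = finish (approx n N₁≤n (near (suc n) N₂≤n) π)
    where
    -- The chosen term has index `suc n`, because exp is truncated at the index of the term and
    -- `approx` speaks of sums with `suc n` terms.
    n = N₁ ℕ.⊔ (N₂ ℕ.⊔ N₄)
    N₁≤n : N₁ ℕ.≤ n
    N₁≤n = ℕₚ.m≤m⊔n N₁ _
    N₂≤n : N₂ ℕ.≤ suc n
    N₂≤n = ℕₚ.m≤n⇒m≤1+n (ℕₚ.≤-trans (ℕₚ.m≤m⊔n N₂ N₄) (ℕₚ.m≤n⊔m N₁ _))
    N₄≤n : N₄ ℕ.≤ suc n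
    N₄≤n = ℕₚ.m≤n⇒m≤1+n (ℕₚ.≤-trans (ℕₚ.m≤n⊔m N₂ N₄) (ℕₚ.m≤n⊔m N₁ _))
    w : Vector ℚ 3
    w = seq α (suc n) ∷ seq β (suc n) ∷ seq γ (suc n) ∷ []
    v≈w : ∀ i k → suc n ℕ.≤ k → ℚ.∣ seq (v i) k ℚ.- w i ∣ ℚ.≤ η
    v≈w 0F = proj₁ (stable (suc n) N₄≤n)
    v≈w 1F = proj₁ (proj₂ (stable (suc n) N₄≤n))
    v≈w 2F = proj₂ (proj₂ (stable (suc n) N₄≤n))
    finish : (∃ λ (G : Gadget) → ∃ λ (σ : Vector ℚ 3) →
               HasSignature G σ × (∀ i → ℚ.∣ σ i ℚ.- w (π ⟨$⟩ʳ i) ∣ ℚ.≤ η)) → _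
    finish (G , σ , has , σ≈w) = G , σ , has , N₃ ℕ.⊔ suc n , λ k le i →
      triangle (seq (s i) k) (seq (v (π ⟨$⟩ʳ i)) k) (w (π ⟨$⟩ʳ i)) (σ i)
        (s≈v k (ℕₚ.m⊔n≤o⇒m≤o N₃ (suc n) le) i)
        (v≈w (π ⟨$⟩ʳ i) k (ℕₚ.m⊔n≤o⇒n≤o N₃ (suc n) le))
        (σ≈w i)

open Defs using (_≤_; _<_; _-_)

theorem6 : (s : Vector ℝ 3) → s ∈S →
    (ε : ℝ) → 0ℝ < ε →
    ∃ λ (G : Gadget) → ∃ λ (σ : Vector ℚ 3) →
    HasSignature G σ × ‖ zipWith _-_ s (map fromℚ σ) ‖₁ ≤ ε
-- ε₀ is the rational lower bound carried by `0ℝ < ε`. Each of the three coordinates costs 3η, so η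
-- = ε₀/9.
theorem6 s s∈S ε (ε₀ , 0<ε₀ , N₀ , ε₀≤ε) = go (quotient (+ 9 ℚ./ 1) ε₀ (ℚₚ.positive⁻¹ (+ 9 ℚ./ 1)) 0<ε₀)
  where
  go : (∃ λ η → 0ℚ ℚ.< η × (+ 9 ℚ./ 1) ℚ.* η ≡ ε₀) → _
  go (η , 0<η , 9η≡ε₀) = conclude (approximates s∈S 0<η (approximation η 0<η))
    where
    total : (η ℚ.+ (η ℚ.+ η)) ℚ.+ ((η ℚ.+ (η ℚ.+ η)) ℚ.+ ((η ℚ.+ (η ℚ.+ η)) ℚ.+ 0ℚ)) ≡ 0ℚ ℚ.+ ε₀
    total = trans
      (solve 1 (λ η → let t = η :+ (η :+ η) in t :+ (t :+ (t :+ con 0ℚ)) := con 0ℚ :+ con (+ 9 ℚ./ 1) :* η) refl η)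
      (cong (λ x → 0ℚ ℚ.+ x) 9η≡ε₀)
    conclude : (∃ λ (G : Gadget) → ∃ λ (σ : Vector ℚ 3) → HasSignature G σ ×
                 Eventually λ k → ∀ i → ℚ.∣ seq (s i) k ℚ.- σ i ∣ ℚ.≤ η ℚ.+ (η ℚ.+ η)) → _
    conclude (G , σ , has , N , close) = G , σ , has , λ ε′ 0<ε′ → N₀ ℕ.⊔ N , λ k le →
      let c = close k (ℕₚ.m⊔n≤o⇒n≤o N₀ N le) in
      ℚₚ.≤-trans (ℚₚ.+-mono-≤ (c 0F) (ℚₚ.+-mono-≤ (c 1F) (ℚₚ.+-monoˡ-≤ 0ℚ (c 2F))))
        (ℚₚ.≤-trans (ℚₚ.≤-reflexive total)
          (ℚₚ.≤-trans (ε₀≤ε k (ℕₚ.m⊔n≤o⇒m≤o N₀ N le)) (p≤p+q (ℚₚ.<⇒≤ 0<ε′))))
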